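{- For $n\geq 1$, with $N_n(t,q,r)=\sum_{\sigma\in\mathfrak{S}_n(321)}t^{\mathsf{exc}\,\sigma}q^{\mathsf{inv}\,\sigma}r^{\mathsf{fix}\,\sigma}$, $$N_n(t, q, t)=\sum_{k=1}^{\lfloor\frac{n+1}{2}\rfloor}\widetilde\gamma_{n-1, k-1}(q)t^k(1+t/q)^{n+1-2k},$$ where $$\widetilde{\gamma}_{n-1, k-1}(q)=\sum_{\pi\in\widetilde{\mathfrak{S}}_{n-1,k-1}(321)}q^{n-1+\mathsf{inv}\,\pi-\mathsf{exc}\,\pi}=\sum_{\pi\in\widetilde{\mathfrak{S}}_{n-1,k-1}(231)}q^{n-1+(31\text{ - }2)\pi}=\sum_{\pi\in\widetilde{\mathfrak{S}}_{n-1,k-1}(312)}q^{n-1+(2\text{ - }31)\pi}=\sum_{\pi\in\widetilde{\mathfrak{S}}_{n-1,k-1}(132)}q^{n-1+(2\text{ - }13)\pi}=\sum_{\pi\in\widetilde{\mathfrak{S}}_{n-1,k-1}(213)}q^{n-1+(13\text{ - }2)\pi}.$$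
   Context: $\mathfrak{S}_m(\tau)$ is the set of permutations of $[m]$ avoiding the classical pattern $\tau$. For $\sigma\in\mathfrak{S}_m$: $\mathsf{exc},\mathsf{fix},\mathsf{inv}$ are the numbers of excedances ($\sigma(i)>i$), fixed points and inversions; $\mathsf{des}\,\sigma=\#\{i\in[m-1]:\sigma(i)>\sigma(i+1)\}$, $\mathsf{asc}\,\sigma=\#\{i\in[m-1]:\sigma(i)<\sigma(i+1)\}$. $(31\text{ - }2)\sigma=\#\{(i,j):i+1<j\le m,\ \sigma(i+1)<\sigma(j)<\sigma(i)\}$, $(2\text{ - }31)\sigma=\#\{(i,j):j<i<m,\ \sigma(i+1)<\sigma(j)<\sigma(i)\}$, $(2\text{ - }13)\sigma=\#\{(i,j):j<i<m,\ \sigma(i)<\sigma(j)<\sigma(i+1)\}$, $(13\text{ - }2)\sigma=\#\{(i,j):i+1<j\le m,\ \sigma(i)<\sigma(j)<\sigma(i+1)\}$. $\mathsf{cda}\,\sigma$ is the number of values $x$ with $\sigma^{ -1}(x)<x<\sigma(x)$. $\mathsf{ldd}\,\sigma$ is the number of $i\in[m]$ with $\sigma(i-1)>\sigma(i)>\sigma(i+1)$ under the convention $\sigma(0)=0,\sigma(m+1)=\infty$; $\mathsf{rda}\,\sigma$ is the number of $i\in[m]$ with $\sigma(i-1)<\sigma(i)<\sigma(i+1)$ under the convention $\sigma(0)=\infty,\sigma(m+1)=0$. For $0\le k\le m$: $\widetilde{\mathfrak{S}}_{m,k}(321)=\{\sigma\in\mathfrak{S}_m(321):\mathsf{exc}\,\sigma=k,\mathsf{cda}\,\sigma=0\}$,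 $\widetilde{\mathfrak{S}}_{m,k}(213)=\{\sigma\in\mathfrak{S}_m(213):\mathsf{asc}\,\sigma=k,\mathsf{rda}\,\sigma=0\}$, $\widetilde{\mathfrak{S}}_{m,k}(312)=\{\sigma\in\mathfrak{S}_m(312):\mathsf{des}\,\sigma=k,\mathsf{ldd}\,\sigma=0\}$, $\widetilde{\mathfrak{S}}_{m,k}(132)=\{\sigma\in\mathfrak{S}_m(132):\mathsf{asc}\,\sigma=k,\mathsf{rda}\,\sigma=0\}$, $\widetilde{\mathfrak{S}}_{m,k}(231)=\{\sigma\in\mathfrak{S}_m(231):\mathsf{des}\,\sigma=k,\mathsf{ldd}\,\sigma=0\}$. -}

module Defs where

open import Algebra.Bundles using (CommutativeRing)
open import Data.Fin as Fin using (Fin; zero; suc; toℕ; inject₁; punchIn)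
import Data.Fin.Properties as Fin
open import Data.Fin.Permutation using (Permutation′; _⟨$⟩ʳ_; _⟨$⟩ˡ_; _≈_; id; insert; remove; insert-punchIn; punchIn-permute)
open import Data.List using (List; []; _∷_; map; concatMap; filter; length; foldr; allFin; applyUpTo; cartesianProduct)
open import Data.List.Membership.Propositional using (lose)
open import Data.List.Membership.Propositional.Properties using (∈-allFin)
open import Data.List.Relation.Unary.All as All using (All)
import Data.List.Relation.Unary.All.Properties as All
open import Data.List.Relation.Unary.AllPairs as AllPairs using (AllPairs; []; _∷_)
import Data.List.Relation.Unary.AllPairs.Properties as AllPairs
open import Data.List.Relation.Unary.Any as Any using (Any; here)
import Data.List.Relation.Unary.Any.Properties as Any
open import Data.List.Relation.Unary.Unique.Propositional.Properties using (allFin⁺)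
open import Data.Nat as ℕ using (ℕ; zero; suc; pred; _≟_)
open import Data.Product using (_×_; _,_; uncurry)
open import Data.Vec using (Vec; []; _∷_; _∷ʳ_; lookup; tabulate)
open import Relation.Binary.Construct.Add.Supremum.Strict ℕ._<_ using (<⁺-dec)
open import Relation.Binary.PropositionalEquality using (_≡_; _≢_; refl; sym; trans; cong)
open import Relation.Nullary using (Dec; ¬_)
open import Relation.Nullary.Construct.Add.Supremum using (_⁺; ⊤⁺; [_])
open import Relation.Nullary.Decidable using (_×-dec_; _→-dec_; ¬?; map′)
open import Relation.Unary using (Decidable)

private
  variable
    m n k : ℕ

-- [m] is represented by Fin m: positions and values are both shifted down
-- by one, which does not affect any comparison.

-- Every permutation of Fin m, listed by its first value j and the
-- standardisation of the remaining values.
perms : ∀ m → List (Permutation′ m)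
perms zero    = id ∷ []
perms (suc m) = concatMap (λ j → map (insert zero j) (perms m)) (allFin (suc m))

insert-remove-zero : (π : Permutation′ (suc m)) (ρ : Permutation′ m) →
                     remove zero π ≈ ρ → π ≈ insert zero (π ⟨$⟩ʳ zero) ρ
insert-remove-zero π ρ eq zero    = refl
insert-remove-zero π ρ eq (suc i) =
  trans (punchIn-permute π zero i)
    (trans (cong (punchIn (π ⟨$⟩ʳ zero)) (eq i))
      (sym (insert-punchIn zero (π ⟨$⟩ʳ zero) ρ i)))

perms-complete : (π : Permutation′ m) → Any (π ≈_) (perms m)
perms-complete {zero}  π = here λ ()
perms-complete {suc m} π =
  Any.concatMap⁺ _ (lose (∈-allFin (π ⟨$⟩ʳ zero))
    (Any.map⁺ (Any.map (λ {ρ} → insert-remove-zero π ρ) (perms-complete (remove zero π)))))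

perms-distinct : ∀ m → AllPairs (λ π ρ → ¬ π ≈ ρ) (perms m)
perms-distinct zero    = All.[] ∷ []
perms-distinct (suc m) = AllPairs.concat⁺
  (All.map⁺ (All.universal (λ j → AllPairs.map⁺ (AllPairs.map (sameFirst j) (perms-distinct m))) _))
  (AllPairs.map⁺ (AllPairs.map otherFirst (allFin⁺ (suc m))))
  where
  sameFirst : ∀ j {π ρ : Permutation′ m} → ¬ π ≈ ρ → ¬ insert zero j π ≈ insert zero j ρ
  sameFirst j {π} {ρ} π≉ρ eq = π≉ρ λ i → Fin.punchIn-injective j _ _
    (trans (sym (insert-punchIn zero j π i)) (trans (eq (suc i)) (insert-punchIn zero j ρ i)))
  otherFirst : ∀ {j l} → j ≢ l →
    All (λ π → All (λ ρ → ¬ π ≈ ρ) (map (insert zero l) (perms m))) (map (insert zero j) (perms m))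
  otherFirst j≢l = All.map⁺ (All.universal (λ _ →
    All.map⁺ (All.universal (λ _ eq → j≢l (eq zero)) _)) _)

-- p lists the positions of an occurrence of the pattern τ in σ.
Occurrence : Vec ℕ k → Permutation′ m → Vec (Fin m) k → Set
Occurrence τ σ p = ∀ a b →
  (a Fin.< b → lookup p a Fin.< lookup p b) ×
  (lookup τ a ℕ.< lookup τ b → σ ⟨$⟩ʳ lookup p a Fin.< σ ⟨$⟩ʳ lookup p b) ×
  (σ ⟨$⟩ʳ lookup p a Fin.< σ ⟨$⟩ʳ lookup p b → lookup τ a ℕ.< lookup τ b)

Avoids : Vec ℕ k → Permutation′ m → Set
Avoids τ σ = ∀ p → ¬ Occurrence τ σ p

occurrence? : (τ : Vec ℕ k) (σ : Permutation′ m) → Decidable (Occurrence τ σ)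
occurrence? τ σ p = Fin.all? λ a → Fin.all? λ b →
  (a Fin.<? b →-dec lookup p a Fin.<? lookup p b) ×-dec
  (lookup τ a ℕ.<? lookup τ b →-dec σ ⟨$⟩ʳ lookup p a Fin.<? σ ⟨$⟩ʳ lookup p b) ×-dec
  (σ ⟨$⟩ʳ lookup p a Fin.<? σ ⟨$⟩ʳ lookup p b →-dec lookup τ a ℕ.<? lookup τ b)

allVec? : {P : Vec (Fin m) k → Set} → Decidable P → Dec (∀ p → P p)
allVec? {k = zero}  P? = map′ (λ { h [] → h }) (λ h → h []) (P? [])
allVec? {k = suc k} P? = map′ (λ { h (x ∷ p) → h x p }) (λ h x p → h (x ∷ p))
  (Fin.all? λ x → allVec? λ p → P? (x ∷ p))

avoids? : (τ : Vec ℕ k) → Decidable (Avoids {m = m} τ)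
avoids? τ σ = allVec? λ p → ¬? (occurrence? τ σ p)

𝔖 : ∀ m → Vec ℕ k → List (Permutation′ m)
𝔖 m τ = filter (avoids? τ) (perms m)

p321 p231 p312 p132 p213 : Vec ℕ 3
p321 = 3 ∷ 2 ∷ 1 ∷ []
p231 = 2 ∷ 3 ∷ 1 ∷ []
p312 = 3 ∷ 1 ∷ 2 ∷ []
p132 = 1 ∷ 3 ∷ 2 ∷ []
p213 = 2 ∷ 1 ∷ 3 ∷ []

#₁ : {P : Fin m → Set} → Decidable P → ℕ
#₁ {m} P? = length (filter P? (allFin m))

#₂ : {P : Fin m → Fin n → Set} → (∀ i j → Dec (P i j)) → ℕ
#₂ {m} {n} P? = length (filter (uncurry P?) (cartesianProduct (allFin m) (allFin n)))

-- The two positions i and i+1 for i ∈ [m-1].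
this next : Fin (pred m) → Fin m
this {suc m} i = inject₁ i
next {suc m} i = suc i

exc fix inv des asc : Permutation′ m → ℕ
exc σ = #₁ λ i → i Fin.<? (σ ⟨$⟩ʳ i)
fix σ = #₁ λ i → (σ ⟨$⟩ʳ i) Fin.≟ i
inv σ = #₂ λ i j → i Fin.<? j ×-dec (σ ⟨$⟩ʳ j) Fin.<? (σ ⟨$⟩ʳ i)
des {m} σ = #₁ λ i → (σ ⟨$⟩ʳ next {m} i) Fin.<? (σ ⟨$⟩ʳ this {m} i)
asc {m} σ = #₁ λ i → (σ ⟨$⟩ʳ this {m} i) Fin.<? (σ ⟨$⟩ʳ next {m} i)

⟨31-2⟩ ⟨2-31⟩ ⟨2-13⟩ ⟨13-2⟩ : Permutation′ m → ℕ
⟨31-2⟩ {m} σ = #₂ λ i j → next {m} i Fin.<? j ×-dec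
  (σ ⟨$⟩ʳ next {m} i) Fin.<? (σ ⟨$⟩ʳ j) ×-dec (σ ⟨$⟩ʳ j) Fin.<? (σ ⟨$⟩ʳ this {m} i)
⟨2-31⟩ {m} σ = #₂ λ i j → j Fin.<? this {m} i ×-dec
  (σ ⟨$⟩ʳ next {m} i) Fin.<? (σ ⟨$⟩ʳ j) ×-dec (σ ⟨$⟩ʳ j) Fin.<? (σ ⟨$⟩ʳ this {m} i)
⟨2-13⟩ {m} σ = #₂ λ i j → j Fin.<? this {m} i ×-dec
  (σ ⟨$⟩ʳ this {m} i) Fin.<? (σ ⟨$⟩ʳ j) ×-dec (σ ⟨$⟩ʳ j) Fin.<? (σ ⟨$⟩ʳ next {m} i)
⟨13-2⟩ {m} σ = #₂ λ i j → next {m} i Fin.<? j ×-dec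
  (σ ⟨$⟩ʳ this {m} i) Fin.<? (σ ⟨$⟩ʳ j) ×-dec (σ ⟨$⟩ʳ j) Fin.<? (σ ⟨$⟩ʳ next {m} i)

cda : Permutation′ m → ℕ
cda σ = #₁ λ x → (σ ⟨$⟩ˡ x) Fin.<? x ×-dec x Fin.<? (σ ⟨$⟩ʳ x)

-- The word σ(0) σ(1) … σ(m+1) with σ(0) = l and σ(m+1) = r, where
-- σ(1), …, σ(m) take values in {1, …, m} and ⊤⁺ plays the role of ∞.
extend : ℕ ⁺ → ℕ ⁺ → Permutation′ m → Vec (ℕ ⁺) (suc (suc m))
extend l r σ = l ∷ (tabulate (λ i → [ suc (toℕ (σ ⟨$⟩ʳ i)) ]) ∷ʳ r)

_<⁺?_ = <⁺-dec ℕ._<?_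

-- i : Fin m stands for the position suc (toℕ i) of the extended word.
ldd rda : Permutation′ m → ℕ
ldd {m} σ = #₁ {m} λ i → w (suc (inject₁ i)) <⁺? w (inject₁ (inject₁ i)) ×-dec
                         w (suc (suc i)) <⁺? w (suc (inject₁ i))
  where w = lookup (extend [ 0 ] ⊤⁺ σ)
rda {m} σ = #₁ {m} λ i → w (inject₁ (inject₁ i)) <⁺? w (suc (inject₁ i)) ×-dec
                         w (suc (inject₁ i)) <⁺? w (suc (suc i))
  where w = lookup (extend ⊤⁺ [ 0 ] σ)

𝔖~321 𝔖~231 𝔖~312 𝔖~132 𝔖~213 : ∀ m → ℕ → List (Permutation′ m)
𝔖~321 m k = filter (λ σ → exc σ ≟ k ×-dec cda σ ≟ 0) (𝔖 m p321)
𝔖~231 m k = filter (λ σ → des σ ≟ k ×-dec ldd σ ≟ 0) (𝔖 m p231)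
𝔖~312 m k = filter (λ σ → des σ ≟ k ×-dec ldd σ ≟ 0) (𝔖 m p312)
𝔖~132 m k = filter (λ σ → asc σ ≟ k ×-dec rda σ ≟ 0) (𝔖 m p132)
𝔖~213 m k = filter (λ σ → asc σ ≟ k ×-dec rda σ ≟ 0) (𝔖 m p213)

[1‥_] : ℕ → List ℕ
[1‥ n ] = applyUpTo suc n

-- Identities between Laurent polynomials in t and q are stated for the values
-- at all t and all units q of an arbitrary commutative ring R; the universal
-- case is R = ℤ[t, q, q⁻¹].
module Polynomials {c ℓ} (R : CommutativeRing c ℓ) where
  open CommutativeRing R hiding (_≈_)
  open import Algebra.Properties.Semiring.Exp semiring public using (_^_)

  infix 6.5 ∑
  ∑ : ∀ {a} {A : Set a} → List A → (A → Carrier) → Carrier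
  ∑ xs f = foldr _+_ 0# (map f xs)

  syntax ∑ xs (λ x → e) = ∑[ x ∈ xs ] e

  N : ℕ → Carrier → Carrier → Carrier → Carrier
  N n t q r = ∑[ σ ∈ 𝔖 n p321 ] (t ^ exc σ * q ^ inv σ * r ^ fix σ)

  -- The truncated subtraction is exact, since exc π ≤ m.
  γ~ : ℕ → ℕ → Carrier → Carrier
  γ~ m k q = ∑[ π ∈ 𝔖~321 m k ] (q ^ (m ℕ.+ inv π ℕ.∸ exc π))

-- Scan a 321-avoiding permutation by reading position 1, value 1, position 2, value 2, …, and
-- delete a point once both its position and its value have been read.  When h of the values read
-- belong to points that are not deleted yet, what is left is again a 321-avoiding permutation, and
-- avoidance forces each deleted point to have the least remaining position or value, so that its
-- deletion lowers inv by exactly h.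
-- Grouping the half steps as (position, value) gives Motzkin paths of length n; grouping them as
-- (value, position), after a first half step of weight t, gives Motzkin paths of length n − 1
-- with level steps of weight (t + q) q ^ h and down steps of weight t q ^ (2h) at height h.
-- Expanding in the number of down steps yields the γ-expansion: in the first grouping, forbidding
-- cyclic double ascents leaves one kind of level step, of weight q ^ h.
--
-- A 231-avoiding word without double descents starts with its minimum or with a letter followed
-- by its minimum, and in the second case the rest is a direct sum of two such words.  This is the
-- recursion of the same Motzkin paths cut at their first return.  Reversal and complement turn
-- 231 into the other three patterns.
module Submission where

open import Defs
open import Algebra.Bundles using (CommutativeRing)
open import Data.Nat using (ℕ; _∸_; _≤_; ⌊_/2⌋) renaming (_+_ to _+ℕ_; _*_ to _*ℕ_)
open import Data.Product using (_×_)
import Algebra.Properties.CommutativeMonoid.Sum as MonoidSum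
open import Data.Bool using (true; false; if_then_else_)
open import Data.Empty using (⊥-elim)
open import Data.Fin as Fin using (Fin; zero; suc; toℕ; inject₁; fromℕ<; opposite; punchIn; punchOut)
open import Data.Fin.Patterns using (0F; 1F; 2F)
open import Data.Fin.Permutation as Perm
  using (Permutation′; _⟨$⟩ʳ_; _⟨$⟩ˡ_; inverseˡ; inverseʳ; insert; insert-punchIn; flip; reverse; _∘ₚ_)
  renaming (_≈_ to _≈ₚ_)
import Data.Fin.Properties as Fin
open import Data.List using (List; []; _∷_; _++_; map; concatMap; filter; length; allFin; tabulate; cartesianProduct; applyUpTo; upTo)
open import Data.List.Properties using (filter-++; length-++)
open import Data.List.Relation.Unary.All as All using (All; []; _∷_)
open import Data.List.Relation.Unary.AllPairs using (AllPairs; _∷_)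
open import Data.List.Relation.Unary.Any using (Any; here; there)
open import Data.Nat as ℕ using (zero; suc; pred; z≤n; s≤s)
open import Data.Nat.ListAction using (sum)
import Data.Nat.Properties as ℕ
open import Data.Product using (_,_; uncurry; proj₁; proj₂; ∃; map₂)
open import Data.Sum as Sum using (_⊎_; inj₁; inj₂)
open import Data.Unit using (⊤; tt)
open import Data.Vec as Vec using (Vec; []; _∷_; _∷ʳ_; lookup)
open import Function using (_∘_; id; _⇔_; mk⇔; Equivalence)
open import Function.Construct.Composition using (_⇔-∘_)
open import Function.Construct.Symmetry using (⇔-sym)
open import Relation.Binary using (tri<; tri≈; tri>)
open import Relation.Binary.Construct.Add.Supremum.Strict ℕ._<_ using (_<⁺_; [_])
open import Relation.Binary.PropositionalEquality as ≡ using (_≡_; _≢_)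
open import Relation.Nullary using (Dec; yes; no; does; ¬_; contradiction)
open import Relation.Nullary.Construct.Add.Supremum using (_⁺; ⊤⁺; [_])
open import Relation.Nullary.Decidable as Dec
  using (_×-dec_; _→-dec_; _⊎-dec_; ¬?; dec-true; dec-false; True; toWitness)
open import Relation.Unary using (Decidable)
open Equivalence using (to; from)

private
  variable
    m n : ℕ
    P Q S : Set

-- `t` and `q` are elements of an arbitrary ring, so coefficients of powers of `t` cannot be
-- compared there. Every sum over paths or permutations therefore carries a function `φ`, applied to
-- the number of down steps, excedances or descents: `t ^_` evaluates the polynomial and `δ k`
-- extracts a coefficient. The price is that generating functions no longer multiply, since nothing
-- makes `φ` multiplicative. A product over pieces is replaced by one sum over lists of pieces;
-- hence the lists `ss` in `stack`, `Cuts` and `words`. Deleted points are not recorded: a partly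
-- scanned permutation is a smaller permutation with three thresholds, so each half step of the scan
-- is an equation between sums over `perms`. The classes for 321 and 231 are not matched by a
-- bijection; both are evaluated as sums over the same paths. The weights that fit the paths are
-- `q ^ inv` for 321 and `q ^ (⟨31-2⟩ + des)` for 231. Both are off by the same power from the
-- exponents in the theorem, and `q` is inverted only at the end, to correct this.

_≈ₚ?_ : (σ τ : Permutation′ m) → Dec (σ ≈ₚ τ)
σ ≈ₚ? τ = Fin.all? λ i → (σ ⟨$⟩ʳ i) Fin.≟ (τ ⟨$⟩ʳ i)

flip-cong : (σ τ : Permutation′ m) → σ ≈ₚ τ → flip σ ≈ₚ flip τ
flip-cong σ τ eq i = ≡.trans (≡.sym (inverseˡ τ))
  (≡.cong (τ ⟨$⟩ˡ_) (≡.trans (≡.sym (eq (σ ⟨$⟩ˡ i))) (inverseʳ σ)))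

flip-insert : ∀ i j (ρ : Permutation′ m) → flip (insert i j ρ) ≈ₚ insert j i (flip ρ)
flip-insert i j ρ k with j Fin.≟ k
... | yes _ = ≡.refl
... | no _  = ≡.refl

-- Finite sums in a commutative ring, and sums over all permutations.

module Sums {c ℓ} (R : CommutativeRing c ℓ) where
  open CommutativeRing R hiding (zero)
  open Polynomials R
  open import Algebra.Properties.CommutativeSemigroup +-commutativeSemigroup using (interchange)
  open import Relation.Binary.Reasoning.Setoid setoid

  infixr 6.7 ⟦_⟧_
  ⟦_⟧_ : Dec P → Carrier → Carrier
  ⟦ P? ⟧ x = if does P? then x else 0#

  ⟦⟧-true : (P? : Dec P) → P → ∀ {x} → ⟦ P? ⟧ x ≈ x
  ⟦⟧-true P? p rewrite dec-true P? p = refl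

  ⟦⟧-false : (P? : Dec P) → ¬ P → ∀ {x} → ⟦ P? ⟧ x ≈ 0#
  ⟦⟧-false P? ¬p rewrite dec-false P? ¬p = refl

  ⟦⟧-cong : (P? : Dec P) (Q? : Dec Q) → (P → Q) → (Q → P) → ∀ {x y} → (P → x ≈ y) →
            ⟦ P? ⟧ x ≈ ⟦ Q? ⟧ y
  ⟦⟧-cong P? (yes q) f g h = trans (⟦⟧-true P? (g q)) (h (g q))
  ⟦⟧-cong P? (no ¬q) f g h = ⟦⟧-false P? (¬q ∘ f)

  ⟦⟧-congˡ : (P? : Dec P) → ∀ {x y} → (P → x ≈ y) → ⟦ P? ⟧ x ≈ ⟦ P? ⟧ y
  ⟦⟧-congˡ P? = ⟦⟧-cong P? P? id id

  ⟦⟧-× : (P? : Dec P) (Q? : Dec Q) → ∀ {x} → ⟦ P? ⟧ ⟦ Q? ⟧ x ≈ ⟦ P? ×-dec Q? ⟧ x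
  ⟦⟧-× (yes _) (yes _) = refl
  ⟦⟧-× (yes _) (no _)  = refl
  ⟦⟧-× (no _)  _       = refl

  ⟦⟧-⊎ : (P? : Dec P) (Q? : Dec Q) (S? : Dec S) →
         (P → Q ⊎ S) → (Q → P) → (S → P) → ¬ (Q × S) → ∀ {x} →
         ⟦ P? ⟧ x ≈ ⟦ Q? ⟧ x + ⟦ S? ⟧ x
  ⟦⟧-⊎ P? (yes q) S? f g h d = sym (trans (+-congˡ (⟦⟧-false S? λ s → d (q , s)))
    (trans (+-identityʳ _) (sym (⟦⟧-true P? (g q)))))
  ⟦⟧-⊎ P? (no ¬q) S? f g h d = trans
    (⟦⟧-cong P? S? (λ p → Sum.[ ⊥-elim ∘ ¬q , id ]′ (f p)) h λ _ → refl)
    (sym (+-identityˡ _))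

  *-⟦⟧ : (P? : Dec P) → ∀ y {x} → y * (⟦ P? ⟧ x) ≈ ⟦ P? ⟧ (y * x)
  *-⟦⟧ (yes _) y = refl
  *-⟦⟧ (no _)  y = zeroʳ y

  module _ {a} {A : Set a} where

    ∑-congᴬ : (xs : List A) → ∀ {f g : A → Carrier} → All (λ x → f x ≈ g x) xs → ∑ xs f ≈ ∑ xs g
    ∑-congᴬ []       []       = refl
    ∑-congᴬ (x ∷ xs) (e ∷ es) = +-cong e (∑-congᴬ xs es)

    ∑-cong : (xs : List A) → ∀ {f g : A → Carrier} → (∀ x → f x ≈ g x) → ∑ xs f ≈ ∑ xs g
    ∑-cong xs e = ∑-congᴬ xs (All.universal e xs)

    ∑-zero : (xs : List A) → ∀ {f : A → Carrier} → (∀ x → f x ≈ 0#) → ∑ xs f ≈ 0#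
    ∑-zero []       e = refl
    ∑-zero (x ∷ xs) e = trans (+-cong (e x) (∑-zero xs e)) (+-identityˡ 0#)

    ∑-+ : (xs : List A) → ∀ (f g : A → Carrier) → ∑[ x ∈ xs ] (f x + g x) ≈ ∑ xs f + ∑ xs g
    ∑-+ []       f g = sym (+-identityˡ 0#)
    ∑-+ (x ∷ xs) f g = trans (+-congˡ (∑-+ xs f g)) (interchange _ _ _ _)

    *-∑ : ∀ y (xs : List A) (f : A → Carrier) → y * ∑ xs f ≈ ∑[ x ∈ xs ] (y * f x)
    *-∑ y []       f = zeroʳ y
    *-∑ y (x ∷ xs) f = trans (distribˡ y _ _) (+-congˡ (*-∑ y xs f))

    ∑-++ : (xs ys : List A) (f : A → Carrier) → ∑ (xs ++ ys) f ≈ ∑ xs f + ∑ ys f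
    ∑-++ []       ys f = sym (+-identityˡ _)
    ∑-++ (x ∷ xs) ys f = trans (+-congˡ (∑-++ xs ys f)) (sym (+-assoc _ _ _))

    ∑-filter : {P : A → Set} (P? : Decidable P) (xs : List A) (f : A → Carrier) →
               ∑ (filter P? xs) f ≈ ∑[ x ∈ xs ] ⟦ P? x ⟧ f x
    ∑-filter P? []       f = refl
    ∑-filter P? (x ∷ xs) f with does (P? x)
    ... | true  = +-congˡ (∑-filter P? xs f)
    ... | false = trans (∑-filter P? xs f) (sym (+-identityˡ _))

    ∑-filter² : {P Q : A → Set} (P? : Decidable P) (Q? : Decidable Q) (xs : List A) (f : A → Carrier) →
                ∑ (filter P? (filter Q? xs)) f ≈ ∑[ x ∈ xs ] ⟦ Q? x ×-dec P? x ⟧ f x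
    ∑-filter² P? Q? xs f = begin
      ∑ (filter P? (filter Q? xs)) f      ≈⟨ ∑-filter P? (filter Q? xs) f ⟩
      ∑[ x ∈ filter Q? xs ] ⟦ P? x ⟧ f x  ≈⟨ ∑-filter Q? xs _ ⟩
      ∑[ x ∈ xs ] ⟦ Q? x ⟧ ⟦ P? x ⟧ f x   ≈⟨ ∑-cong xs (λ x → ⟦⟧-× (Q? x) (P? x)) ⟩
      ∑[ x ∈ xs ] ⟦ Q? x ×-dec P? x ⟧ f x ∎

    ∑-⟦⟧-⊎ : {P Q S : A → Set} (P? : Decidable P) (Q? : Decidable Q) (S? : Decidable S) (xs : List A) →
              (∀ x → P x → Q x ⊎ S x) → (∀ x → Q x → P x) → (∀ x → S x → P x) → (∀ x → ¬ (Q x × S x)) →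
              ∀ (f : A → Carrier) → ∑[ x ∈ xs ] ⟦ P? x ⟧ f x ≈ ∑[ x ∈ xs ] ⟦ Q? x ⟧ f x + ∑[ x ∈ xs ] ⟦ S? x ⟧ f x
    ∑-⟦⟧-⊎ P? Q? S? xs to g h d f = trans
      (∑-cong xs λ x → ⟦⟧-⊎ (P? x) (Q? x) (S? x) (to x) (g x) (h x) (d x))
      (∑-+ xs _ _)

    *-∑-⟦⟧ : ∀ y {P : A → Set} (P? : Decidable P) (xs : List A) (f : A → Carrier) →
             y * (∑[ x ∈ xs ] ⟦ P? x ⟧ f x) ≈ ∑[ x ∈ xs ] ⟦ P? x ⟧ (y * f x)
    *-∑-⟦⟧ y P? xs f = trans (*-∑ y xs _) (∑-cong xs λ x → *-⟦⟧ (P? x) y)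

  module _ {a b} {A : Set a} {B : Set b} where

    ∑-map : (g : B → A) (xs : List B) (f : A → Carrier) → ∑ (map g xs) f ≈ ∑ xs (f ∘ g)
    ∑-map g []       f = refl
    ∑-map g (x ∷ xs) f = +-congˡ (∑-map g xs f)

    ∑-concatMap : (g : B → List A) (xs : List B) (f : A → Carrier) → ∑ (concatMap g xs) f ≈ ∑[ x ∈ xs ] ∑ (g x) f
    ∑-concatMap g []       f = refl
    ∑-concatMap g (x ∷ xs) f = trans (∑-++ (g x) (concatMap g xs) f) (+-congˡ (∑-concatMap g xs f))

    ∑-comm : (xs : List A) (ys : List B) (f : A → B → Carrier) →
             ∑[ x ∈ xs ] ∑[ y ∈ ys ] f x y ≈ ∑[ y ∈ ys ] ∑[ x ∈ xs ] f x y
    ∑-comm []       ys f = sym (∑-zero ys λ _ → refl)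
    ∑-comm (x ∷ xs) ys f = trans (+-congˡ (∑-comm xs ys f)) (sym (∑-+ ys _ _))

  ∑-tabulate : ∀ {a} {A : Set a} n (g : Fin n → A) (f : A → Carrier) → ∑ (tabulate g) f ≈ ∑[ i ∈ allFin n ] f (g i)
  ∑-tabulate zero    g f = refl
  ∑-tabulate (suc n) g f = +-congˡ (trans (∑-tabulate n (g ∘ suc) f) (sym (∑-tabulate n suc (f ∘ g))))

  ∑-allFin-suc : ∀ n (f : Fin (suc n) → Carrier) → ∑ (allFin (suc n)) f ≈ f zero + ∑[ i ∈ allFin n ] f (suc i)
  ∑-allFin-suc n f = +-congˡ (∑-tabulate n suc f)

  ∑-allFin-≟ : (j : Fin n) (f : Fin n → Carrier) → ∑[ i ∈ allFin n ] ⟦ i Fin.≟ j ⟧ f i ≈ f j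
  ∑-allFin-≟ {suc n} zero f = trans (∑-allFin-suc n _)
    (trans (+-congˡ (∑-zero (allFin n) λ _ → refl)) (+-identityʳ _))
  ∑-allFin-≟ {suc n} (suc j) f = trans (∑-allFin-suc n _) (trans (+-identityˡ _) (trans
    (∑-cong (allFin n) λ i → ⟦⟧-cong (suc i Fin.≟ suc j) (i Fin.≟ j) Fin.suc-injective (≡.cong suc) λ _ → refl)
    (∑-allFin-≟ j (f ∘ suc))))

  Respectful : (Permutation′ m → Carrier) → Set ℓ
  Respectful f = ∀ σ τ → σ ≈ₚ τ → f σ ≈ f τ

  -- `perms` represents each class of pointwise equality exactly once: completeness supplies one
  -- surviving term and distinctness removes all others.
  ∑-perms-≈ : (π : Permutation′ m) (f : Permutation′ m → Carrier) → Respectful f →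
              ∑[ σ ∈ perms m ] ⟦ π ≈ₚ? σ ⟧ f σ ≈ f π
  ∑-perms-≈ {m} π f f-cong = pick (perms m) (perms-distinct m) (perms-complete π)
    where
    none : ∀ {σ} xs → π ≈ₚ σ → All (λ τ → ¬ σ ≈ₚ τ) xs → ∑[ τ ∈ xs ] ⟦ π ≈ₚ? τ ⟧ f τ ≈ 0#
    none []       eq []        = refl
    none {σ} (τ ∷ xs) eq (ne ∷ ns) = trans
      (+-cong (⟦⟧-false (π ≈ₚ? τ) λ eq′ → ne λ i → ≡.trans (≡.sym (eq i)) (eq′ i)) (none {σ} xs eq ns))
      (+-identityˡ 0#)
    pick : ∀ xs → AllPairs (λ σ τ → ¬ σ ≈ₚ τ) xs → Any (π ≈ₚ_) xs → ∑[ σ ∈ xs ] ⟦ π ≈ₚ? σ ⟧ f σ ≈ f π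
    pick (σ ∷ xs) (ns ∷ _) (here eq) = trans
      (+-cong (trans (⟦⟧-true (π ≈ₚ? σ) eq) (sym (f-cong π σ eq))) (none {σ} xs eq ns)) (+-identityʳ _)
    pick (σ ∷ xs) (ns ∷ ds) (there any) = trans
      (+-cong (⟦⟧-false (π ≈ₚ? σ) (absurd xs ns any)) (pick xs ds any)) (+-identityˡ _)
      where
      absurd : ∀ ys → All (λ τ → ¬ σ ≈ₚ τ) ys → Any (π ≈ₚ_) ys → ¬ π ≈ₚ σ
      absurd (τ ∷ _)  (ne ∷ _)  (here eq)  eq′ = ne λ i → ≡.trans (≡.sym (eq′ i)) (eq i)
      absurd (_ ∷ ys) (_ ∷ ns′) (there an) eq′ = absurd ys ns′ an eq′

  -- `φ σ` need not itself be an entry of `perms`, so the list cannot simply be permuted. A double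
  -- sum over the relation `φ σ ≈ₚ τ` replaces this: for an involution the relation is symmetric,
  -- and each variable selects one entry for the other.
  ∑-perms-involution : (φ : Permutation′ m → Permutation′ m) →
    (∀ σ τ → σ ≈ₚ τ → φ σ ≈ₚ φ τ) → (∀ σ → φ (φ σ) ≈ₚ σ) →
    (f : Permutation′ m → Carrier) → Respectful f → ∑[ σ ∈ perms m ] f (φ σ) ≈ ∑ (perms m) f
  ∑-perms-involution {m} φ φ-cong φφ f f-cong = begin
    ∑[ σ ∈ perms m ] f (φ σ)                                       ≈⟨ ∑-cong (perms m) (λ σ → ∑-perms-≈ (φ σ) f f-cong) ⟨
    ∑[ σ ∈ perms m ] ∑[ τ ∈ perms m ] ⟦ φ σ ≈ₚ? τ ⟧ f τ            ≈⟨ ∑-comm (perms m) (perms m) _ ⟩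
    ∑[ τ ∈ perms m ] ∑[ σ ∈ perms m ] ⟦ φ σ ≈ₚ? τ ⟧ f τ            ≈⟨ ∑-cong (perms m) (λ τ → ∑-cong (perms m) λ σ →
      ⟦⟧-cong (φ σ ≈ₚ? τ) (φ τ ≈ₚ? σ) (swap σ τ) (swap τ σ) (λ _ → refl)) ⟩
    ∑[ τ ∈ perms m ] ∑[ σ ∈ perms m ] ⟦ φ τ ≈ₚ? σ ⟧ f τ            ≈⟨ ∑-cong (perms m) (λ τ → ∑-perms-≈ (φ τ) (λ _ → f τ) λ _ _ _ → refl) ⟩
    ∑ (perms m) f                                                  ∎
    where
    swap : ∀ σ τ → φ σ ≈ₚ τ → φ τ ≈ₚ σ
    swap σ τ eq i = ≡.trans (≡.sym (φ-cong (φ σ) τ eq i)) (φφ σ i)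

  ∑-perms-suc : ∀ m (f : Permutation′ (suc m) → Carrier) → ∑ (perms (suc m)) f ≈ ∑[ j ∈ allFin (suc m) ] ∑[ ρ ∈ perms m ] f (insert zero j ρ)
  ∑-perms-suc m f = trans (∑-concatMap (λ j → map (insert zero j) (perms m)) (allFin (suc m)) f)
    (∑-cong (allFin (suc m)) λ j → ∑-map (insert zero j) (perms m) f)

  ∑-perms-insertˡ : ∀ m j (f : Permutation′ (suc m) → Carrier) →
    ∑[ τ ∈ perms (suc m) ] ⟦ (τ ⟨$⟩ʳ zero) Fin.≟ j ⟧ f τ ≈ ∑[ ρ ∈ perms m ] f (insert zero j ρ)
  ∑-perms-insertˡ m j f = begin
    ∑[ τ ∈ perms (suc m) ] ⟦ (τ ⟨$⟩ʳ zero) Fin.≟ j ⟧ f τ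
      ≈⟨ ∑-perms-suc m _ ⟩
    ∑[ i ∈ allFin (suc m) ] ∑[ ρ ∈ perms m ] ⟦ i Fin.≟ j ⟧ f (insert zero i ρ)
      ≈⟨ ∑-comm (allFin (suc m)) (perms m) _ ⟩
    ∑[ ρ ∈ perms m ] ∑[ i ∈ allFin (suc m) ] ⟦ i Fin.≟ j ⟧ f (insert zero i ρ)
      ≈⟨ ∑-cong (perms m) (λ ρ → ∑-allFin-≟ j _) ⟩
    ∑[ ρ ∈ perms m ] f (insert zero j ρ) ∎

  -- `perms` is built by the first value, so the value 0 is reached through inverses. `flip` is
  -- applied twice: once to exchange position and value of the inserted point, once to return from
  -- `flip ρ` to `ρ`.
  ∑-perms-insertʳ : ∀ m i (f : Permutation′ (suc m) → Carrier) → Respectful f →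
    ∑[ τ ∈ perms (suc m) ] ⟦ (τ ⟨$⟩ˡ zero) Fin.≟ i ⟧ f τ ≈ ∑[ ρ ∈ perms m ] f (insert i zero ρ)
  ∑-perms-insertʳ m i f f-cong = begin
    ∑[ τ ∈ perms (suc m) ] ⟦ (τ ⟨$⟩ˡ zero) Fin.≟ i ⟧ f τ
      ≈⟨ ∑-perms-involution flip flip-cong (λ _ _ → ≡.refl) _ (λ σ τ eq →
           ⟦⟧-cong (_ Fin.≟ i) (_ Fin.≟ i) (≡.trans (≡.sym (flip-cong σ τ eq zero)))
             (≡.trans (flip-cong σ τ eq zero)) λ _ → f-cong σ τ eq) ⟨
    ∑[ τ ∈ perms (suc m) ] ⟦ (τ ⟨$⟩ʳ zero) Fin.≟ i ⟧ f (flip τ)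
      ≈⟨ ∑-perms-insertˡ m i (f ∘ flip) ⟩
    ∑[ ρ ∈ perms m ] f (flip (insert zero i ρ))
      ≈⟨ ∑-cong (perms m) (λ ρ → f-cong (flip (insert zero i ρ)) (insert i zero (flip ρ)) (flip-insert zero i ρ)) ⟩
    ∑[ ρ ∈ perms m ] f (insert i zero (flip ρ))
      ≈⟨ ∑-perms-involution flip flip-cong (λ _ _ → ≡.refl) _ (λ σ τ eq → f-cong _ _ (insert-cong σ τ eq)) ⟩
    ∑[ ρ ∈ perms m ] f (insert i zero ρ) ∎
    where
    insert-cong : ∀ σ τ → σ ≈ₚ τ → insert i zero σ ≈ₚ insert i zero τ
    insert-cong σ τ eq k with i Fin.≟ k
    ... | yes _ = ≡.refl
    ... | no _  = ≡.cong suc (eq _)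

-- Weighted Motzkin paths and their first-return decomposition.

module Paths {c ℓ} (R : CommutativeRing c ℓ) where
  open CommutativeRing R hiding (zero)
  open Polynomials R
  open Sums R
  open import Algebra.Properties.Semiring.Exp semiring using (^-cong; ^-congˡ; ^-homo-*)
  open import Algebra.Properties.CommutativeSemiring.Exp commutativeSemiring using (^-distrib-*)
  open import Algebra.Properties.CommutativeSemigroup +-commutativeSemigroup using () renaming (interchange to +-interchange)
  open import Algebra.Properties.CommutativeSemigroup *-commutativeSemigroup
    using (x∙yz≈y∙xz)
  open import Algebra.Solver.CommutativeMonoid *-commutativeMonoid using (solve; _⊕_; _⊜_)
  open import Relation.Binary.Reasoning.Setoid setoid

  Weight : Set c
  Weight = ℕ → Carrier

  -- The sum of F i j over all i + j + 1 = n.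
  conv : ℕ → (ℕ → ℕ → Carrier) → Carrier
  conv zero    F = 0#
  conv (suc n) F = F 0 n + conv n (F ∘ suc)

  conv-cong-≡ : ∀ n {F G : ℕ → ℕ → Carrier} → (∀ i j → suc (i ℕ.+ j) ≡ n → F i j ≈ G i j) → conv n F ≈ conv n G
  conv-cong-≡ zero    e = refl
  conv-cong-≡ (suc n) e = +-cong (e 0 n ≡.refl) (conv-cong-≡ n λ i j eq → e (suc i) j (≡.cong suc eq))

  conv-cong : ∀ n {F G : ℕ → ℕ → Carrier} → (∀ i j → F i j ≈ G i j) → conv n F ≈ conv n G
  conv-cong n e = conv-cong-≡ n λ i j _ → e i j

  conv-+ : ∀ n (F G : ℕ → ℕ → Carrier) → conv n (λ i j → F i j + G i j) ≈ conv n F + conv n G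
  conv-+ zero    F G = sym (+-identityˡ 0#)
  conv-+ (suc n) F G = trans (+-congˡ (conv-+ n (F ∘ suc) (G ∘ suc))) (+-interchange _ _ _ _)

  *-conv : ∀ y n (F : ℕ → ℕ → Carrier) → y * conv n F ≈ conv n (λ i j → y * F i j)
  *-conv y zero    F = zeroʳ y
  *-conv y (suc n) F = trans (distribˡ y _ _) (+-congˡ (*-conv y n (F ∘ suc)))

  conv-comm : ∀ m n (F : ℕ → ℕ → ℕ → ℕ → Carrier) →
              conv m (λ a b → conv n (F a b)) ≈ conv n (λ i j → conv m (λ a b → F a b i j))
  conv-comm m zero    F = zeros m
    where
    zeros : ∀ m → conv m (λ _ _ → 0#) ≈ 0#
    zeros zero    = refl
    zeros (suc m) = trans (+-identityˡ _) (zeros m)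
  conv-comm m (suc n) F = trans (conv-+ m _ _) (+-congˡ (conv-comm m n λ a b i j → F a b (suc i) j))

  -- Both sides run over `i + j + k + 2 = n`, bracketed from the left and from the right.
  conv-assoc : ∀ n (F : ℕ → ℕ → ℕ → Carrier) →
    conv n (λ s k → conv s (λ i j → F i j k)) ≈ conv n (λ i s → conv s (F i))
  conv-assoc zero    F = refl
  conv-assoc (suc n) F = begin
    0# + conv n (λ s k → F 0 s k + conv s (λ i j → F (suc i) j k))        ≈⟨ +-identityˡ _ ⟩
    conv n (λ s k → F 0 s k + conv s (λ i j → F (suc i) j k))             ≈⟨ conv-+ n _ _ ⟩
    conv n (F 0) + conv n (λ s k → conv s (λ i j → F (suc i) j k))        ≈⟨ +-congˡ (conv-assoc n (F ∘ suc)) ⟩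
    conv n (F 0) + conv n (λ i s → conv s (F (suc i)))                    ∎

  module _ (q : Carrier) where

    -- Weighted Motzkin paths with r steps from height h to 0: a level step at height h
    -- weighs q ^ h, a down step from height h weighs q ^ (2h − 1), and a path with e down
    -- steps contributes φ e.
    motzkin : ℕ → ℕ → Weight → Carrier
    motzkin zero    zero    φ = φ 0
    motzkin (suc h) zero    φ = 0#
    motzkin zero    (suc r) φ = motzkin 1 r φ + motzkin 0 r φ
    motzkin (suc h) (suc r) φ = motzkin (suc (suc h)) r φ +
      q ^ suc h * (motzkin (suc h) r φ + q ^ h * motzkin h r (φ ∘ suc))

    -- A path from height `h` to 0 with `e` down steps has `e - h` up steps, so `2e - h` cannot
    -- exceed its number of steps `r`.
    motzkin-vanishes : ∀ h r {φ} → (∀ e → 2 ℕ.* e ℕ.≤ r ℕ.+ h → φ e ≈ 0#) → motzkin h r φ ≈ 0#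
    motzkin-vanishes zero    zero    z = z 0 z≤n
    motzkin-vanishes (suc h) zero    z = refl
    motzkin-vanishes zero    (suc r) z = trans
      (+-cong (motzkin-vanishes 1 r λ e le → z e (ℕ.≤-trans le (ℕ.≤-reflexive (ℕ.+-suc r 0))))
              (motzkin-vanishes 0 r λ e le → z e (ℕ.m≤n⇒m≤1+n le)))
      (+-identityˡ 0#)
    motzkin-vanishes (suc h) (suc r) {φ} z = begin
      motzkin (2 ℕ.+ h) r φ + q ^ suc h * (motzkin (suc h) r φ + q ^ h * motzkin h r (φ ∘ suc))
        ≈⟨ +-cong (motzkin-vanishes (suc (suc h)) r λ e le → z e (ℕ.≤-trans le (ℕ.≤-reflexive (ℕ.+-suc r (suc h)))))
             (*-congˡ (+-cong (motzkin-vanishes (suc h) r λ e le → z e (ℕ.m≤n⇒m≤1+n le))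
               (trans (*-congˡ (motzkin-vanishes h r λ e le → z (suc e)
                 (ℕ.≤-trans (ℕ.≤-reflexive (ℕ.*-suc 2 e)) (ℕ.≤-trans (s≤s (s≤s le)) (ℕ.≤-reflexive (≡.cong suc (≡.sym (ℕ.+-suc r h))))))))
                 (zeroʳ _)))) ⟩
      0# + q ^ suc h * (0# + 0#) ≈⟨ trans (+-identityˡ _) (trans (*-congˡ (+-identityˡ 0#)) (zeroʳ _)) ⟩
      0# ∎

    -- A path is cut at its first down steps from the heights h, h − 1, …, 1 into pieces of
    -- lengths ss, and f ss sums over the paths with pieces of these lengths.
    stack : ℕ → ℕ → Weight → (List ℕ → Weight → Carrier) → Carrier
    stack zero    r φ f = f (r ∷ []) φ
    stack (suc h) r φ f = (q ^ suc h * q ^ h) *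
      conv r (λ s r′ → (q ^ suc h) ^ s * stack h r′ (φ ∘ suc) (λ ss → f (s ∷ ss)))

    stack-cong : ∀ h r {φ} {f g : List ℕ → Weight → Carrier} → (∀ ss ψ → f ss ψ ≈ g ss ψ) → stack h r φ f ≈ stack h r φ g
    stack-cong zero    r e = e _ _
    stack-cong (suc h) r e = *-congˡ (conv-cong r λ s r′ → *-congˡ (stack-cong h r′ λ ss → e (s ∷ ss)))

    stack-+ : ∀ h r {φ} (f g : List ℕ → Weight → Carrier) →
              stack h r φ (λ ss ψ → f ss ψ + g ss ψ) ≈ stack h r φ f + stack h r φ g
    stack-+ zero    r f g = refl
    stack-+ (suc h) r f g = trans
      (*-congˡ (trans (conv-cong r λ s r′ → trans (*-congˡ (stack-+ h r′ _ _)) (distribˡ _ _ _)) (conv-+ r _ _)))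
      (distribˡ _ _ _)

    stack-* : ∀ h r {φ} y (f : List ℕ → Weight → Carrier) → stack h r φ (λ ss ψ → y * f ss ψ) ≈ y * stack h r φ f
    stack-* zero    r y f = refl
    stack-* (suc h) r {φ} y f = begin
      w * conv r (λ s r′ → x ^ s * stack h r′ (φ ∘ suc) (λ ss ψ → y * f (s ∷ ss) ψ))
        ≈⟨ *-congˡ (conv-cong r λ s r′ → trans (*-congˡ (stack-* h r′ y _)) (x∙yz≈y∙xz _ _ _)) ⟩
      w * conv r (λ s r′ → y * (x ^ s * stack h r′ (φ ∘ suc) (λ ss → f (s ∷ ss))))
        ≈⟨ *-congˡ (*-conv y r _) ⟨
      w * (y * conv r (λ s r′ → x ^ s * stack h r′ (φ ∘ suc) (λ ss → f (s ∷ ss))))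
        ≈⟨ x∙yz≈y∙xz _ _ _ ⟩
      y * stack (suc h) r φ f ∎
      where
      x = q ^ suc h
      w = q ^ suc h * q ^ h

    stack-conv : ∀ h r {φ} n (f : ℕ → ℕ → List ℕ → Weight → Carrier) →
                 stack h r φ (λ ss ψ → conv n (λ i j → f i j ss ψ)) ≈ conv n (λ i j → stack h r φ (f i j))
    stack-conv zero    r n f = refl
    stack-conv (suc h) r {φ} n f = begin
      w * conv r (λ s r′ → x ^ s * stack h r′ (φ ∘ suc) (λ ss ψ → conv n (λ i j → f i j (s ∷ ss) ψ)))
        ≈⟨ *-congˡ (conv-cong r λ s r′ → trans (*-congˡ (stack-conv h r′ n _)) (*-conv _ n _)) ⟩
      w * conv r (λ s r′ → conv n (λ i j → x ^ s * stack h r′ (φ ∘ suc) (λ ss → f i j (s ∷ ss))))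
        ≈⟨ *-congˡ (conv-comm r n _) ⟩
      w * conv n (λ i j → conv r (λ s r′ → x ^ s * stack h r′ (φ ∘ suc) (λ ss → f i j (s ∷ ss))))
        ≈⟨ *-conv w n _ ⟩
      conv n (λ i j → stack (suc h) r φ (f i j)) ∎
      where
      x = q ^ suc h
      w = q ^ suc h * q ^ h

    stack-shift : ∀ h r {φ} (f : List ℕ → Weight → Carrier) →
                  stack h r φ (λ ss ψ → f ss (ψ ∘ suc)) ≈ stack h r (φ ∘ suc) f
    stack-shift zero    r f = refl
    stack-shift (suc h) r f = *-congˡ (conv-cong r λ s r′ → *-congˡ (stack-shift h r′ _))

    -- The hypotheses are the first-return recursion of the first piece: it is empty, or starts with
    -- a level step, or starts with an up step whose matching down step cuts it into parts of
    -- lengths `i` and `j`. In `q ^ suc i` one factor `q` is the down step from height 1, and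
    -- `q ^ i` pays for raising the first part by one.
    module _ (f : List ℕ → Weight → Carrier)
             (f-[] : ∀ φ → f [] φ ≈ φ 0)
             (f-zero : ∀ ss φ → f (0 ∷ ss) φ ≈ f ss φ)
             (f-suc : ∀ s ss φ → f (suc s ∷ ss) φ ≈
                      f (s ∷ ss) φ + conv s (λ i j → q ^ suc i * f (i ∷ j ∷ ss) (φ ∘ suc))) where

      -- Raising a closed path of length `s` by `h` multiplies its weight by `(q ^ h) ^ s`: a level
      -- step gains `q ^ h`, and a down step gains `q ^ (2h)`, shared with the up step that it
      -- matches. With these factors in `stack`, the three ways in which the first piece can begin
      -- are the three first steps of a path at height `suc h`; an empty first piece means a down
      -- step.
      stack-suc : ∀ h r φ → stack (suc h) (suc r) φ f ≈ stack (suc (suc h)) r φ f +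
        q ^ suc h * (stack (suc h) r φ f + q ^ h * stack h r (φ ∘ suc) f)
      stack-suc h r φ = begin
        w * (1# * stack h r φ′ (λ ss → f (0 ∷ ss)) +
             conv r (λ s r′ → x ^ suc s * stack h r′ φ′ (λ ss → f (suc s ∷ ss))))
          ≈⟨ *-congˡ (+-cong (trans (*-identityˡ _) (stack-cong h r f-zero)) (conv-cong r unfold)) ⟩
        w * (D + conv r (λ s r′ → x * (x ^ s * stack h r′ φ′ (λ ss → f (s ∷ ss))) +
                                  conv s (λ i j → x ^ suc s * (q ^ suc i * Z i j r′))))
          ≈⟨ *-congˡ (+-congˡ (trans (conv-+ r _ _) (+-congʳ (sym (*-conv x r _))))) ⟩
        w * (D + (x * L + conv r (λ s r′ → conv s (λ i j → x ^ suc s * (q ^ suc i * Z i j r′)))))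
          ≈⟨ *-congˡ (+-congˡ (+-congˡ (conv-cong r λ s r′ → conv-cong-≡ s λ i j eq → trans
               (*-congʳ (^-cong {x = x} refl (≡.cong suc (≡.sym eq)))) (weights i j _)))) ⟩
        w * (D + (x * L + conv r (λ s r′ → conv s (λ i j → G i j r′))))
          -- Regrouping makes `i` the top piece and `j` the next one in a stack that is higher by
          -- one.
          ≈⟨ *-congˡ (+-congˡ (+-congˡ (trans (conv-assoc r G)
               (trans (conv-cong r λ i s → trans (sym (*-conv _ s _)) (*-congˡ (sym (*-conv _ s _)))) (sym (*-conv _ r _)))))) ⟩
        w * (D + (x * L + q * x * x * U))
          ≈⟨ trans (distribˡ w _ _) (+-congˡ (distribˡ w _ _)) ⟩
        w * D + (w * (x * L) + w * (q * x * x * U))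
          ≈⟨ trans (sym (+-assoc _ _ _)) (+-comm _ _) ⟩
        w * (q * x * x * U) + (w * D + w * (x * L))
          ≈⟨ +-cong (trans (x∙yz≈y∙xz _ _ _) (*-congˡ up))
               (trans (+-cong (*-assoc _ _ _) (x∙yz≈y∙xz _ _ _))
                 (trans (sym (distribˡ x _ _)) (*-congˡ (+-comm _ _)))) ⟩
        stack (suc (suc h)) r φ f + x * (stack (suc h) r φ f + q ^ h * D) ∎
        where
        x = q ^ suc h
        w = x * q ^ h
        φ′ = φ ∘ suc
        D = stack h r φ′ f
        Z : ℕ → ℕ → ℕ → Carrier
        Z i j r′ = stack h r′ (φ′ ∘ suc) (λ ss → f (i ∷ j ∷ ss))
        G : ℕ → ℕ → ℕ → Carrier
        G i j r′ = q * x * x * ((q * x) ^ i * (x ^ j * Z i j r′))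
        L = conv r (λ s r′ → x ^ s * stack h r′ φ′ (λ ss → f (s ∷ ss)))
        U = conv r (λ i s → (q * x) ^ i * conv s (λ j r′ → x ^ j * Z i j r′))
        up : w * U ≈ conv r (λ i s → (q * x) ^ i * stack (suc h) s φ′ (λ ss → f (i ∷ ss)))
        up = trans (*-conv w r _) (conv-cong r λ i s → x∙yz≈y∙xz _ _ _)
        -- Here `q * x` is `q ^ suc (suc h)`, the factor for raising the part of length `i`, and
        -- `q * x * x` is the weight of a down step from height `suc (suc h)`. The exponent of `x`
        -- on the left is `suc s` with `s = i + j + 1`.
        weights : ∀ i j z → x ^ suc (suc (i ℕ.+ j)) * (q ^ suc i * z) ≈ q * x * x * ((q * x) ^ i * (x ^ j * z))
        weights i j z = begin
          x * (x * x ^ (i ℕ.+ j)) * (q * q ^ i * z)   ≈⟨ *-congʳ (*-congˡ (*-congˡ (^-homo-* x i j))) ⟩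
          x * (x * (x ^ i * x ^ j)) * (q * q ^ i * z)
            ≈⟨ solve 6 (λ x q xi xj qi z → (x ⊕ (x ⊕ (xi ⊕ xj))) ⊕ ((q ⊕ qi) ⊕ z) ⊜ ((q ⊕ x) ⊕ x) ⊕ ((qi ⊕ xi) ⊕ (xj ⊕ z)))
                 refl x q (x ^ i) (x ^ j) (q ^ i) z ⟩
          q * x * x * (q ^ i * x ^ i * (x ^ j * z))   ≈⟨ *-congˡ (*-congʳ (^-distrib-* q x i)) ⟨
          q * x * x * ((q * x) ^ i * (x ^ j * z))     ∎
        unfold : ∀ s r′ → x ^ suc s * stack h r′ φ′ (λ ss → f (suc s ∷ ss)) ≈
                 x * (x ^ s * stack h r′ φ′ (λ ss → f (s ∷ ss))) +
                 conv s (λ i j → x ^ suc s * (q ^ suc i * Z i j r′))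
        unfold s r′ = begin
          x ^ suc s * stack h r′ φ′ (λ ss → f (suc s ∷ ss))
            ≈⟨ *-congˡ (trans (stack-cong h r′ (f-suc s)) (stack-+ h r′ _ _)) ⟩
          x ^ suc s * (stack h r′ φ′ (λ ss → f (s ∷ ss)) +
                       stack h r′ φ′ (λ ss ψ → conv s (λ i j → q ^ suc i * f (i ∷ j ∷ ss) (ψ ∘ suc))))
            ≈⟨ *-congˡ (+-congˡ (trans (stack-conv h r′ s _) (conv-cong s λ i j →
                 trans (stack-* h r′ (q ^ suc i) _) (*-congˡ (stack-shift h r′ _))))) ⟩
          x ^ suc s * (stack h r′ φ′ (λ ss → f (s ∷ ss)) + conv s (λ i j → q ^ suc i * Z i j r′))
            ≈⟨ distribˡ _ _ _ ⟩
          x ^ suc s * stack h r′ φ′ (λ ss → f (s ∷ ss)) + x ^ suc s * conv s (λ i j → q ^ suc i * Z i j r′)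
            ≈⟨ +-cong (*-assoc _ _ _) (*-conv _ s _) ⟩
          x * (x ^ s * stack h r′ φ′ (λ ss → f (s ∷ ss))) +
          conv s (λ i j → x ^ suc s * (q ^ suc i * Z i j r′)) ∎

      -- Only height 0 is of interest in the end, but an up step leaves it, so the induction on the
      -- number of steps has to treat all heights.
      motzkin≈stack : ∀ h r φ → motzkin h r φ ≈ stack h r φ f
      motzkin≈stack zero    zero    φ = sym (trans (f-zero [] φ) (f-[] φ))
      motzkin≈stack (suc h) zero    φ = sym (zeroʳ _)
      motzkin≈stack zero    (suc r) φ = begin
        motzkin 1 r φ + motzkin 0 r φ
          ≈⟨ +-cong (motzkin≈stack 1 r φ) (motzkin≈stack 0 r φ) ⟩
        stack 1 r φ f + f (r ∷ []) φ
          ≈⟨ +-congʳ (trans (*-conv _ r _) (conv-cong r λ i j → weights i _)) ⟩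
        conv r (λ i j → q ^ suc i * f (i ∷ j ∷ []) (φ ∘ suc)) + f (r ∷ []) φ
          ≈⟨ +-comm _ _ ⟩
        f (r ∷ []) φ + conv r (λ i j → q ^ suc i * f (i ∷ j ∷ []) (φ ∘ suc))
          ≈⟨ f-suc r [] φ ⟨
        f (suc r ∷ []) φ ∎
        where
        weights : ∀ i z → q ^ 1 * q ^ 0 * ((q ^ 1) ^ i * z) ≈ q ^ suc i * z
        weights i z = trans (*-cong (trans (*-identityʳ _) (*-identityʳ q)) (*-congʳ (^-congˡ i (*-identityʳ q))))
          (sym (*-assoc _ _ _))
      motzkin≈stack (suc h) (suc r) φ = trans
        (+-cong (motzkin≈stack (suc (suc h)) r φ) (*-congˡ (+-cong (motzkin≈stack (suc h) r φ)
          (*-congˡ (motzkin≈stack h r (φ ∘ suc))))))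
        (sym (stack-suc h r φ))

      motzkin≈ : ∀ r φ → motzkin 0 r φ ≈ f (r ∷ []) φ
      motzkin≈ = motzkin≈stack 0

-- The γ-expansion of paths with two kinds of level steps.

module Expansion {c ℓ} (R : CommutativeRing c ℓ) where
  open CommutativeRing R hiding (zero)
  open Polynomials R
  open Sums R
  open Paths R
  open import Algebra.Properties.Semiring.Exp semiring using (^-cong)
  open import Algebra.Properties.CommutativeSemigroup *-commutativeSemigroup
    using (x∙yz≈y∙xz)
  open import Algebra.Solver.CommutativeMonoid *-commutativeMonoid using (solve; _⊕_; _⊜_)
  open import Relation.Binary.Reasoning.Setoid setoid

  -- Kronecker's delta, by recursion so that `δ (suc k) ∘ suc` is `δ k` by computation; this is how
  -- a down step lowers `k` in `down`.
  δ : ℕ → Weight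
  δ zero    zero    = 1#
  δ zero    (suc e) = 0#
  δ (suc k) zero    = 0#
  δ (suc k) (suc e) = δ k e

  δ-≢ : ∀ k e → k ≢ e → δ k e ≈ 0#
  δ-≢ zero    zero    ne = contradiction ≡.refl ne
  δ-≢ zero    (suc e) ne = refl
  δ-≢ (suc k) zero    ne = refl
  δ-≢ (suc k) (suc e) ne = δ-≢ k e (ne ∘ ≡.cong suc)

  δ-≡ : ∀ k → δ k k ≈ 1#
  δ-≡ zero    = refl
  δ-≡ (suc k) = δ-≡ k

  ∑-applyUpTo : ∀ {a} {A : Set a} (g : ℕ → A) n (f : A → Carrier) → ∑ (applyUpTo g n) f ≈ ∑[ k ∈ upTo n ] f (g k)
  ∑-applyUpTo g zero    f = refl
  ∑-applyUpTo g (suc n) f = +-congˡ (trans (∑-applyUpTo (g ∘ suc) n f) (sym (∑-applyUpTo suc n (f ∘ g))))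

  module _ (q t : Carrier) where

    bicoloured : ℕ → ℕ → Carrier
    bicoloured zero    zero    = 1#
    bicoloured (suc h) zero    = 0#
    bicoloured zero    (suc r) = bicoloured 1 r + (t + q) * bicoloured 0 r
    bicoloured (suc h) (suc r) = bicoloured (suc (suc h)) r +
      q ^ suc h * ((t + q) * bicoloured (suc h) r + t * q ^ suc h * bicoloured h r)

    -- The factor between the weights in `bicoloured` and in `motzkin` of a path with `k` down
    -- steps: `t * q` for each down step and `t + q` for each level step. For `n = r + h` there are
    -- `n - 2k` level steps.
    term : ℕ → ℕ → Carrier
    term n k = (t * q) ^ k * (t + q) ^ (n ℕ.∸ 2 ℕ.* k)

    term-suc : ∀ n k → 2 ℕ.* k ℕ.≤ n → term (suc n) k ≈ (t + q) * term n k
    term-suc n k le = trans (*-congˡ (^-cong refl (ℕ.+-∸-assoc 1 le))) (x∙yz≈y∙xz _ _ _)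

    motzkin-δ-vanishes : ∀ h r k → r ℕ.+ h ℕ.< 2 ℕ.* k → motzkin q h r (δ k) ≈ 0#
    motzkin-δ-vanishes h r k lt = motzkin-vanishes q h r λ e le → δ-≢ k e
      λ { ≡.refl → ℕ.<⇒≱ lt le }

    -- For `2k > r + h` both truncated exponents in `term` are 0 and no factor `t + q` splits off;
    -- but then no path has `k` down steps and both sides vanish.
    level : ∀ h r k → motzkin q h r (δ k) * term (suc (r ℕ.+ h)) k ≈ (t + q) * (motzkin q h r (δ k) * term (r ℕ.+ h) k)
    level h r k with 2 ℕ.* k ℕ.≤? r ℕ.+ h
    ... | yes le = trans (*-congˡ (term-suc (r ℕ.+ h) k le)) (x∙yz≈y∙xz _ _ _)
    ... | no gt  = trans (zero· _) (sym (trans (*-congˡ (zero· _)) (zeroʳ _)))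
      where
      zero· : ∀ x → motzkin q h r (δ k) * x ≈ 0#
      zero· x = trans (*-congʳ (motzkin-δ-vanishes h r k (ℕ.≰⇒> gt))) (zeroˡ x)

    expansion : ℕ → ℕ → ℕ → Carrier
    expansion K h r = ∑[ k ∈ upTo K ] (motzkin q h r (δ k) * term (r ℕ.+ h) k)

    -- The down step removes one from `k` and two from `r + h`, which leaves the exponent of `t + q`
    -- as it was. The summand for `k = 0` vanishes because a down step has already been made.
    down : ∀ K h r → ∑[ k ∈ upTo (suc K) ] (motzkin q h r (δ k ∘ suc) * term (suc r ℕ.+ suc h) k) ≈ t * q * expansion K h r
    down K h r = begin
      motzkin q h r (λ _ → 0#) * term (suc r ℕ.+ suc h) 0 + ∑ (applyUpTo suc K) _
        ≈⟨ +-cong (trans (*-congʳ (motzkin-vanishes q h r λ _ _ → refl)) (zeroˡ _)) (∑-applyUpTo suc K _) ⟩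
      0# + ∑[ k ∈ upTo K ] (motzkin q h r (δ k) * term (suc r ℕ.+ suc h) (suc k))
        ≈⟨ +-identityˡ _ ⟩
      ∑[ k ∈ upTo K ] (motzkin q h r (δ k) * term (suc r ℕ.+ suc h) (suc k))
        ≈⟨ ∑-cong (upTo K) (λ k → trans (*-congˡ (trans (*-assoc _ _ _) (*-congˡ (*-congˡ (^-cong refl (exponent k)))))) (x∙yz≈y∙xz _ _ _)) ⟩
      ∑[ k ∈ upTo K ] (t * q * (motzkin q h r (δ k) * term (r ℕ.+ h) k))
        ≈⟨ *-∑ (t * q) (upTo K) _ ⟨
      t * q * expansion K h r ∎
      where
      exponent : ∀ k → suc r ℕ.+ suc h ℕ.∸ 2 ℕ.* suc k ≡ r ℕ.+ h ℕ.∸ 2 ℕ.* k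
      exponent k = ≡.cong₂ ℕ._∸_ (≡.cong suc (ℕ.+-suc r h)) (ℕ.*-suc 2 k)

    -- The bound on `K` lets `k` run through every possible number of down steps. It survives a down
    -- step, which costs one unit of `K` and two of `r + h`.
    expansion≈bicoloured : ∀ K h r → r ℕ.+ h ℕ.< 2 ℕ.* K → expansion K h r ≈ bicoloured h r
    expansion≈bicoloured (suc K) zero zero lt = begin
      1# * term 0 0 + ∑ (applyUpTo suc K) _
        ≈⟨ +-cong (*-identityˡ _) (trans (∑-applyUpTo suc K _) (∑-zero (upTo K) λ k → zeroˡ _)) ⟩
      1# * 1# + 0# ≈⟨ trans (+-identityʳ _) (*-identityˡ 1#) ⟩
      1# ∎
    expansion≈bicoloured K (suc h) zero lt = ∑-zero (upTo K) λ k → zeroˡ _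
    expansion≈bicoloured K zero (suc r) lt = begin
      ∑[ k ∈ upTo K ] ((motzkin q 1 r (δ k) + motzkin q 0 r (δ k)) * term (suc r ℕ.+ 0) k)
        ≈⟨ ∑-cong (upTo K) (λ k → trans (distribʳ _ _ _) (+-cong (*-congˡ (reflexive (≡.cong (λ n → term n k) (≡.sym (ℕ.+-suc r 0))))) (level 0 r k))) ⟩
      ∑[ k ∈ upTo K ] (motzkin q 1 r (δ k) * term (r ℕ.+ 1) k + (t + q) * (motzkin q 0 r (δ k) * term (r ℕ.+ 0) k))
        ≈⟨ trans (∑-+ (upTo K) _ _) (+-congˡ (sym (*-∑ (t + q) (upTo K) _))) ⟩
      expansion K 1 r + (t + q) * expansion K 0 r
        ≈⟨ +-cong (expansion≈bicoloured K 1 r (ℕ.≤-<-trans (ℕ.≤-reflexive (ℕ.+-suc r 0)) lt))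
                  (*-congˡ (expansion≈bicoloured K 0 r (ℕ.<-trans (ℕ.n<1+n _) lt))) ⟩
      bicoloured 1 r + (t + q) * bicoloured 0 r ∎
    expansion≈bicoloured (suc K) (suc h) (suc r) lt = begin
      ∑[ k ∈ upTo (suc K) ] ((U k + x * (L k + q ^ h * D k)) * T k)
        ≈⟨ ∑-cong (upTo (suc K)) (λ k → trans (distribʳ _ _ _) (+-cong (*-congˡ (reflexive (≡.cong (λ n → term n k) (≡.sym (ℕ.+-suc r (suc h))))))
             (trans (*-assoc _ _ _) (*-congˡ (trans (distribʳ _ _ _) (+-cong (level (suc h) r k) (*-assoc _ _ _))))))) ⟩
      ∑[ k ∈ upTo (suc K) ] (U k * term (r ℕ.+ suc (suc h)) k + x * ((t + q) * (L k * term (r ℕ.+ suc h) k) + q ^ h * (D k * T k)))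
        ≈⟨ trans (∑-+ (upTo (suc K)) _ _) (+-congˡ (trans (sym (*-∑ x (upTo (suc K)) _)) (*-congˡ (trans (∑-+ (upTo (suc K)) _ _)
             (+-cong (sym (*-∑ (t + q) (upTo (suc K)) _)) (sym (*-∑ (q ^ h) (upTo (suc K)) _))))))) ⟩
      expansion (suc K) (suc (suc h)) r + x * ((t + q) * expansion (suc K) (suc h) r + q ^ h * (∑[ k ∈ upTo (suc K) ] (D k * T k)))
        ≈⟨ +-cong (expansion≈bicoloured (suc K) (suc (suc h)) r (ℕ.≤-<-trans (ℕ.≤-reflexive (ℕ.+-suc r (suc h))) lt))
             (*-congˡ (+-cong (*-congˡ (expansion≈bicoloured (suc K) (suc h) r (ℕ.<-trans (ℕ.n<1+n _) lt)))
               (trans (*-congˡ (trans (down K h r) (*-congˡ (expansion≈bicoloured K h r lt′))))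
                 (solve 4 (λ t q y z → y ⊕ ((t ⊕ q) ⊕ z) ⊜ (t ⊕ (q ⊕ y)) ⊕ z) refl t q (q ^ h) (bicoloured h r))))) ⟩
      bicoloured (suc h) (suc r) ∎
      where
      x = q ^ suc h
      U L D T : ℕ → Carrier
      U k = motzkin q (suc (suc h)) r (δ k)
      L k = motzkin q (suc h) r (δ k)
      D k = motzkin q h r (δ k ∘ suc)
      T k = term (suc r ℕ.+ suc h) k
      lt′ : r ℕ.+ h ℕ.< 2 ℕ.* K
      lt′ = ℕ.s<s⁻¹ (ℕ.s<s⁻¹ (≡.subst₂ ℕ._<_ (≡.cong suc (ℕ.+-suc r h)) (ℕ.*-suc 2 K) lt))

-- Counting, inversions, and the insertion of a point into a permutation.

module Counting where
  open ≡ using (refl; sym; trans; cong; cong₂; subst; subst₂)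
  open MonoidSum ℕ.+-0-commutativeMonoid using (sum-cong-≗; sum-remove; sum-permute; sum-replicate-zero; ∑-distrib-+)
    renaming (sum to sumᶠ; ∑-comm to sum-comm)

  ind : {P : Set} → Dec P → ℕ
  ind P? = if does P? then 1 else 0

  ind-true : {P : Set} (P? : Dec P) → P → ind P? ≡ 1
  ind-true P? p rewrite dec-true P? p = refl

  ind-false : {P : Set} (P? : Dec P) → ¬ P → ind P? ≡ 0
  ind-false P? ¬p rewrite dec-false P? ¬p = refl

  ind-cong : {P Q : Set} (P? : Dec P) (Q? : Dec Q) → P ⇔ Q → ind P? ≡ ind Q?
  ind-cong P? (yes q) e = ind-true P? (from e q)
  ind-cong P? (no ¬q) e = ind-false P? (¬q ∘ to e)

  length-filter-map : ∀ {a} {A B : Set a} {P : B → Set} (P? : Decidable P) (g : A → B) xs →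
                      length (filter P? (map g xs)) ≡ length (filter (P? ∘ g) xs)
  length-filter-map P? g []       = refl
  length-filter-map P? g (x ∷ xs) with does (P? (g x))
  ... | true  = cong suc (length-filter-map P? g xs)
  ... | false = length-filter-map P? g xs

  length-filter-tabulate : {A : Set} {P : A → Set} (P? : Decidable P) (g : Fin n → A) →
                           length (filter P? (tabulate g)) ≡ sumᶠ (λ i → ind (P? (g i)))
  length-filter-tabulate {n = zero}  P? g = refl
  length-filter-tabulate {n = suc n} P? g with does (P? (g zero))
  ... | true  = cong suc (length-filter-tabulate P? (g ∘ suc))
  ... | false = length-filter-tabulate P? (g ∘ suc)

  #₁-sum : {P : Fin m → Set} (P? : Decidable P) → #₁ P? ≡ sumᶠ (λ i → ind (P? i))
  #₁-sum P? = length-filter-tabulate P? id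

  #₂-sum : {P : Fin m → Fin n → Set} (P? : ∀ i j → Dec (P i j)) → #₂ P? ≡ sumᶠ (λ i → sumᶠ (λ j → ind (P? i j)))
  #₂-sum {m} {n} P? = rows id
    where
    rows : ∀ {l} (g : Fin l → Fin m) →
           length (filter (uncurry P?) (cartesianProduct (tabulate g) (allFin n))) ≡ sumᶠ (λ i → sumᶠ (λ j → ind (P? (g i) j)))
    rows {zero}  g = refl
    rows {suc l} g = trans
      (cong length (filter-++ (uncurry P?) (map (g zero ,_) (allFin n)) _))
      (trans (length-++ (filter (uncurry P?) (map (g zero ,_) (allFin n))))
        (cong₂ ℕ._+_
          (trans (length-filter-map (uncurry P?) (g zero ,_) (allFin n)) (length-filter-tabulate (P? (g zero)) id))
          (rows (g ∘ suc))))

  #₁-cong : {P Q : Fin m → Set} (P? : Decidable P) (Q? : Decidable Q) → (∀ i → P i ⇔ Q i) → #₁ P? ≡ #₁ Q?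
  #₁-cong P? Q? e = trans (#₁-sum P?) (trans (sum-cong-≗ λ i → ind-cong (P? i) (Q? i) (e i)) (sym (#₁-sum Q?)))

  #₁-suc : {P : Fin (suc m) → Set} (P? : Decidable P) → #₁ P? ≡ ind (P? zero) ℕ.+ #₁ (P? ∘ suc)
  #₁-suc P? = trans (#₁-sum P?) (cong (ind (P? zero) ℕ.+_) (sym (#₁-sum (P? ∘ suc))))

  #₁-remove : ∀ i {P : Fin (suc m) → Set} (P? : Decidable P) → #₁ P? ≡ ind (P? i) ℕ.+ #₁ (P? ∘ punchIn i)
  #₁-remove i P? = trans (#₁-sum P?) (trans (sum-remove {i = i} (λ j → ind (P? j))) (cong (ind (P? i) ℕ.+_) (sym (#₁-sum (P? ∘ punchIn i)))))

  #₁-permute : (π : Permutation′ m) {P : Fin m → Set} (P? : Decidable P) → #₁ P? ≡ #₁ (λ i → P? (π ⟨$⟩ʳ i))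
  #₁-permute π P? = trans (#₁-sum P?) (trans (sum-permute _ π) (sym (#₁-sum λ i → P? (π ⟨$⟩ʳ i))))

  #₁-none : {P : Fin m → Set} (P? : Decidable P) → (∀ i → ¬ P i) → #₁ P? ≡ 0
  #₁-none {m} P? none = trans (#₁-sum P?) (trans (sum-cong-≗ λ i → ind-false (P? i) (none i)) (sum-replicate-zero m))

  #₁≡0⇒none : {P : Fin m → Set} (P? : Decidable P) → #₁ P? ≡ 0 → ∀ i → ¬ P i
  #₁≡0⇒none {suc m} P? eq zero    p = contradiction (trans (sym (cong (ℕ._+ #₁ (P? ∘ suc)) (ind-true (P? zero) p))) (trans (sym (#₁-suc P?)) eq)) λ ()
  #₁≡0⇒none {suc m} P? eq (suc i) p = #₁≡0⇒none (P? ∘ suc) (ℕ.m+n≡0⇒n≡0 (ind (P? zero)) (trans (sym (#₁-suc P?)) eq)) i p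

  #₁-+ : {P Q S : Fin m → Set} (P? : Decidable P) (Q? : Decidable Q) (S? : Decidable S) →
         (∀ i → ind (P? i) ≡ ind (Q? i) ℕ.+ ind (S? i)) → #₁ P? ≡ #₁ Q? ℕ.+ #₁ S?
  #₁-+ P? Q? S? e = begin
    #₁ P?                                                       ≡⟨ #₁-sum P? ⟩
    sumᶠ (λ i → ind (P? i))                                     ≡⟨ sum-cong-≗ e ⟩
    sumᶠ (λ i → ind (Q? i) ℕ.+ ind (S? i))                      ≡⟨ ∑-distrib-+ (λ i → ind (Q? i)) (λ i → ind (S? i)) ⟩
    sumᶠ (λ i → ind (Q? i)) ℕ.+ sumᶠ (λ i → ind (S? i))         ≡⟨ cong₂ ℕ._+_ (#₁-sum Q?) (#₁-sum S?) ⟨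
    #₁ Q? ℕ.+ #₁ S?                                             ∎
    where open ≡.≡-Reasoning

  #₁-≤ : {P : Fin m → Set} (P? : Decidable P) → #₁ P? ℕ.≤ m
  #₁-≤ {zero}  P? = z≤n
  #₁-≤ {suc m} P? = ℕ.≤-trans (ℕ.≤-reflexive (#₁-suc P?)) (ℕ.+-mono-≤ ind≤1 (#₁-≤ (P? ∘ suc)))
    where
    ind≤1 : ind (P? zero) ℕ.≤ 1
    ind≤1 with does (P? zero)
    ... | true  = ℕ.≤-refl
    ... | false = z≤n

  #₁-< : ∀ m a → a ℕ.≤ m → #₁ {m} (λ i → toℕ i ℕ.<? a) ≡ a
  #₁-< m       zero    le       = #₁-none {m} (λ i → toℕ i ℕ.<? 0) λ _ ()
  #₁-< (suc m) (suc a) (s≤s le) = trans (#₁-suc {m} (λ i → toℕ i ℕ.<? suc a)) (cong suc (trans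
    (#₁-cong {m} (λ i → suc (toℕ i) ℕ.<? suc a) (λ i → toℕ i ℕ.<? a) λ i → mk⇔ ℕ.s<s⁻¹ s≤s)
    (#₁-< m a le)))

  #₂-cong : {P Q : Fin m → Fin n → Set} (P? : ∀ i j → Dec (P i j)) (Q? : ∀ i j → Dec (Q i j)) →
            (∀ i j → P i j ⇔ Q i j) → #₂ P? ≡ #₂ Q?
  #₂-cong P? Q? e = trans (#₂-sum P?) (trans
    (sum-cong-≗ λ i → sum-cong-≗ λ j → ind-cong (P? i j) (Q? i j) (e i j)) (sym (#₂-sum Q?)))

  #₂-comm : {P : Fin m → Fin n → Set} (P? : ∀ i j → Dec (P i j)) → #₂ P? ≡ #₂ (λ j i → P? i j)
  #₂-comm P? = trans (#₂-sum P?) (trans (sum-comm (λ i j → ind (P? i j))) (sym (#₂-sum λ j i → P? i j)))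

  #₂-permute : (π : Permutation′ m) (ρ : Permutation′ n) {P : Fin m → Fin n → Set} (P? : ∀ i j → Dec (P i j)) →
               #₂ P? ≡ #₂ (λ i j → P? (π ⟨$⟩ʳ i) (ρ ⟨$⟩ʳ j))
  #₂-permute π ρ P? = trans (#₂-sum P?) (trans (sum-permute _ π) (trans
    (sum-cong-≗ λ i → sum-permute (λ j → ind (P? (π ⟨$⟩ʳ i) j)) ρ) (sym (#₂-sum λ i j → P? (π ⟨$⟩ʳ i) (ρ ⟨$⟩ʳ j)))))

  #₂-sucˡ : {P : Fin (suc m) → Fin n → Set} (P? : ∀ i j → Dec (P i j)) →
            #₂ P? ≡ #₁ (P? zero) ℕ.+ #₂ (P? ∘ suc)
  #₂-sucˡ P? = trans (#₂-sum P?) (cong₂ ℕ._+_ (sym (#₁-sum (P? zero))) (sym (#₂-sum (P? ∘ suc))))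

  #₂-sucʳ : {P : Fin m → Fin (suc n) → Set} (P? : ∀ i j → Dec (P i j)) →
            #₂ P? ≡ #₁ (λ i → P? i zero) ℕ.+ #₂ (λ i j → P? i (suc j))
  #₂-sucʳ P? = trans (#₂-comm P?) (trans (#₂-sucˡ (λ j i → P? i j)) (cong (#₁ (λ i → P? i zero) ℕ.+_) (sym (#₂-comm λ i j → P? i (suc j)))))

  punchIn-< : ∀ (a : Fin (suc n)) v → toℕ v ℕ.< toℕ a → toℕ (punchIn a v) ≡ toℕ v
  punchIn-< (suc a) zero    lt       = refl
  punchIn-< (suc a) (suc v) (s≤s lt) = cong suc (punchIn-< a v lt)

  punchIn-≥ : ∀ (a : Fin (suc n)) v → toℕ a ℕ.≤ toℕ v → punchIn a v ≡ suc v
  punchIn-≥ zero    v       le       = refl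
  punchIn-≥ (suc a) (suc v) (s≤s le) = cong suc (punchIn-≥ a v le)

  punchIn-≤-suc : ∀ (a : Fin (suc n)) v → toℕ (punchIn a v) ℕ.≤ suc (toℕ v)
  punchIn-≤-suc zero    v       = ℕ.≤-refl
  punchIn-≤-suc (suc a) zero    = z≤n
  punchIn-≤-suc (suc a) (suc v) = s≤s (punchIn-≤-suc a v)

  ≤-punchIn : ∀ (a : Fin (suc n)) v → toℕ v ℕ.≤ toℕ (punchIn a v)
  ≤-punchIn zero    v       = ℕ.n≤1+n _
  ≤-punchIn (suc a) zero    = z≤n
  ≤-punchIn (suc a) (suc v) = s≤s (≤-punchIn a v)

  punchIn-mono-< : ∀ (a : Fin (suc n)) {u v} → u Fin.< v → punchIn a u Fin.< punchIn a v
  punchIn-mono-< a {u} {v} lt = ℕ.≰⇒> λ le → ℕ.<⇒≱ lt (Fin.punchIn-cancel-≤ a v u le)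

  punchIn-cancel-< : ∀ (a : Fin (suc n)) {u v} → punchIn a u Fin.< punchIn a v → u Fin.< v
  punchIn-cancel-< a {u} {v} lt = ℕ.≰⇒> λ le → ℕ.<⇒≱ lt (Fin.punchIn-mono-≤ a v u le)

  punchIn-<⇔ : ∀ (a : Fin (suc n)) {u v} → punchIn a u Fin.< punchIn a v ⇔ u Fin.< v
  punchIn-<⇔ a = mk⇔ (punchIn-cancel-< a) (punchIn-mono-< a)

  punchIn-below : ∀ (a : Fin (suc n)) v → punchIn a v Fin.< a ⇔ toℕ v ℕ.< toℕ a
  punchIn-below a v = mk⇔ (ℕ.≤-<-trans (≤-punchIn a v)) λ lt → subst (ℕ._< toℕ a) (sym (punchIn-< a v lt)) lt

  data PunchInView (a : Fin (suc n)) : Fin (suc n) → Set where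
    here  : PunchInView a a
    there : ∀ k → PunchInView a (punchIn a k)

  punchInView : ∀ (a i : Fin (suc n)) → PunchInView a i
  punchInView a i with a Fin.≟ i
  ... | yes refl = here
  ... | no a≢i   = subst (PunchInView a) (Fin.punchIn-punchOut a≢i) (there (punchOut a≢i))

  insert-at : ∀ i j (ρ : Permutation′ m) → insert i j ρ ⟨$⟩ʳ i ≡ j
  insert-at i j ρ with i Fin.≟ i
  ... | yes _  = refl
  ... | no i≢i = contradiction refl i≢i

  ⟨$⟩ʳ-injective : (σ : Permutation′ m) {i j : Fin m} → σ ⟨$⟩ʳ i ≡ σ ⟨$⟩ʳ j → i ≡ j
  ⟨$⟩ʳ-injective σ eq = trans (sym (inverseˡ σ)) (trans (cong (σ ⟨$⟩ˡ_) eq) (inverseˡ σ))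

  inversion? : (σ : Permutation′ m) (i j : Fin m) → Dec (i Fin.< j × σ ⟨$⟩ʳ j Fin.< σ ⟨$⟩ʳ i)
  inversion? σ i j = i Fin.<? j ×-dec (σ ⟨$⟩ʳ j) Fin.<? (σ ⟨$⟩ʳ i)

  inv-cong : (σ τ : Permutation′ m) → σ ≈ₚ τ → inv σ ≡ inv τ
  inv-cong σ τ eq = #₂-cong (inversion? σ) (inversion? τ) λ i j → mk⇔
    (map₂ (subst₂ Fin._<_ (eq j) (eq i))) (map₂ (subst₂ Fin._<_ (sym (eq j)) (sym (eq i))))

  inv-flip : (σ : Permutation′ m) → inv (flip σ) ≡ inv σ
  inv-flip σ = begin
    #₂ (inversion? (flip σ))                                        ≡⟨ #₂-permute σ σ (inversion? (flip σ)) ⟩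
    #₂ (λ i j → inversion? (flip σ) (σ ⟨$⟩ʳ i) (σ ⟨$⟩ʳ j))          ≡⟨ #₂-comm (λ i j → inversion? (flip σ) (σ ⟨$⟩ʳ i) (σ ⟨$⟩ʳ j)) ⟩
    #₂ (λ j i → inversion? (flip σ) (σ ⟨$⟩ʳ i) (σ ⟨$⟩ʳ j))          ≡⟨ #₂-cong (λ j i → inversion? (flip σ) (σ ⟨$⟩ʳ i) (σ ⟨$⟩ʳ j)) (inversion? σ) (λ j i → mk⇔
      (λ (p , r) → subst₂ Fin._<_ (inverseˡ σ) (inverseˡ σ) r , p)
      (λ (p , r) → r , subst₂ Fin._<_ (sym (inverseˡ σ)) (sym (inverseˡ σ)) p)) ⟩
    #₂ (inversion? σ) ∎
    where open ≡.≡-Reasoning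

  -- Position 0 is inverted with exactly the smaller values, and `a` has `toℕ a` of them; all other
  -- pairs keep their order.
  inv-insertˡ : ∀ a (ρ : Permutation′ m) → inv (insert zero a ρ) ≡ toℕ a ℕ.+ inv ρ
  inv-insertˡ {m} a ρ = trans (#₂-sucˡ τ?) (cong₂ ℕ._+_ first (trans (#₂-sucʳ (τ? ∘ suc)) (cong₂ ℕ._+_
    (#₁-none (λ i → τ? (suc i) zero) λ i ())
    (#₂-cong (λ i j → τ? (suc i) (suc j)) (inversion? ρ) λ i j → mk⇔
      (λ (p , r) → ℕ.s<s⁻¹ p , to (punchIn-<⇔ a) r) (λ (p , r) → s≤s p , from (punchIn-<⇔ a) r)))))
    where
    τ? = inversion? (insert zero a ρ)
    first : #₁ (τ? zero) ≡ toℕ a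
    first = begin
      #₁ (τ? zero)                                ≡⟨ #₁-suc (τ? zero) ⟩
      #₁ (τ? zero ∘ suc)                          ≡⟨ #₁-cong (τ? zero ∘ suc) (λ j → toℕ (ρ ⟨$⟩ʳ j) ℕ.<? toℕ a) (λ j → mk⇔
        (λ (_ , lt) → to (punchIn-below a (ρ ⟨$⟩ʳ j)) lt) (λ lt → s≤s z≤n , from (punchIn-below a (ρ ⟨$⟩ʳ j)) lt)) ⟩
      #₁ (λ j → toℕ (ρ ⟨$⟩ʳ j) ℕ.<? toℕ a)        ≡⟨ #₁-permute ρ (λ v → toℕ v ℕ.<? toℕ a) ⟨
      #₁ {m} (λ v → toℕ v ℕ.<? toℕ a)             ≡⟨ #₁-< m (toℕ a) (Fin.toℕ≤pred[n] a) ⟩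
      toℕ a                                       ∎
      where open ≡.≡-Reasoning

  inv-insertʳ : ∀ a (ρ : Permutation′ m) → inv (insert a zero ρ) ≡ toℕ a ℕ.+ inv ρ
  inv-insertʳ a ρ = trans (sym (inv-flip (insert a zero ρ))) (trans
    (inv-cong (flip (insert a zero ρ)) (insert zero a (flip ρ)) (flip-insert a zero ρ))
    (trans (inv-insertˡ a (flip ρ)) (cong (toℕ a ℕ.+_) (inv-flip ρ))))

open Counting

-- Scan states of 321-avoiding permutations.

module Patterns321 where
  open ≡ using (refl; sym; trans; cong; cong₂; subst; subst₂)

  -- `x`, `y`, `z` are the places of `τ` in increasing order of their entries. The property is
  -- decidable, so that for a concrete pattern it is proved by evaluation.
  Sorts : Vec ℕ 3 → (x y z : Fin 3) → Set
  Sorts τ x y z = lookup τ x ℕ.< lookup τ y × lookup τ y ℕ.< lookup τ z ×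
    (∀ a b → lookup τ a ≡ lookup τ b → a ≡ b) ×
    (∀ a b → lookup τ a ℕ.< lookup τ b → (a ≡ x × b ≡ y) ⊎ (a ≡ y × b ≡ z) ⊎ (a ≡ x × b ≡ z))

  sorts? : ∀ τ x y z → Dec (Sorts τ x y z)
  sorts? τ x y z = lookup τ x ℕ.<? lookup τ y ×-dec lookup τ y ℕ.<? lookup τ z ×-dec
    (Fin.all? λ a → Fin.all? λ b → lookup τ a ℕ.≟ lookup τ b →-dec a Fin.≟ b) ×-dec
    (Fin.all? λ a → Fin.all? λ b → lookup τ a ℕ.<? lookup τ b →-dec
      ((a Fin.≟ x ×-dec b Fin.≟ y) ⊎-dec (a Fin.≟ y ×-dec b Fin.≟ z) ⊎-dec (a Fin.≟ x ×-dec b Fin.≟ z)))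

  AvoidsSorted : (x y z : Fin 3) → Permutation′ m → Set
  AvoidsSorted x y z σ = ∀ i j k → i Fin.< j → j Fin.< k → let p = lookup (i ∷ j ∷ k ∷ []) in
    σ ⟨$⟩ʳ p x Fin.< σ ⟨$⟩ʳ p y → ¬ σ ⟨$⟩ʳ p y Fin.< σ ⟨$⟩ʳ p z

  -- The two inequalities of the chain imply the third by transitivity, and trichotomy gives the
  -- converse implications that `Occurrence` also asks for.
  avoids⇔ : ∀ τ x y z {_ : True (sorts? τ x y z)} (σ : Permutation′ m) → Avoids τ σ ⇔ AvoidsSorted x y z σ
  avoids⇔ τ x y z {sorts} σ = mk⇔ sorted unsorted
    where
    xy = proj₁ (toWitness sorts)
    yz = proj₁ (proj₂ (toWitness sorts))
    injective = proj₁ (proj₂ (proj₂ (toWitness sorts)))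
    chain = proj₂ (proj₂ (proj₂ (toWitness sorts)))
    unsorted : AvoidsSorted x y z σ → Avoids τ σ
    unsorted av (i ∷ j ∷ k ∷ []) occ = av i j k
      (proj₁ (occ zero (suc zero)) (s≤s z≤n)) (proj₁ (occ (suc zero) (suc (suc zero))) (s≤s (s≤s z≤n)))
      (proj₁ (proj₂ (occ x y)) xy) (proj₁ (proj₂ (occ y z)) yz)
    sorted : Avoids τ σ → AvoidsSorted x y z σ
    sorted av i j k i<j j<k σxy σyz = av p λ a b → position a b , value a b , λ lt → pattern′ a b lt (ℕ.<-cmp _ _)
      where
      p = i ∷ j ∷ k ∷ []
      position : ∀ a b → a Fin.< b → lookup p a Fin.< lookup p b
      position zero             (suc zero)       _ = i<j
      position zero             (suc (suc zero)) _ = ℕ.<-trans i<j j<k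
      position (suc zero)       (suc (suc zero)) _ = j<k
      position (suc zero)       (suc zero)       (s≤s ())
      position (suc (suc zero)) (suc zero)       (s≤s ())
      position (suc (suc zero)) (suc (suc zero)) (s≤s (s≤s ()))
      value : ∀ a b → lookup τ a ℕ.< lookup τ b → σ ⟨$⟩ʳ lookup p a Fin.< σ ⟨$⟩ʳ lookup p b
      value a b lt with chain a b lt
      ... | inj₁ (refl , refl)        = σxy
      ... | inj₂ (inj₁ (refl , refl)) = σyz
      ... | inj₂ (inj₂ (refl , refl)) = ℕ.<-trans σxy σyz
      pattern′ : ∀ a b → σ ⟨$⟩ʳ lookup p a Fin.< σ ⟨$⟩ʳ lookup p b → _ → lookup τ a ℕ.< lookup τ b
      pattern′ a b lt (tri< τ< _ _) = τ<
      pattern′ a b lt (tri≈ _ τ≡ _) = contradiction lt (ℕ.<-irrefl (cong (λ c → toℕ (σ ⟨$⟩ʳ lookup p c)) (injective a b τ≡)))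
      pattern′ a b lt (tri> _ _ τ>) = contradiction lt (ℕ.<-asym (value b a τ>))

  Avoids321 : Permutation′ m → Set
  Avoids321 = AvoidsSorted 2F 1F 0F

  avoids321⇔ : (σ : Permutation′ m) → Avoids p321 σ ⇔ Avoids321 σ
  avoids321⇔ = avoids⇔ p321 2F 1F 0F

  Above : ℕ → ℕ → Permutation′ m → Set
  Above a b σ = ∀ i → toℕ i ℕ.< a → b ℕ.≤ toℕ (σ ⟨$⟩ʳ i)

  above? : ∀ a b (σ : Permutation′ m) → Dec (Above a b σ)
  above? a b σ = Fin.all? λ i → toℕ i ℕ.<? a →-dec b ℕ.≤? toℕ (σ ⟨$⟩ʳ i)

  -- For ε = 1, no value x ≥ c is a cyclic double ascent; for ε = 0, no condition.
  NoCda : ℕ → ℕ → Permutation′ m → Set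
  NoCda ε c σ = ∀ x → c ℕ.≤ toℕ x → (σ ⟨$⟩ˡ x) Fin.< x → x Fin.< (σ ⟨$⟩ʳ x) → ε ≡ 0

  noCda? : ∀ ε c (σ : Permutation′ m) → Dec (NoCda ε c σ)
  noCda? ε c σ = Fin.all? λ x → c ℕ.≤? toℕ x →-dec ((σ ⟨$⟩ˡ x) Fin.<? x →-dec (x Fin.<? (σ ⟨$⟩ʳ x) →-dec ε ℕ.≟ 0))

  -- The first `a` positions and the first `b` values have been read. Points with both read are
  -- deleted, so a read position holds an unread value; this is `Above`. The threshold `c` separates
  -- what is already settled from the positions and values at which excedances and cyclic double
  -- ascents are still to be decided.
  State : (ε a b c : ℕ) → Permutation′ m → Set
  State ε a b c σ = Avoids321 σ × Above a b σ × NoCda ε c σ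

  avoids321? : (σ : Permutation′ m) → Dec (Avoids321 σ)
  avoids321? σ = Dec.map (avoids321⇔ σ) (avoids? p321 σ)

  opaque
    state? : ∀ ε a b c (σ : Permutation′ m) → Dec (State ε a b c σ)
    state? ε a b c σ = avoids321? σ ×-dec above? a b σ ×-dec noCda? ε c σ

  excedance? : ∀ ε c (σ : Permutation′ m) i → Dec (c ℕ.≤ toℕ i × ε ℕ.+ toℕ i ℕ.≤ toℕ (σ ⟨$⟩ʳ i))
  excedance? ε c σ i = c ℕ.≤? toℕ i ×-dec ε ℕ.+ toℕ i ℕ.≤? toℕ (σ ⟨$⟩ʳ i)

  opaque
    -- Excedances (ε = 1) or weak excedances (ε = 0) at the positions i ≥ c.
    excedances : ℕ → ℕ → Permutation′ m → ℕ
    excedances ε c σ = #₁ (excedance? ε c σ)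

    excedances-cong : ∀ ε c (σ τ : Permutation′ m) → σ ≈ₚ τ → excedances ε c σ ≡ excedances ε c τ
    excedances-cong ε c σ τ eq = #₁-cong (excedance? ε c σ) (excedance? ε c τ) λ i → mk⇔
      (map₂ (subst (λ v → ε ℕ.+ toℕ i ℕ.≤ toℕ v) (eq i))) (map₂ (subst (λ v → ε ℕ.+ toℕ i ℕ.≤ toℕ v) (sym (eq i))))

  state-cong : ∀ ε a b c (σ τ : Permutation′ m) → σ ≈ₚ τ → State ε a b c σ → State ε a b c τ
  state-cong ε a b c σ τ eq (av , ab , nc) =
    (λ i j k i<j j<k ji kj → av i j k i<j j<k (subst₂ Fin._<_ (sym (eq _)) (sym (eq _)) ji) (subst₂ Fin._<_ (sym (eq _)) (sym (eq _)) kj)) ,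
    (λ i lt → subst (λ v → b ℕ.≤ toℕ v) (eq i) (ab i lt)) ,
    (λ x le p r → nc x le (subst (Fin._< x) (sym (flip-cong σ τ eq x)) p) (subst (x Fin.<_) (sym (eq x)) r))

  opaque
    unfolding excedances
    excedances-suc : ∀ ε (a : Fin (suc m)) (τ : Permutation′ (suc m)) →
      excedances ε (toℕ a) τ ≡ ind (ε ℕ.+ toℕ a ℕ.≤? toℕ (τ ⟨$⟩ʳ a)) ℕ.+ excedances ε (suc (toℕ a)) τ
    excedances-suc ε a τ = begin
      #₁ (e? (toℕ a))                                                ≡⟨ #₁-remove a (e? (toℕ a)) ⟩
      ind (e? (toℕ a) a) ℕ.+ #₁ (e? (toℕ a) ∘ punchIn a)             ≡⟨ cong₂ ℕ._+_
        (ind-cong (e? (toℕ a) a) (ε ℕ.+ toℕ a ℕ.≤? toℕ (τ ⟨$⟩ʳ a)) (mk⇔ proj₂ (ℕ.≤-refl ,_)))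
        (#₁-cong (e? (toℕ a) ∘ punchIn a) (e? (suc (toℕ a)) ∘ punchIn a) λ i → mk⇔
          (λ (p , r) → ℕ.≤∧≢⇒< p (λ eq → Fin.punchInᵢ≢i a i (Fin.toℕ-injective (sym eq))) , r)
          (λ (p , r) → ℕ.<⇒≤ p , r)) ⟩
      ind a? ℕ.+ #₁ (e? (suc (toℕ a)) ∘ punchIn a)                   ≡⟨ cong (λ n → ind a? ℕ.+ (n ℕ.+ #₁ (e? (suc (toℕ a)) ∘ punchIn a)))
        (ind-false (e? (suc (toℕ a)) a) (ℕ.n≮n _ ∘ proj₁)) ⟨
      ind a? ℕ.+ (ind (e? (suc (toℕ a)) a) ℕ.+ #₁ (e? (suc (toℕ a)) ∘ punchIn a)) ≡⟨ cong (ind a? ℕ.+_) (#₁-remove a (e? (suc (toℕ a)))) ⟨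
      ind a? ℕ.+ #₁ (e? (suc (toℕ a)))                               ∎
      where
      open ≡.≡-Reasoning
      e? : ∀ c i → Dec (c ℕ.≤ toℕ i × ε ℕ.+ toℕ i ℕ.≤ toℕ (τ ⟨$⟩ʳ i))
      e? c = excedance? ε c τ
      a? : Dec (ε ℕ.+ toℕ a ℕ.≤ toℕ (τ ⟨$⟩ʳ a))
      a? = ε ℕ.+ toℕ a ℕ.≤? toℕ (τ ⟨$⟩ʳ a)

  -- For `h > 0` the value 0 lies to the right of the first `suc h` positions and would complete any
  -- descent among them to a 321. For `h = 0` there is only one such position.
  increasing : ∀ h (ρ : Permutation′ m) → Avoids321 ρ → Above (suc h) h ρ →
               ∀ i j → i Fin.< j → toℕ j ℕ.< suc h → ¬ ρ ⟨$⟩ʳ j Fin.< ρ ⟨$⟩ʳ i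
  increasing zero            ρ av ab i j i<j j≤h ji = contradiction (ℕ.<-≤-trans i<j (ℕ.s≤s⁻¹ j≤h)) λ ()
  increasing {suc m} (suc h) ρ av ab i j i<j j≤h ji = av i j p i<j (ℕ.<-≤-trans j≤h h<p)
    (subst (Fin._< ρ ⟨$⟩ʳ j) (sym (inverseʳ ρ)) (ℕ.<-≤-trans (s≤s z≤n) (ab j j≤h))) ji
    where
    p = ρ ⟨$⟩ˡ zero
    h<p : suc (suc h) ℕ.≤ toℕ p
    h<p = ℕ.≮⇒≥ λ lt → contradiction (subst (λ v → suc h ℕ.≤ toℕ v) (inverseʳ ρ) (ab p lt)) λ ()

  module _ {h : ℕ} (a : Fin (suc m)) (a≡ : toℕ a ≡ suc h) where

    -- A value below `suc h` at `a` is smaller than the value at position 0. If it were not 0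
    -- itself, the value 0 would lie to the right of `a`, and the three points would form a 321.
    smallValue : (τ : Permutation′ (suc m)) → Avoids321 τ → Above (suc h) (suc h) τ →
                 toℕ (τ ⟨$⟩ʳ a) ℕ.< suc h → τ ⟨$⟩ˡ zero ≡ a
    smallValue τ av ab lt with Fin.<-cmp (τ ⟨$⟩ˡ zero) a
    ... | tri≈ _ eq _ = eq
    ... | tri< p<a _ _ = contradiction (ab (τ ⟨$⟩ˡ zero) (subst (toℕ (τ ⟨$⟩ˡ zero) ℕ.<_) a≡ p<a))
        (ℕ.<⇒≱ (subst (ℕ._< suc h) (cong toℕ (sym (inverseʳ τ))) (s≤s z≤n)))
    ... | tri> _ _ a<p = ⊥-elim (av zero a (τ ⟨$⟩ˡ zero) (subst (0 ℕ.<_) (sym a≡) (s≤s z≤n)) a<p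
        (subst (ℕ._< toℕ (τ ⟨$⟩ʳ a)) (cong toℕ (sym (inverseʳ τ)))
          (ℕ.n≢0⇒n>0 λ eq → ℕ.<⇒≢ a<p (cong toℕ (trans (sym (inverseˡ τ)) (cong (τ ⟨$⟩ˡ_) (Fin.toℕ-injective eq))))))
        (ℕ.<-≤-trans lt (ab zero (s≤s z≤n))))

    module _ (ρ : Permutation′ m) where
      private
        τ = insert a zero ρ

        τ-a : τ ⟨$⟩ʳ a ≡ zero
        τ-a = insert-at a zero ρ

        τ-punchIn : ∀ k → τ ⟨$⟩ʳ punchIn a k ≡ suc (ρ ⟨$⟩ʳ k)
        τ-punchIn = insert-punchIn a zero ρ

        τ-suc : ∀ k → suc h ℕ.≤ toℕ k → τ ⟨$⟩ʳ suc k ≡ suc (ρ ⟨$⟩ʳ k)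
        τ-suc k le = trans (cong (τ ⟨$⟩ʳ_) (sym (punchIn-≥ a k (subst (ℕ._≤ toℕ k) (sym a≡) le)))) (τ-punchIn k)

        index< : ∀ k → toℕ (punchIn a k) ℕ.< suc h ⇔ toℕ k ℕ.< suc h
        index< k = subst (λ n → toℕ (punchIn a k) ℕ.< n ⇔ toℕ k ℕ.< n) a≡ (punchIn-below a k)

      -- All other values exceed 0 and drop by one, and so do the positions beyond `a`; from the
      -- threshold on, comparisons of value and position are unaffected. A 321 through the deleted
      -- point has to end in it, and `increasing` rules out the descent that it would need to its
      -- left.
      insertʳ-state⇔ : ∀ ε → State ε (suc h) (suc h) (suc h) τ ⇔ State ε (suc h) h (suc h) ρ
      insertʳ-state⇔ ε = mk⇔
        (λ (av , ab , nc) → avoids⇒ av , above⇒ ab , noCda⇒ nc)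
        (λ (av , ab , nc) → avoids⇐ av ab , above⇐ ab , noCda⇐ nc)
        where
        avoids⇒ : Avoids321 τ → Avoids321 ρ
        avoids⇒ av i j k i<j j<k ji kj = av (punchIn a i) (punchIn a j) (punchIn a k)
          (punchIn-mono-< a i<j) (punchIn-mono-< a j<k)
          (subst₂ Fin._<_ (sym (τ-punchIn k)) (sym (τ-punchIn j)) (s≤s ji))
          (subst₂ Fin._<_ (sym (τ-punchIn j)) (sym (τ-punchIn i)) (s≤s kj))
        above⇒ : Above (suc h) (suc h) τ → Above (suc h) h ρ
        above⇒ ab i lt = ℕ.s≤s⁻¹ (subst (λ v → suc h ℕ.≤ toℕ v) (τ-punchIn i) (ab (punchIn a i) (from (index< i) lt)))
        above⇐ : Above (suc h) h ρ → Above (suc h) (suc h) τ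
        above⇐ ab i lt with punchInView a i
        ... | here    = contradiction lt (ℕ.≤⇒≯ (ℕ.≤-reflexive (sym a≡)))
        ... | there k = subst (λ v → suc h ℕ.≤ toℕ v) (sym (τ-punchIn k)) (s≤s (ab k (to (index< k) lt)))
        noCda⇒ : NoCda ε (suc h) τ → NoCda ε (suc h) ρ
        noCda⇒ nc x le p r = nc (suc x) (ℕ.m≤n⇒m≤1+n le)
          (ℕ.≤-<-trans (punchIn-≤-suc a (ρ ⟨$⟩ˡ x)) (s≤s p))
          (subst (suc x Fin.<_) (sym (τ-suc x le)) (s≤s r))
        noCda⇐ : NoCda ε (suc h) ρ → NoCda ε (suc h) τ
        noCda⇐ nc (suc x) le p r with suc h ℕ.≤? toℕ x
        -- Here `suc x` is `a`, which is mapped to 0 and hence not to anything larger.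
        ... | no gt = contradiction (subst (suc x Fin.<_) (trans (cong (τ ⟨$⟩ʳ_) (Fin.toℕ-injective
                (trans (ℕ.≤-antisym (ℕ.≰⇒> gt) le) (sym a≡)))) τ-a) r) λ ()
        ... | yes h<x = nc x h<x back (ℕ.s<s⁻¹ (subst (suc x Fin.<_) (τ-suc x h<x) r))
          where
          back : (ρ ⟨$⟩ˡ x) Fin.< x
          back with suc h ℕ.≤? toℕ (ρ ⟨$⟩ˡ x)
          -- A position up to `h` lies below every value from `suc h` on.
          ... | no lt  = ℕ.<-≤-trans (ℕ.≰⇒> lt) h<x
          ... | yes le′ = ℕ.s<s⁻¹ (subst (Fin._< suc x) (punchIn-≥ a (ρ ⟨$⟩ˡ x) (subst (ℕ._≤ toℕ (ρ ⟨$⟩ˡ x)) (sym a≡) le′)) p)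
        avoids⇐ : Avoids321 ρ → Above (suc h) h ρ → Avoids321 τ
        avoids⇐ av ab i j k i<j j<k ji kj with punchInView a i | punchInView a j | punchInView a k
        ... | here     | _        | _        = contradiction (subst (τ ⟨$⟩ʳ j Fin.<_) τ-a kj) λ ()
        ... | there i′ | here     | _        = contradiction (subst (τ ⟨$⟩ʳ k Fin.<_) τ-a ji) λ ()
        ... | there i′ | there j′ | there k′ = av i′ j′ k′ (punchIn-cancel-< a i<j) (punchIn-cancel-< a j<k)
                (ℕ.s<s⁻¹ (subst₂ Fin._<_ (τ-punchIn k′) (τ-punchIn j′) ji)) (ℕ.s<s⁻¹ (subst₂ Fin._<_ (τ-punchIn j′) (τ-punchIn i′) kj))
        ... | there i′ | there j′ | here     = increasing h ρ av ab i′ j′ (punchIn-cancel-< a i<j)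
                (subst (toℕ j′ ℕ.<_) a≡ (to (punchIn-below a j′) j<k)) (ℕ.s<s⁻¹ (subst₂ Fin._<_ (τ-punchIn j′) (τ-punchIn i′) kj))

      opaque
        unfolding excedances
        insertʳ-excedances : ∀ ε → excedances ε (suc h) τ ≡ excedances ε (suc h) ρ
        insertʳ-excedances ε = begin
          #₁ τ?                           ≡⟨ #₁-remove a τ? ⟩
          ind (τ? a) ℕ.+ #₁ (τ? ∘ punchIn a) ≡⟨ cong₂ ℕ._+_
            (ind-false (τ? a) λ (h<a , le) → contradiction
              (ℕ.≤-trans h<a (ℕ.≤-trans (ℕ.m≤n+m (toℕ a) ε) (subst (λ v → ε ℕ.+ toℕ a ℕ.≤ toℕ v) τ-a le))) λ ())
            (#₁-cong (τ? ∘ punchIn a) ρ? λ i → mk⇔ (λ (le , r) → ⇒ i le r) λ (le , r) → ⇐ i le r) ⟩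
          #₁ ρ?                           ∎
          where
          open ≡.≡-Reasoning
          τ? : ∀ i → Dec (suc h ℕ.≤ toℕ i × ε ℕ.+ toℕ i ℕ.≤ toℕ (τ ⟨$⟩ʳ i))
          τ? = excedance? ε (suc h) τ
          ρ? : ∀ i → Dec (suc h ℕ.≤ toℕ i × ε ℕ.+ toℕ i ℕ.≤ toℕ (ρ ⟨$⟩ʳ i))
          ρ? = excedance? ε (suc h) ρ
          ⇒ : ∀ i → suc h ℕ.≤ toℕ (punchIn a i) → ε ℕ.+ toℕ (punchIn a i) ℕ.≤ toℕ (τ ⟨$⟩ʳ punchIn a i) →
              suc h ℕ.≤ toℕ i × ε ℕ.+ toℕ i ℕ.≤ toℕ (ρ ⟨$⟩ʳ i)
          ⇒ i le r = h<i , ℕ.s≤s⁻¹ (subst₂ ℕ._≤_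
            (trans (cong (λ k → ε ℕ.+ toℕ k) (punchIn-≥ a i (subst (ℕ._≤ toℕ i) (sym a≡) h<i))) (ℕ.+-suc ε (toℕ i)))
            (cong toℕ (τ-punchIn i)) r)
            where
            h<i : suc h ℕ.≤ toℕ i
            h<i = ℕ.≮⇒≥ λ lt → ℕ.<⇒≱ (from (index< i) lt) le
          ⇐ : ∀ i → suc h ℕ.≤ toℕ i → ε ℕ.+ toℕ i ℕ.≤ toℕ (ρ ⟨$⟩ʳ i) →
              suc h ℕ.≤ toℕ (punchIn a i) × ε ℕ.+ toℕ (punchIn a i) ℕ.≤ toℕ (τ ⟨$⟩ʳ punchIn a i)
          ⇐ i h<i r = ℕ.≤-trans h<i (≤-punchIn a i) , subst₂ ℕ._≤_
            (sym (trans (cong (λ k → ε ℕ.+ toℕ k) (punchIn-≥ a i (subst (ℕ._≤ toℕ i) (sym a≡) h<i))) (ℕ.+-suc ε (toℕ i))))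
            (sym (cong toℕ (τ-punchIn i))) (s≤s r)

  -- A value below `h` sits at a position from `h` on, to the right of position 0, whose value is at
  -- least `h`. A still smaller value further right would complete a 321.
  smallIncreasing : ∀ h (ρ : Permutation′ m) → Avoids321 ρ → Above h h ρ →
                    ∀ j k → j Fin.< k → ρ ⟨$⟩ʳ k Fin.< ρ ⟨$⟩ʳ j → ¬ toℕ (ρ ⟨$⟩ʳ j) ℕ.< h
  smallIncreasing {suc m} h ρ av ab j k j<k kj lt = av zero j k (ℕ.<-≤-trans 0<h h≤j) j<k kj (ℕ.<-≤-trans lt (ab zero 0<h))
    where
    0<h : 0 ℕ.< h
    0<h = ℕ.≤-<-trans z≤n lt
    h≤j : h ℕ.≤ toℕ j
    h≤j = ℕ.≮⇒≥ λ j<h → ℕ.<⇒≱ lt (ab j j<h)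

  module _ (a : Fin (suc m)) where

    -- By avoidance, a position i ≤ a with value a can only be position 0.
    raise : (τ : Permutation′ (suc m)) → Avoids321 τ → Above (suc (toℕ a)) (toℕ a) τ →
            τ ⟨$⟩ʳ zero ≢ a → Above (suc (toℕ a)) (suc (toℕ a)) τ
    raise τ av ab τ0≢a i i≤a = ℕ.≤∧≢⇒< (ab i i≤a) λ eq → contra i i≤a (Fin.toℕ-injective (sym eq))
      where
      a<τ0 : a Fin.< τ ⟨$⟩ʳ zero
      a<τ0 = ℕ.≤∧≢⇒< (ab zero (s≤s z≤n)) (τ0≢a ∘ sym ∘ Fin.toℕ-injective)
      contra : ∀ i → toℕ i ℕ.< suc (toℕ a) → ¬ τ ⟨$⟩ʳ i ≡ a
      contra zero    _  eq = τ0≢a eq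
      contra (suc i) lt eq = av zero (suc i) p (s≤s z≤n) (ℕ.<-≤-trans lt a<p)
        (subst₂ Fin._<_ (sym (inverseʳ τ)) (sym eq) 0<a) (subst (Fin._< τ ⟨$⟩ʳ zero) (sym eq) a<τ0)
        where
        p = τ ⟨$⟩ˡ zero
        0<a : 0 ℕ.< toℕ a
        0<a = ℕ.<-≤-trans (s≤s z≤n) (ℕ.s≤s⁻¹ lt)
        a<p : suc (toℕ a) ℕ.≤ toℕ p
        a<p = ℕ.≮⇒≥ λ lt′ → ℕ.<⇒≱ 0<a (subst (λ v → toℕ a ℕ.≤ toℕ v) (inverseʳ τ) (ab p lt′))

    module _ (ρ : Permutation′ m) where
      private
        τ = insert zero a ρ

        value> : ∀ v {k} → toℕ a ℕ.≤ k → k ℕ.≤ toℕ v ⇔ suc k ℕ.≤ toℕ (punchIn a v)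
        value> v {k} le = mk⇔
          (λ kv → subst (suc k ℕ.≤_) (cong toℕ (sym (punchIn-≥ a v (ℕ.≤-trans le kv)))) (s≤s kv))
          (λ kv → ℕ.s≤s⁻¹ (ℕ.≤-trans kv (punchIn-≤-suc a v)))

        value≥ : ∀ v → toℕ a ℕ.≤ toℕ v ⇔ toℕ a ℕ.≤ toℕ (punchIn a v)
        value≥ v = mk⇔ (λ le → ℕ.≤-trans le (≤-punchIn a v)) (λ le → ℕ.≮⇒≥ λ lt → ℕ.<⇒≱ (from (punchIn-below a v) lt) le)

        τˡ-suc : ∀ x → toℕ a ℕ.≤ toℕ x → τ ⟨$⟩ˡ suc x ≡ suc (ρ ⟨$⟩ˡ x)
        τˡ-suc x le = trans (cong (τ ⟨$⟩ˡ_) (sym (punchIn-≥ a x le)))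
          (trans (flip-insert zero a ρ (punchIn a x)) (insert-punchIn a zero (flip ρ) x))

      -- All positions and the values above `a` drop by one, so comparisons from the threshold on
      -- are kept while the threshold itself drops by one. A 321 through the deleted point starts in
      -- it, and `smallIncreasing` rules out the descent below `a` that would follow.
      insertˡ-state⇔ : ∀ ε → State ε (suc (toℕ a)) (toℕ a) (suc (toℕ a)) τ ⇔ State ε (toℕ a) (toℕ a) (toℕ a) ρ
      insertˡ-state⇔ ε = mk⇔
        (λ (av , ab , nc) → avoids⇒ av , above⇒ ab , noCda⇒ nc)
        (λ (av , ab , nc) → avoids⇐ av ab , above⇐ ab , noCda⇐ nc)
        where
        avoids⇒ : Avoids321 τ → Avoids321 ρ
        avoids⇒ av i j k i<j j<k kj ji = av (suc i) (suc j) (suc k) (s≤s i<j) (s≤s j<k) (punchIn-mono-< a kj) (punchIn-mono-< a ji)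
        avoids⇐ : Avoids321 ρ → Above (toℕ a) (toℕ a) ρ → Avoids321 τ
        avoids⇐ av ab (suc i) (suc j) (suc k) i<j j<k kj ji =
          av i j k (ℕ.s<s⁻¹ i<j) (ℕ.s<s⁻¹ j<k) (punchIn-cancel-< a kj) (punchIn-cancel-< a ji)
        avoids⇐ av ab zero (suc j) (suc k) _ j<k kj ja = smallIncreasing (toℕ a) ρ av ab j k
          (ℕ.s<s⁻¹ j<k) (punchIn-cancel-< a kj) (to (punchIn-below a (ρ ⟨$⟩ʳ j)) ja)
        above⇒ : Above (suc (toℕ a)) (toℕ a) τ → Above (toℕ a) (toℕ a) ρ
        above⇒ ab i lt = from (value≥ (ρ ⟨$⟩ʳ i)) (ab (suc i) (s≤s lt))
        above⇐ : Above (toℕ a) (toℕ a) ρ → Above (suc (toℕ a)) (toℕ a) τ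
        above⇐ ab zero    lt = ℕ.≤-refl
        above⇐ ab (suc i) lt = to (value≥ (ρ ⟨$⟩ʳ i)) (ab i (ℕ.s≤s⁻¹ lt))
        noCda⇒ : NoCda ε (suc (toℕ a)) τ → NoCda ε (toℕ a) ρ
        noCda⇒ nc x le p r = nc (suc x) (s≤s le) (subst (Fin._< suc x) (sym (τˡ-suc x le)) (s≤s p))
          (to (value> (ρ ⟨$⟩ʳ x) (ℕ.m≤n⇒m≤1+n le)) r)
        noCda⇐ : NoCda ε (toℕ a) ρ → NoCda ε (suc (toℕ a)) τ
        noCda⇐ nc (suc x) le p r = nc x le′ (ℕ.s<s⁻¹ (subst (Fin._< suc x) (τˡ-suc x le′) p))
          (from (value> (ρ ⟨$⟩ʳ x) (ℕ.m≤n⇒m≤1+n le′)) r)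
          where
          le′ = ℕ.s≤s⁻¹ le

      opaque
        unfolding excedances
        insertˡ-excedances : ∀ ε → excedances ε (suc (toℕ a)) τ ≡ excedances ε (toℕ a) ρ
        insertˡ-excedances ε = trans (#₁-suc τ?) (#₁-cong (τ? ∘ suc) (excedance? ε (toℕ a) ρ) λ i → mk⇔
          (λ (le , r) → ℕ.s≤s⁻¹ le , from (value> (ρ ⟨$⟩ʳ i) (≤ε (ℕ.s≤s⁻¹ le))) (subst (ℕ._≤ toℕ (τ ⟨$⟩ʳ suc i)) (ℕ.+-suc ε (toℕ i)) r))
          (λ (le , r) → s≤s le , subst (ℕ._≤ toℕ (τ ⟨$⟩ʳ suc i)) (sym (ℕ.+-suc ε (toℕ i))) (to (value> (ρ ⟨$⟩ʳ i) (≤ε le)) r)))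
          where
          τ? : ∀ i → Dec (suc (toℕ a) ℕ.≤ toℕ i × ε ℕ.+ toℕ i ℕ.≤ toℕ (τ ⟨$⟩ʳ i))
          τ? = excedance? ε (suc (toℕ a)) τ
          ≤ε : ∀ {k} → toℕ a ℕ.≤ k → toℕ a ℕ.≤ ε ℕ.+ k
          ≤ε {k} le = ℕ.≤-trans le (ℕ.m≤n+m k ε)

      -- No position precedes 0, so the value 0 is never a cyclic double ascent and the thresholds 0
      -- and 1 agree.
      insertˡ-fixed-state⇔ : toℕ a ≡ 0 → ∀ ε → State ε 1 0 0 τ ⇔ State ε 1 0 1 τ
      insertˡ-fixed-state⇔ a≡0 ε = mk⇔
        (λ (av , ab , nc) → av , ab , λ x _ → nc x z≤n)
        (λ (av , ab , nc) → av , ab , λ where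
          zero    _ ()
          (suc x) _ → nc (suc x) (s≤s z≤n))

  excedances-fixed : (τ : Permutation′ (suc m)) → τ ⟨$⟩ʳ zero ≡ zero → excedances 1 0 τ ≡ excedances 1 1 τ
  excedances-fixed τ eq = trans (excedances-suc 1 zero τ) (cong (ℕ._+ excedances 1 1 τ)
    (ind-false (1 ℕ.≤? toℕ (τ ⟨$⟩ʳ zero)) λ le → contradiction (subst (λ v → 1 ℕ.≤ toℕ v) eq le) λ ()))

  -- If the value a were taken at position 0, then a would be a cyclic double ascent or the fixed point 0.
  strict-state⇔ : ∀ (a : Fin (suc m)) (τ : Permutation′ (suc m)) → ¬ (toℕ a ≡ 0 × τ ⟨$⟩ʳ zero ≡ zero) →
    State 1 (suc (toℕ a)) (toℕ a) (toℕ a) τ ⇔ State 1 (suc (toℕ a)) (suc (toℕ a)) (suc (toℕ a)) τ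
  strict-state⇔ a τ unfixed = mk⇔
    (λ (av , ab , nc) → av , raise a τ av ab (noLoop ab nc) , λ x le → nc x (ℕ.<⇒≤ le))
    (λ (av , ab , nc) → av , (λ i lt → ℕ.<⇒≤ (ab i lt)) , noCda⇐ ab nc)
    where
    noLoop : Above (suc (toℕ a)) (toℕ a) τ → NoCda 1 (toℕ a) τ → τ ⟨$⟩ʳ zero ≢ a
    noLoop ab nc τ0≡a with toℕ a ℕ.≟ 0
    ... | yes a≡0 = unfixed (a≡0 , trans τ0≡a (Fin.toℕ-injective a≡0))
    ... | no a≢0 = contradiction (nc a ℕ.≤-refl
        (subst (Fin._< a) (trans (sym (inverseˡ τ)) (cong (τ ⟨$⟩ˡ_) τ0≡a)) (ℕ.n≢0⇒n>0 a≢0))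
        (ℕ.≤∧≢⇒< (ab a ℕ.≤-refl) λ eq → a≢0 (cong toℕ (sym (⟨$⟩ʳ-injective τ (trans τ0≡a (Fin.toℕ-injective eq))))))) λ ()
    noCda⇐ : Above (suc (toℕ a)) (suc (toℕ a)) τ → NoCda 1 (suc (toℕ a)) τ → NoCda 1 (toℕ a) τ
    noCda⇐ ab nc x le p r with toℕ a ℕ.≟ toℕ x
    ... | no a≢x  = nc x (ℕ.≤∧≢⇒< le a≢x) p r
    ... | yes a≡x = contradiction (subst (λ v → suc (toℕ a) ℕ.≤ toℕ v) (inverseʳ τ)
        (ab (τ ⟨$⟩ˡ x) (ℕ.m≤n⇒m≤1+n (subst (toℕ (τ ⟨$⟩ˡ x) ℕ.<_) (sym a≡x) p)))) (ℕ.<⇒≱ (s≤s (ℕ.≤-reflexive (sym a≡x))))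

  weak-state⇔ : ∀ a b c d (τ : Permutation′ m) → State 0 a b c τ ⇔ State 0 a b d τ
  weak-state⇔ a b c d τ = mk⇔ (λ (av , ab , _) → av , ab , λ _ _ _ _ → refl) (λ (av , ab , _) → av , ab , λ _ _ _ _ → refl)

open Patterns321

-- Words avoiding 231 without double descents.

module Patterns231 where
  open ≡ using (refl; sym; trans; cong; cong₂; subst; subst₂)

  Avoids231 : Permutation′ m → Set
  Avoids231 = AvoidsSorted 2F 0F 1F

  avoids231⇔ : (σ : Permutation′ m) → Avoids p231 σ ⇔ Avoids231 σ
  avoids231⇔ = avoids⇔ p231 2F 0F 1F

  NoDoubleDescent : Permutation′ m → Set
  NoDoubleDescent σ = ∀ i j k → toℕ j ≡ suc (toℕ i) → toℕ k ≡ suc (toℕ j) →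
    σ ⟨$⟩ʳ j Fin.< σ ⟨$⟩ʳ i → ¬ σ ⟨$⟩ʳ k Fin.< σ ⟨$⟩ʳ j

  -- The values below `c` occupy an initial segment of the positions: the permutation splits there
  -- as a direct sum.
  Cut : ℕ → Permutation′ m → Set
  Cut c σ = ∀ x y → x Fin.< y → toℕ (σ ⟨$⟩ʳ y) ℕ.< c → toℕ (σ ⟨$⟩ʳ x) ℕ.< c

  -- Cuts 0 ss σ: σ is a direct sum of permutations of the sizes ss.
  Cuts : ℕ → List ℕ → Permutation′ m → Set
  Cuts o []       σ = ⊤
  Cuts o (s ∷ ss) σ = Cut (o ℕ.+ s) σ × Cuts (o ℕ.+ s) ss σ

  Good : List ℕ → Permutation′ m → Set
  Good ss σ = (Avoids231 σ × NoDoubleDescent σ) × Cuts 0 ss σ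

  module _ (ρ : Permutation′ m) where
    private
      τ = insert zero zero ρ

    insert₀-avoids⇔ : Avoids231 τ ⇔ Avoids231 ρ
    insert₀-avoids⇔ = mk⇔
      (λ av i j k i<j j<k ki ij → av (suc i) (suc j) (suc k) (s≤s i<j) (s≤s j<k) (s≤s ki) (s≤s ij))
      λ where
        av (suc i) (suc j) (suc k) i<j j<k ki ij →
          av i j k (ℕ.s<s⁻¹ i<j) (ℕ.s<s⁻¹ j<k) (ℕ.s<s⁻¹ ki) (ℕ.s<s⁻¹ ij)

    insert₀-noDoubleDescent⇔ : NoDoubleDescent τ ⇔ NoDoubleDescent ρ
    insert₀-noDoubleDescent⇔ = mk⇔
      (λ nd i j k ij jk p r → nd (suc i) (suc j) (suc k) (cong suc ij) (cong suc jk) (s≤s p) (s≤s r))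
      λ where
        nd (suc i) (suc j) (suc k) ij jk p r →
          nd i j k (ℕ.suc-injective ij) (ℕ.suc-injective jk) (ℕ.s<s⁻¹ p) (ℕ.s<s⁻¹ r)

    insert₀-cut⇔ : ∀ c → Cut (suc c) τ ⇔ Cut c ρ
    insert₀-cut⇔ c = mk⇔
      (λ cut x y x<y lt → ℕ.s<s⁻¹ (cut (suc x) (suc y) (s≤s x<y) (s≤s lt)))
      λ where
        cut zero    y       x<y lt → s≤s z≤n
        cut (suc x) (suc y) x<y lt → s≤s (cut x y (ℕ.s<s⁻¹ x<y) (ℕ.s<s⁻¹ lt))

    insert₀-cuts⇔ : ∀ o ss → Cuts (suc o) ss τ ⇔ Cuts o ss ρ
    insert₀-cuts⇔ o []       = mk⇔ id id
    insert₀-cuts⇔ o (s ∷ ss) = mk⇔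
      (λ (c , cs) → to (insert₀-cut⇔ (o ℕ.+ s)) c , to (insert₀-cuts⇔ (o ℕ.+ s) ss) cs)
      (λ (c , cs) → from (insert₀-cut⇔ (o ℕ.+ s)) c , from (insert₀-cuts⇔ (o ℕ.+ s) ss) cs)

    insert₀-good⇔ : ∀ s ss → Good (suc s ∷ ss) τ ⇔ Good (s ∷ ss) ρ
    insert₀-good⇔ s ss = mk⇔
      (λ ((av , nd) , c , cs) → (to insert₀-avoids⇔ av , to insert₀-noDoubleDescent⇔ nd) ,
        to (insert₀-cut⇔ s) c , to (insert₀-cuts⇔ s ss) cs)
      (λ ((av , nd) , c , cs) → (from insert₀-avoids⇔ av , from insert₀-noDoubleDescent⇔ nd) ,
        from (insert₀-cut⇔ s) c , from (insert₀-cuts⇔ s ss) cs)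

  module _ (i : Fin (suc m)) (ρ : Permutation′ m) where
    private
      τ = insert zero (suc i) (insert zero zero ρ)

      value-< : ∀ v {c} → toℕ i ℕ.≤ c → suc (toℕ (punchIn i v)) ℕ.< suc (suc c) ⇔ toℕ v ℕ.< c
      value-< v {c} le = mk⇔
        (λ lt → case′ (ℕ.s<s⁻¹ lt)) (λ lt → s≤s (ℕ.≤-<-trans (punchIn-≤-suc i v) (s≤s lt)))
        where
        case′ : toℕ (punchIn i v) ℕ.< suc c → toℕ v ℕ.< c
        case′ lt with toℕ i ℕ.≤? toℕ v
        ... | yes i≤v = ℕ.s<s⁻¹ (subst (λ u → toℕ u ℕ.< suc c) (punchIn-≥ i v i≤v) lt)
        ... | no i≰v  = ℕ.<-≤-trans (ℕ.≰⇒> i≰v) le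

    -- The letter 0 in second place is minimal and could only end a 231, with too few letters before
    -- it. The first letter can only be the 2 of a 231; then a value at least `toℕ i` of `ρ`
    -- precedes one below `toℕ i`, which is what the cut forbids.
    insert₂-avoids⇔ : Avoids231 τ ⇔ (Avoids231 ρ × Cut (toℕ i) ρ)
    insert₂-avoids⇔ = mk⇔ (λ av → avoids⇒ av , cut⇒ av) λ (av , cut) → avoids⇐ av cut
      where
      avoids⇒ : Avoids231 τ → Avoids231 ρ
      avoids⇒ av a b c a<b b<c p r = av (suc (suc a)) (suc (suc b)) (suc (suc c)) (s≤s (s≤s a<b)) (s≤s (s≤s b<c))
        (s≤s (punchIn-mono-< i p)) (s≤s (punchIn-mono-< i r))
      cut⇒ : Avoids231 τ → Cut (toℕ i) ρ
      cut⇒ av x y x<y lt = ℕ.≰⇒> λ le → av zero (suc (suc x)) (suc (suc y)) (s≤s z≤n) (s≤s (s≤s x<y))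
        (s≤s (from (punchIn-below i (ρ ⟨$⟩ʳ y)) lt))
        (s≤s (subst (toℕ i ℕ.<_) (cong toℕ (sym (punchIn-≥ i (ρ ⟨$⟩ʳ x) le))) (s≤s le)))
      avoids⇐ : Avoids231 ρ → Cut (toℕ i) ρ → Avoids231 τ
      avoids⇐ av cut zero (suc (suc b)) (suc (suc c)) a<b b<c p r = ℕ.<-asym (ℕ.s<s⁻¹ r)
        (from (punchIn-below i (ρ ⟨$⟩ʳ b)) (cut b c (ℕ.s<s⁻¹ (ℕ.s<s⁻¹ b<c)) (to (punchIn-below i (ρ ⟨$⟩ʳ c)) (ℕ.s<s⁻¹ p))))
      avoids⇐ av cut zero (suc (suc b)) (suc zero) a<b (s≤s ())
      avoids⇐ av cut (suc zero) (suc (suc b)) (suc zero) a<b (s≤s ())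
      avoids⇐ av cut (suc (suc a)) (suc (suc b)) (suc zero) a<b (s≤s ())
      avoids⇐ av cut (suc (suc a)) (suc zero) c (s≤s ())
      avoids⇐ av cut (suc (suc a)) (suc (suc b)) (suc (suc c)) a<b b<c p r = av a b c
        (ℕ.s<s⁻¹ (ℕ.s<s⁻¹ a<b)) (ℕ.s<s⁻¹ (ℕ.s<s⁻¹ b<c)) (punchIn-cancel-< i (ℕ.s<s⁻¹ p)) (punchIn-cancel-< i (ℕ.s<s⁻¹ r))

    insert₂-noDoubleDescent⇔ : NoDoubleDescent τ ⇔ NoDoubleDescent ρ
    insert₂-noDoubleDescent⇔ = mk⇔
      (λ nd a b c ab bc p r → nd (suc (suc a)) (suc (suc b)) (suc (suc c)) (cong (2 ℕ.+_) ab) (cong (2 ℕ.+_) bc)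
        (s≤s (punchIn-mono-< i p)) (s≤s (punchIn-mono-< i r)))
      λ where
        nd (suc (suc a)) (suc (suc b)) (suc (suc c)) ab bc p r → nd a b c
          (ℕ.suc-injective (ℕ.suc-injective ab)) (ℕ.suc-injective (ℕ.suc-injective bc))
          (punchIn-cancel-< i (ℕ.s<s⁻¹ p)) (punchIn-cancel-< i (ℕ.s<s⁻¹ r))

    insert₂-cut⇔ : ∀ c → toℕ i ℕ.≤ c → Cut (suc (suc c)) τ ⇔ Cut c ρ
    insert₂-cut⇔ c le = mk⇔
      (λ cut x y x<y lt → to (value-< (ρ ⟨$⟩ʳ x) le)
        (cut (suc (suc x)) (suc (suc y)) (s≤s (s≤s x<y)) (from (value-< (ρ ⟨$⟩ʳ y) le) lt)))
      λ where
        cut zero          y             x<y lt → s≤s (s≤s le)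
        cut (suc zero)    y             x<y lt → s≤s z≤n
        cut (suc (suc x)) (suc zero)    (s≤s ())
        cut (suc (suc x)) (suc (suc y)) x<y lt → from (value-< (ρ ⟨$⟩ʳ x) le)
          (cut x y (ℕ.s<s⁻¹ (ℕ.s<s⁻¹ x<y)) (to (value-< (ρ ⟨$⟩ʳ y) le) lt))

    insert₂-cuts⇔ : ∀ o ss → toℕ i ℕ.≤ o → Cuts (suc (suc o)) ss τ ⇔ Cuts o ss ρ
    insert₂-cuts⇔ o []       le = mk⇔ id id
    insert₂-cuts⇔ o (s ∷ ss) le = mk⇔
      (λ (c , cs) → to (insert₂-cut⇔ (o ℕ.+ s) le′) c , to (insert₂-cuts⇔ (o ℕ.+ s) ss le′) cs)
      (λ (c , cs) → from (insert₂-cut⇔ (o ℕ.+ s) le′) c , from (insert₂-cuts⇔ (o ℕ.+ s) ss le′) cs)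
      where
      le′ : toℕ i ℕ.≤ o ℕ.+ s
      le′ = ℕ.≤-trans le (ℕ.m≤m+n o s)

    -- The additional cut at `toℕ i`, which splits the first summand in two, comes from avoidance;
    -- the other cuts are those of `τ`, moved by the two letters removed.
    insert₂-good⇔ : ∀ j ss → Good (suc (suc (toℕ i ℕ.+ j)) ∷ ss) τ ⇔ Good (toℕ i ∷ j ∷ ss) ρ
    insert₂-good⇔ j ss = mk⇔
      (λ ((av , nd) , c , cs) → (proj₁ (to insert₂-avoids⇔ av) , to insert₂-noDoubleDescent⇔ nd) ,
        proj₂ (to insert₂-avoids⇔ av) , to (insert₂-cut⇔ (toℕ i ℕ.+ j) le) c , to (insert₂-cuts⇔ (toℕ i ℕ.+ j) ss le) cs)
      (λ ((av , nd) , cᵢ , c , cs) → (from insert₂-avoids⇔ (av , cᵢ) , from insert₂-noDoubleDescent⇔ nd) ,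
        from (insert₂-cut⇔ (toℕ i ℕ.+ j) le) c , from (insert₂-cuts⇔ (toℕ i ℕ.+ j) ss le) cs)
      where
      le : toℕ i ℕ.≤ toℕ i ℕ.+ j
      le = ℕ.m≤m+n (toℕ i) j

  -- Otherwise the second letter either continues a double descent or, with the first letter and 0, an occurrence of 231.
  second-zero : (i : Fin (suc m)) (ρ : Permutation′ (suc m)) → Avoids231 (insert zero (suc i) ρ) →
                NoDoubleDescent (insert zero (suc i) ρ) → ρ ⟨$⟩ʳ zero ≡ zero
  second-zero i ρ av nd = cases (ρ ⟨$⟩ˡ zero) (inverseʳ ρ)
    where
    τ : Permutation′ (suc (suc _))
    τ = insert zero (suc i) ρ
    cases : ∀ p → ρ ⟨$⟩ʳ p ≡ zero → ρ ⟨$⟩ʳ zero ≡ zero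
    cases zero    eq = eq
    cases (suc p) eq with ℕ.<-cmp (toℕ (τ ⟨$⟩ʳ suc zero)) (suc (toℕ i))
    ... | tri≈ _ eq′ _ = contradiction (Fin.toℕ-injective eq′) (Fin.punchInᵢ≢i (suc i) (ρ ⟨$⟩ʳ zero))
    ... | tri> _ _ gt  = ⊥-elim (av zero (suc zero) (suc (suc p)) (s≤s z≤n) (s≤s (s≤s z≤n))
            (subst (λ v → punchIn (suc i) v Fin.< suc i) (sym eq) (s≤s z≤n)) gt)
    ... | tri< lt _ _  = second p eq
      where
      below : ∀ {k} → ρ ⟨$⟩ʳ k ≡ zero → ∀ l → l ≢ k → τ ⟨$⟩ʳ suc k Fin.< τ ⟨$⟩ʳ suc l
      below {k} eq l l≢k = subst (λ v → punchIn (suc i) v Fin.< τ ⟨$⟩ʳ suc l) (sym eq)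
        (ℕ.n≢0⇒n>0 λ eq″ → l≢k (⟨$⟩ʳ-injective ρ (trans (Fin.punchIn-injective (suc i) _ zero (Fin.toℕ-injective eq″)) (sym eq))))
      second : ∀ p → ρ ⟨$⟩ʳ suc p ≡ zero → ρ ⟨$⟩ʳ zero ≡ zero
      second zero    eq = ⊥-elim (nd zero (suc zero) (suc (suc zero)) refl refl lt (below eq zero λ ()))
      second (suc p) eq with ℕ.<-cmp (toℕ (τ ⟨$⟩ʳ suc (suc zero))) (toℕ (τ ⟨$⟩ʳ suc zero))
      ... | tri< lt′ _ _ = ⊥-elim (nd zero (suc zero) (suc (suc zero)) refl refl lt lt′)
      ... | tri≈ _ eq′ _ = contradiction (⟨$⟩ʳ-injective τ {suc (suc zero)} {suc zero} (Fin.toℕ-injective eq′)) λ ()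
      ... | tri> _ _ gt  = ⊥-elim (av (suc zero) (suc (suc zero)) (suc (suc (suc p))) (s≤s (s≤s z≤n)) (s≤s (s≤s (s≤s z≤n)))
              (below eq zero λ ()) gt)

  -- If the first letter is not 0, then 0 comes later and lies below the cut, which forces the first
  -- letter below it too.
  first-≤ : ∀ {s} (a : Fin (suc m)) (ρ : Permutation′ m) → Cut (suc s) (insert zero a ρ) → toℕ a ℕ.≤ s
  first-≤ zero                ρ cut = z≤n
  first-≤ {m = suc m} (suc i) ρ cut = ℕ.s≤s⁻¹ (cut zero (suc (ρ ⟨$⟩ˡ zero)) (s≤s z≤n)
    (subst (λ v → toℕ (punchIn (suc i) v) ℕ.< suc _) (sym (inverseʳ ρ)) (s≤s z≤n)))

  descent? : (σ : Permutation′ m) (i : Fin (pred m)) → Dec (σ ⟨$⟩ʳ next {m} i Fin.< σ ⟨$⟩ʳ this {m} i)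
  descent? {m} σ i = (σ ⟨$⟩ʳ next {m} i) Fin.<? (σ ⟨$⟩ʳ this {m} i)

  31-2? : (σ : Permutation′ m) (i : Fin (pred m)) (j : Fin m) → Dec (next {m} i Fin.< j ×
    σ ⟨$⟩ʳ next {m} i Fin.< σ ⟨$⟩ʳ j × σ ⟨$⟩ʳ j Fin.< σ ⟨$⟩ʳ this {m} i)
  31-2? {m} σ i j = next {m} i Fin.<? j ×-dec (σ ⟨$⟩ʳ next {m} i) Fin.<? (σ ⟨$⟩ʳ j) ×-dec (σ ⟨$⟩ʳ j) Fin.<? (σ ⟨$⟩ʳ this {m} i)

  module _ (a : Fin (suc (suc m))) (ρ : Permutation′ (suc m)) where
    private
      τ = insert zero a ρ

    des-insert : des τ ≡ ind (descent? τ zero) ℕ.+ des ρ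
    des-insert = trans (#₁-suc (descent? τ)) (cong (ind (descent? τ zero) ℕ.+_)
      (#₁-cong (descent? τ ∘ suc) (descent? ρ) λ i → punchIn-<⇔ a))

    31-2-insert : ⟨31-2⟩ τ ≡ #₁ (31-2? τ zero) ℕ.+ ⟨31-2⟩ ρ
    31-2-insert = trans (#₂-sucˡ (31-2? τ)) (cong (#₁ (31-2? τ zero) ℕ.+_) (trans (#₂-sucʳ (31-2? τ ∘ suc)) (cong₂ ℕ._+_
      (#₁-none (λ i → 31-2? τ (suc i) zero) λ i ())
      (#₂-cong (λ i j → 31-2? τ (suc i) (suc j)) (31-2? ρ) λ i j → mk⇔
        (λ (p , r , t) → ℕ.s<s⁻¹ p , to (punchIn-<⇔ a) r , to (punchIn-<⇔ a) t)
        (λ (p , r , t) → s≤s p , from (punchIn-<⇔ a) r , from (punchIn-<⇔ a) t)))))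

  des-insert₀ : (ρ : Permutation′ m) → des (insert zero zero ρ) ≡ des ρ
  des-insert₀ {zero}  ρ = refl
  des-insert₀ {suc m} ρ = trans (des-insert zero ρ) (cong (ℕ._+ des ρ) (ind-false (descent? (insert zero zero ρ) zero) λ ()))

  31-2-insert₀ : (ρ : Permutation′ m) → ⟨31-2⟩ (insert zero zero ρ) ≡ ⟨31-2⟩ ρ
  31-2-insert₀ {zero}  ρ = refl
  31-2-insert₀ {suc m} ρ = trans (31-2-insert zero ρ) (cong (ℕ._+ ⟨31-2⟩ ρ)
    (#₁-none (31-2? (insert zero zero ρ) zero) λ j ()))

  des-insert₂ : (i : Fin (suc m)) (ρ : Permutation′ m) → des (insert zero (suc i) (insert zero zero ρ)) ≡ suc (des ρ)
  des-insert₂ i ρ = trans (des-insert (suc i) (insert zero zero ρ)) (cong₂ ℕ._+_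
    (ind-true (descent? (insert zero (suc i) (insert zero zero ρ)) zero) (s≤s z≤n)) (des-insert₀ ρ))

  -- The initial descent from `suc i` to 0 encloses exactly `toℕ i` values, all of them to its
  -- right.
  31-2-insert₂ : (i : Fin (suc m)) (ρ : Permutation′ m) →
                 ⟨31-2⟩ (insert zero (suc i) (insert zero zero ρ)) ≡ toℕ i ℕ.+ ⟨31-2⟩ ρ
  31-2-insert₂ {m} i ρ = trans (31-2-insert (suc i) (insert zero zero ρ)) (cong₂ ℕ._+_ first (31-2-insert₀ ρ))
    where
    τ : Permutation′ (suc (suc m))
    τ = insert zero (suc i) (insert zero zero ρ)
    τ? : ∀ (j : Fin (suc (suc m))) → Dec (Fin.suc (Fin.zero {m}) Fin.< j × τ ⟨$⟩ʳ suc zero Fin.< τ ⟨$⟩ʳ j × τ ⟨$⟩ʳ j Fin.< τ ⟨$⟩ʳ zero)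
    τ? = 31-2? τ zero
    first : #₁ τ? ≡ toℕ i
    first = begin
      #₁ τ?
        ≡⟨ #₁-suc τ? ⟩
      #₁ {suc m} (λ j → τ? (suc j))
        ≡⟨ #₁-suc {m} (λ j → τ? (suc j)) ⟩
      #₁ {m} (λ j → τ? (suc (suc j)))
        ≡⟨ #₁-cong {m} (λ j → τ? (suc (suc j))) (λ j → toℕ (ρ ⟨$⟩ʳ j) ℕ.<? toℕ i) (λ j → mk⇔
             (λ (_ , _ , lt) → to (punchIn-below i (ρ ⟨$⟩ʳ j)) (ℕ.s<s⁻¹ lt))
             (λ lt → s≤s (s≤s z≤n) , s≤s z≤n , s≤s (from (punchIn-below i (ρ ⟨$⟩ʳ j)) lt))) ⟩
      #₁ (λ j → toℕ (ρ ⟨$⟩ʳ j) ℕ.<? toℕ i)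
        ≡⟨ #₁-permute ρ (λ v → toℕ v ℕ.<? toℕ i) ⟨
      #₁ {m} (λ v → toℕ v ℕ.<? toℕ i)
        ≡⟨ #₁-< m (toℕ i) (Fin.toℕ≤pred[n] i) ⟩
      toℕ i ∎
      where open ≡.≡-Reasoning

  lookup-∷ʳ : ∀ {A : Set} (f : Fin m → A) r (x : Fin (suc m)) i → toℕ x ≡ toℕ i → lookup (Vec.tabulate f ∷ʳ r) x ≡ f i
  lookup-∷ʳ f r zero    zero    eq = refl
  lookup-∷ʳ f r (suc x) (suc i) eq = lookup-∷ʳ (f ∘ suc) r x i (ℕ.suc-injective eq)

  lookup-∷ʳ-last : ∀ {A : Set} (f : Fin m → A) r (x : Fin (suc m)) → toℕ x ≡ m → lookup (Vec.tabulate f ∷ʳ r) x ≡ r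
  lookup-∷ʳ-last {zero}  f r zero    eq = refl
  lookup-∷ʳ-last {suc m} f r (suc x) eq = lookup-∷ʳ-last (f ∘ suc) r x (ℕ.suc-injective eq)

  -- _≺_ and _⊏_ are _<_ and _<⁺_ for double descents, and the reverse relations for double ascents.
  module _ (l r : ℕ ⁺) (_≺_ : ℕ → ℕ → Set) (_⊏_ : ℕ ⁺ → ℕ ⁺ → Set)
           (⊏⇔≺ : ∀ a b → [ suc a ] ⊏ [ suc b ] ⇔ a ≺ b)
           (l-minimal : ∀ x → ¬ x ⊏ l) (r-maximal : ∀ x → ¬ r ⊏ x) (σ : Permutation′ m) where
    private
      f : Fin m → ℕ ⁺
      f i = [ suc (toℕ (σ ⟨$⟩ʳ i)) ]

      w : Fin (suc (suc m)) → ℕ ⁺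
      w = lookup (extend l r σ)

      w-centre : ∀ i → w (suc (inject₁ i)) ≡ f i
      w-centre i = lookup-∷ʳ f r (inject₁ i) i (Fin.toℕ-inject₁ i)

      w-left : ∀ i j → toℕ j ≡ suc (toℕ i) → w (inject₁ (inject₁ j)) ≡ f i
      w-left i (suc j) eq = lookup-∷ʳ f r (inject₁ (inject₁ j)) i
        (trans (Fin.toℕ-inject₁ (inject₁ j)) (trans (Fin.toℕ-inject₁ j) (ℕ.suc-injective eq)))

      w-right : ∀ j k → toℕ k ≡ suc (toℕ j) → w (suc (suc j)) ≡ f k
      w-right j k eq = lookup-∷ʳ f r (suc j) k (sym eq)

      left-cases : ∀ (j : Fin m) → w (inject₁ (inject₁ j)) ≡ l ⊎ (∃ λ (i : Fin m) → toℕ j ≡ suc (toℕ i))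
      left-cases zero    = inj₁ refl
      left-cases (suc j) = inj₂ (inject₁ j , cong suc (sym (Fin.toℕ-inject₁ j)))

      right-cases : ∀ (j : Fin m) → w (suc (suc j)) ≡ r ⊎ (∃ λ (k : Fin m) → toℕ k ≡ suc (toℕ j))
      right-cases j with suc (toℕ j) ℕ.<? m
      ... | yes lt = inj₂ (fromℕ< lt , Fin.toℕ-fromℕ< lt)
      ... | no nlt = inj₁ (lookup-∷ʳ-last f r (suc j) (ℕ.≤-antisym (Fin.toℕ<n j) (ℕ.≮⇒≥ nlt)))

      value : Fin m → ℕ
      value i = toℕ (σ ⟨$⟩ʳ i)

    -- The sentinels take part in no double step, since nothing is `⊏ l` and `r ⊏` nothing. So the
    -- two end positions drop out and three honest letters remain.
    noDoubleStep⇔ :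
      (∀ i j k → toℕ j ≡ suc (toℕ i) → toℕ k ≡ suc (toℕ j) → value j ≺ value i → ¬ value k ≺ value j) ⇔
      (∀ j → ¬ (w (suc (inject₁ j)) ⊏ w (inject₁ (inject₁ j)) × w (suc (suc j)) ⊏ w (suc (inject₁ j))))
    noDoubleStep⇔ = mk⇔ ⇒ ⇐
      where
      ⇒ : _ → ∀ j → ¬ (w (suc (inject₁ j)) ⊏ w (inject₁ (inject₁ j)) × w (suc (suc j)) ⊏ w (suc (inject₁ j)))
      ⇒ none j (p , t) with left-cases j | right-cases j
      ... | inj₁ eq       | _              = l-minimal _ (subst (w (suc (inject₁ j)) ⊏_) eq p)
      ... | inj₂ _        | inj₁ eq        = r-maximal _ (subst (_⊏ w (suc (inject₁ j))) eq t)
      ... | inj₂ (i , ij) | inj₂ (k , jk)  = none i j k ij jk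
        (to (⊏⇔≺ _ _) (subst₂ _⊏_ (w-centre j) (w-left i j ij) p)) (to (⊏⇔≺ _ _) (subst₂ _⊏_ (w-right j k jk) (w-centre j) t))
      ⇐ : _ → ∀ i j k → toℕ j ≡ suc (toℕ i) → toℕ k ≡ suc (toℕ j) → value j ≺ value i → ¬ value k ≺ value j
      ⇐ none i j k ij jk p t = none j
        (subst₂ _⊏_ (sym (w-centre j)) (sym (w-left i j ij)) (from (⊏⇔≺ _ _) p) ,
         subst₂ _⊏_ (sym (w-right j k jk)) (sym (w-centre j)) (from (⊏⇔≺ _ _) t))

  []<⁺⇔ : ∀ a b → [ suc a ] <⁺ [ suc b ] ⇔ a ℕ.< b
  []<⁺⇔ a b = mk⇔ (λ { [ lt ] → ℕ.s<s⁻¹ lt }) (λ lt → [ s≤s lt ])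

  ≮⁺0 : ∀ x → ¬ x <⁺ [ 0 ]
  ≮⁺0 x [ () ]

  ⊤⁺≮⁺ : ∀ x → ¬ ⊤⁺ <⁺ x
  ⊤⁺≮⁺ x ()

  ldd≡0⇔ : (σ : Permutation′ m) → ldd σ ≡ 0 ⇔ NoDoubleDescent σ
  ldd≡0⇔ {m} σ = mk⇔
    (λ eq → from (noDoubleStep⇔ [ 0 ] ⊤⁺ ℕ._<_ _<⁺_ []<⁺⇔ ≮⁺0 ⊤⁺≮⁺ σ) (#₁≡0⇒none ldd? eq))
    (λ nd → #₁-none ldd? (to (noDoubleStep⇔ [ 0 ] ⊤⁺ ℕ._<_ _<⁺_ []<⁺⇔ ≮⁺0 ⊤⁺≮⁺ σ) nd))
    where
    w : Fin (suc (suc m)) → ℕ ⁺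
    w = lookup (extend [ 0 ] ⊤⁺ σ)
    ldd? : ∀ (i : Fin m) → Dec (w (suc (inject₁ i)) <⁺ w (inject₁ (inject₁ i)) × w (suc (suc i)) <⁺ w (suc (inject₁ i)))
    ldd? i = w (suc (inject₁ i)) <⁺? w (inject₁ (inject₁ i)) ×-dec w (suc (suc i)) <⁺? w (suc (inject₁ i))

  NoDoubleAscent : Permutation′ m → Set
  NoDoubleAscent σ = ∀ i j k → toℕ j ≡ suc (toℕ i) → toℕ k ≡ suc (toℕ j) →
    σ ⟨$⟩ʳ i Fin.< σ ⟨$⟩ʳ j → ¬ σ ⟨$⟩ʳ j Fin.< σ ⟨$⟩ʳ k

  rda≡0⇔ : (σ : Permutation′ m) → rda σ ≡ 0 ⇔ NoDoubleAscent σ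
  rda≡0⇔ {m} σ = mk⇔
    (λ eq → from (noDoubleStep⇔ ⊤⁺ [ 0 ] ℕ._>_ (λ x y → y <⁺ x) (λ a b → []<⁺⇔ b a) ⊤⁺≮⁺ ≮⁺0 σ) (#₁≡0⇒none rda? eq))
    (λ nd → #₁-none rda? (to (noDoubleStep⇔ ⊤⁺ [ 0 ] ℕ._>_ (λ x y → y <⁺ x) (λ a b → []<⁺⇔ b a) ⊤⁺≮⁺ ≮⁺0 σ) nd))
    where
    w : Fin (suc (suc m)) → ℕ ⁺
    w = lookup (extend ⊤⁺ [ 0 ] σ)
    rda? : ∀ (i : Fin m) → Dec (w (inject₁ (inject₁ i)) <⁺ w (suc (inject₁ i)) × w (suc (inject₁ i)) <⁺ w (suc (suc i)))
    rda? i = w (inject₁ (inject₁ i)) <⁺? w (suc (inject₁ i)) ×-dec w (suc (inject₁ i)) <⁺? w (suc (suc i))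

open Patterns231

-- Reversal and complement of permutations.

module Symmetries where
  open ≡ using (refl; sym; trans; cong; subst; subst₂)

  opposite-anti : {i j : Fin m} → i Fin.< j → opposite j Fin.< opposite i
  opposite-anti {m} {i} {j} i<j = subst₂ ℕ._<_ (sym (Fin.opposite-prop j)) (sym (Fin.opposite-prop i))
    (ℕ.∸-monoʳ-< (s≤s i<j) (Fin.toℕ<n j))

  opposite-<⇔ : {i j : Fin m} → opposite j Fin.< opposite i ⇔ i Fin.< j
  opposite-<⇔ {i = i} {j} = mk⇔
    (λ lt → subst₂ Fin._<_ (Fin.opposite-involutive i) (Fin.opposite-involutive j) (opposite-anti lt)) opposite-anti

  opposite-suc-toℕ : {i j : Fin m} → toℕ j ≡ suc (toℕ i) → toℕ (opposite i) ≡ suc (toℕ (opposite j))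
  opposite-suc-toℕ {suc m} {i} {j} eq = begin
    toℕ (opposite i)        ≡⟨ Fin.opposite-prop i ⟩
    m ℕ.∸ toℕ i               ≡⟨ cong (suc m ℕ.∸_) eq ⟨
    suc m ℕ.∸ toℕ j         ≡⟨ ℕ.+-∸-assoc 1 (Fin.toℕ≤pred[n] j) ⟩
    suc (m ℕ.∸ toℕ j)       ≡⟨ cong suc (Fin.opposite-prop j) ⟨
    suc (toℕ (opposite j))  ∎
    where open ≡.≡-Reasoning

  opposite-inject₁ : (i : Fin m) → opposite (inject₁ i) ≡ suc (opposite i)
  opposite-inject₁ zero    = refl
  opposite-inject₁ (suc i) = cong inject₁ (opposite-inject₁ i)

  opposite-next : (i : Fin (pred m)) → opposite (next {m} i) ≡ this {m} (opposite i)
  opposite-next {suc m} i = refl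

  opposite-this : (i : Fin (pred m)) → opposite (this {m} i) ≡ next {m} (opposite i)
  opposite-this {suc m} i = opposite-inject₁ i

  rev comp rc : Permutation′ m → Permutation′ m
  rev σ  = reverse ∘ₚ σ
  comp σ = σ ∘ₚ reverse
  rc σ   = rev (comp σ)

  rev-involutive : (σ : Permutation′ m) → rev (rev σ) ≈ₚ σ
  rev-involutive σ i = cong (σ ⟨$⟩ʳ_) (Fin.opposite-involutive i)

  comp-involutive : (σ : Permutation′ m) → comp (comp σ) ≈ₚ σ
  comp-involutive σ i = Fin.opposite-involutive _

  rc-involutive : (σ : Permutation′ m) → rc (rc σ) ≈ₚ σ
  rc-involutive σ i = trans (Fin.opposite-involutive _) (cong (σ ⟨$⟩ʳ_) (Fin.opposite-involutive i))

  Avoids132 Avoids213 Avoids312 : Permutation′ m → Set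
  Avoids132 = AvoidsSorted 0F 2F 1F
  Avoids213 = AvoidsSorted 1F 0F 2F
  Avoids312 = AvoidsSorted 1F 2F 0F

  avoidsSorted-cong : ∀ x y z (σ τ : Permutation′ m) → σ ≈ₚ τ → AvoidsSorted x y z σ → AvoidsSorted x y z τ
  avoidsSorted-cong x y z σ τ eq av i j k i<j j<k p r = av i j k i<j j<k
    (subst₂ Fin._<_ (sym (eq _)) (sym (eq _)) p) (subst₂ Fin._<_ (sym (eq _)) (sym (eq _)) r)

  avoids132⇔ : (σ : Permutation′ m) → Avoids132 σ ⇔ Avoids231 (rev σ)
  avoids132⇔ σ = mk⇔
    (λ av i j k i<j j<k → av (opposite k) (opposite j) (opposite i) (opposite-anti j<k) (opposite-anti i<j))
    (λ av → avoidsSorted-cong 0F 2F 1F (rev (rev σ)) σ (rev-involutive σ)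
      λ i j k i<j j<k → av (opposite k) (opposite j) (opposite i) (opposite-anti j<k) (opposite-anti i<j))

  avoids213⇔ : (σ : Permutation′ m) → Avoids213 σ ⇔ Avoids231 (comp σ)
  avoids213⇔ σ = mk⇔
    (λ av i j k i<j j<k p r → av i j k i<j j<k (to opposite-<⇔ r) (to opposite-<⇔ p))
    (λ av i j k i<j j<k p r → av i j k i<j j<k (opposite-anti r) (opposite-anti p))

  avoids312⇔ : (σ : Permutation′ m) → Avoids312 σ ⇔ Avoids231 (rc σ)
  avoids312⇔ σ = mk⇔
    (λ av i j k i<j j<k p r → av (opposite k) (opposite j) (opposite i) (opposite-anti j<k) (opposite-anti i<j)
      (to opposite-<⇔ r) (to opposite-<⇔ p))
    (λ av → avoidsSorted-cong 1F 2F 0F (rev (rev σ)) σ (rev-involutive σ)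
      λ i j k i<j j<k p r → av (opposite k) (opposite j) (opposite i) (opposite-anti j<k) (opposite-anti i<j)
        (opposite-anti r) (opposite-anti p))

  noDoubleDescent-cong : (σ τ : Permutation′ m) → σ ≈ₚ τ → NoDoubleDescent σ → NoDoubleDescent τ
  noDoubleDescent-cong σ τ eq nd i j k ij jk p r = nd i j k ij jk
    (subst₂ Fin._<_ (sym (eq j)) (sym (eq i)) p) (subst₂ Fin._<_ (sym (eq k)) (sym (eq j)) r)

  noDoubleAscent-rev⇔ : (σ : Permutation′ m) → NoDoubleAscent σ ⇔ NoDoubleDescent (rev σ)
  noDoubleAscent-rev⇔ σ = mk⇔
    (λ na i j k ij jk p r → na (opposite k) (opposite j) (opposite i) (opposite-suc-toℕ jk) (opposite-suc-toℕ ij) r p)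
    (λ nd i j k ij jk p r → nd (opposite k) (opposite j) (opposite i) (opposite-suc-toℕ jk) (opposite-suc-toℕ ij)
      (subst₂ Fin._<_ (sym (rev-involutive σ j)) (sym (rev-involutive σ k)) r)
      (subst₂ Fin._<_ (sym (rev-involutive σ i)) (sym (rev-involutive σ j)) p))

  noDoubleAscent-comp⇔ : (σ : Permutation′ m) → NoDoubleAscent σ ⇔ NoDoubleDescent (comp σ)
  noDoubleAscent-comp⇔ σ = mk⇔
    (λ na i j k ij jk p r → na i j k ij jk (to opposite-<⇔ p) (to opposite-<⇔ r))
    (λ nd i j k ij jk p r → nd i j k ij jk (opposite-anti p) (opposite-anti r))

  noDoubleDescent-comp⇔ : (σ : Permutation′ m) → NoDoubleDescent σ ⇔ NoDoubleAscent (comp σ)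
  noDoubleDescent-comp⇔ σ = mk⇔
    (λ nd i j k ij jk p r → nd i j k ij jk (to opposite-<⇔ p) (to opposite-<⇔ r))
    (λ na i j k ij jk p r → na i j k ij jk (opposite-anti p) (opposite-anti r))

  descents-cong : (σ τ : Permutation′ m) → σ ≈ₚ τ → des σ ≡ des τ
  descents-cong {m} σ τ eq = #₁-cong (descent? σ) (descent? τ) λ i → mk⇔
    (subst₂ Fin._<_ (eq (next {m} i)) (eq (this {m} i))) (subst₂ Fin._<_ (sym (eq (next {m} i))) (sym (eq (this {m} i))))

  31-2-cong : (σ τ : Permutation′ m) → σ ≈ₚ τ → ⟨31-2⟩ σ ≡ ⟨31-2⟩ τ
  31-2-cong {m} σ τ eq = #₂-cong (31-2? σ) (31-2? τ) λ i j → mk⇔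
    (λ (p , r , t) → p , subst₂ Fin._<_ (eq (next {m} i)) (eq j) r , subst₂ Fin._<_ (eq j) (eq (this {m} i)) t)
    (λ (p , r , t) → p , subst₂ Fin._<_ (sym (eq (next {m} i))) (sym (eq j)) r , subst₂ Fin._<_ (sym (eq j)) (sym (eq (this {m} i))) t)

  module _ (σ : Permutation′ m) where
    private
      v : Fin m → Fin m
      v = σ ⟨$⟩ʳ_

      nx th : Fin (pred m) → Fin m
      nx = next {m}
      th = this {m}

    asc≡des-rev : asc σ ≡ des (rev σ)
    asc≡des-rev = begin
      #₁ ascent?                       ≡⟨ #₁-permute reverse ascent? ⟩
      #₁ (λ i → ascent? (opposite i))  ≡⟨ #₁-cong (λ i → ascent? (opposite i)) (descent? (rev σ)) (λ i → mk⇔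
        (subst₂ (λ x y → v x Fin.< v y) (sym (opposite-next {m} i)) (sym (opposite-this {m} i)))
        (subst₂ (λ x y → v x Fin.< v y) (opposite-next {m} i) (opposite-this {m} i))) ⟩
      des (rev σ)                      ∎
      where
      open ≡.≡-Reasoning
      ascent? : ∀ i → Dec (v (th i) Fin.< v (nx i))
      ascent? i = v (th i) Fin.<? v (nx i)

    asc≡des-comp : asc σ ≡ des (comp σ)
    asc≡des-comp = #₁-cong (λ i → v (th i) Fin.<? v (nx i)) (descent? (comp σ)) λ i →
      mk⇔ opposite-anti (to opposite-<⇔)

    des≡asc-comp : des σ ≡ asc (comp σ)
    des≡asc-comp = #₁-cong (descent? σ) (λ i → opposite (v (th i)) Fin.<? opposite (v (nx i))) λ i →
      mk⇔ opposite-anti (to opposite-<⇔)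

    -- Reversing both indices moves `j` from the left to the right of the adjacent pair and turns
    -- the ascent of the pair into a descent.
    2-13≡31-2-rev : ⟨2-13⟩ σ ≡ ⟨31-2⟩ (rev σ)
    2-13≡31-2-rev = begin
      #₂ 2-13?                                      ≡⟨ #₂-permute reverse reverse 2-13? ⟩
      #₂ (λ i j → 2-13? (opposite i) (opposite j))  ≡⟨ #₂-cong (λ i j → 2-13? (opposite i) (opposite j)) (31-2? (rev σ)) (λ i j → mk⇔
        (λ (p , r , t) → to opposite-<⇔ (subst (opposite j Fin.<_) (sym (opposite-next {m} i)) p) ,
          subst (λ x → v x Fin.< v (opposite j)) (sym (opposite-next {m} i)) r ,
          subst (λ x → v (opposite j) Fin.< v x) (sym (opposite-this {m} i)) t)
        (λ (p , r , t) → subst (opposite j Fin.<_) (opposite-next {m} i) (opposite-anti p) ,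
          subst (λ x → v x Fin.< v (opposite j)) (opposite-next {m} i) r ,
          subst (λ x → v (opposite j) Fin.< v x) (opposite-this {m} i) t)) ⟩
      ⟨31-2⟩ (rev σ)                                ∎
      where
      open ≡.≡-Reasoning
      2-13? : ∀ i j → Dec (j Fin.< th i × v (th i) Fin.< v j × v j Fin.< v (nx i))
      2-13? i j = j Fin.<? th i ×-dec v (th i) Fin.<? v j ×-dec v j Fin.<? v (nx i)

    13-2≡31-2-comp : ⟨13-2⟩ σ ≡ ⟨31-2⟩ (comp σ)
    13-2≡31-2-comp = #₂-cong
      (λ i j → nx i Fin.<? j ×-dec v (th i) Fin.<? v j ×-dec v j Fin.<? v (nx i)) (31-2? (comp σ)) λ i j → mk⇔
      (λ (p , r , t) → p , opposite-anti t , opposite-anti r)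
      (λ (p , r , t) → p , to opposite-<⇔ t , to opposite-<⇔ r)

    2-31≡2-13-comp : ⟨2-31⟩ σ ≡ ⟨2-13⟩ (comp σ)
    2-31≡2-13-comp = #₂-cong
      (λ i j → j Fin.<? th i ×-dec v (nx i) Fin.<? v j ×-dec v j Fin.<? v (th i))
      (λ i j → j Fin.<? th i ×-dec opposite (v (th i)) Fin.<? opposite (v j) ×-dec opposite (v j) Fin.<? opposite (v (nx i)))
      λ i j → mk⇔
      (λ (p , r , t) → p , opposite-anti t , opposite-anti r)
      (λ (p , r , t) → p , to opposite-<⇔ t , to opposite-<⇔ r)

open Symmetries

-- Sums over scan states as sums over paths.

module Avoiding321 {c ℓ} (R : CommutativeRing c ℓ) (q : CommutativeRing.Carrier R) where
  open CommutativeRing R hiding (zero)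
  open Polynomials R
  open Sums R
  open Paths R
  open Expansion R
  open import Algebra.Properties.Semiring.Exp semiring using (^-cong; ^-homo-*)
  open import Algebra.Properties.CommutativeSemigroup *-commutativeSemigroup using (x∙yz≈y∙xz)
  open import Algebra.Solver.CommutativeMonoid *-commutativeMonoid using (solve; _⊕_; _⊜_)
  open import Relation.Binary.Reasoning.Setoid setoid

  opaque
    unfolding excedances
    -- The positions below `c` hold points that are read but not yet deleted. They are known to be
    -- (weak) excedances and are counted in advance by the summand `c`.
    weight : ℕ → ℕ → Weight → Permutation′ m → Carrier
    weight ε c φ τ = φ (c ℕ.+ excedances ε c τ) * q ^ inv τ

    weight-cong : ∀ ε c φ (σ τ : Permutation′ m) → σ ≈ₚ τ → weight ε c φ σ ≈ weight ε c φ τ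
    weight-cong ε c φ σ τ eq = *-cong
      (reflexive (≡.cong (λ e → φ (c ℕ.+ e)) (excedances-cong ε c σ τ eq))) (^-cong refl (inv-cong σ τ eq))

    weight-* : ∀ y ε c φ (τ : Permutation′ m) → weight ε c (λ e → y * φ e) τ ≈ y * weight ε c φ τ
    weight-* y ε c φ τ = *-assoc _ _ _

    weight-insert : ∀ ε c d φ ψ (τ : Permutation′ (suc m)) (ρ : Permutation′ m) a →
      φ (c ℕ.+ excedances ε c τ) ≡ ψ (d ℕ.+ excedances ε d ρ) → inv τ ≡ a ℕ.+ inv ρ →
      weight ε c φ τ ≈ q ^ a * weight ε d ψ ρ
    weight-insert ε c d φ ψ τ ρ a eq inv≡ = trans
      (*-cong (reflexive eq) (trans (^-cong refl inv≡) (^-homo-* q a (inv ρ)))) (x∙yz≈y∙xz _ _ _)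

    weight-def : ∀ ε c φ (τ : Permutation′ m) → weight ε c φ τ ≈ φ (c ℕ.+ excedances ε c τ) * q ^ inv τ
    weight-def ε c φ τ = refl

    weight-id : ∀ ε φ → weight ε 0 φ (Perm.id {0}) ≈ φ 0
    weight-id ε φ = *-identityʳ _

    -- Position `a` merely changes from being counted to being counted in advance.
    weight-suc : ∀ ε φ (a : Fin (suc m)) (τ : Permutation′ (suc m)) → ε ℕ.+ toℕ a ℕ.≤ toℕ (τ ⟨$⟩ʳ a) →
                 weight ε (toℕ a) φ τ ≈ weight ε (suc (toℕ a)) φ τ
    weight-suc ε φ a τ le = *-congʳ (reflexive (≡.cong φ (≡.trans
      (≡.cong (toℕ a ℕ.+_) (≡.trans (excedances-suc ε a τ) (≡.cong (ℕ._+ excedances ε (suc (toℕ a)) τ)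
        (ind-true (ε ℕ.+ toℕ a ℕ.≤? toℕ (τ ⟨$⟩ʳ a)) le))))
      (ℕ.+-suc (toℕ a) _))))

  opaque
    states : (ε m a b c : ℕ) → Weight → Carrier
    states ε m a b c φ = ∑[ τ ∈ perms m ] ⟦ state? ε a b c τ ⟧ weight ε c φ τ

    states-def : ∀ ε m a b c φ → states ε m a b c φ ≈ ∑[ τ ∈ perms m ] ⟦ state? ε a b c τ ⟧ weight ε c φ τ
    states-def ε m a b c φ = refl

  states-cong : ∀ ε m a b c a′ b′ c′ φ →
    (∀ (τ : Permutation′ m) → State ε a b c τ ⇔ State ε a′ b′ c′ τ) →
    (∀ (τ : Permutation′ m) → State ε a b c τ → weight ε c φ τ ≈ weight ε c′ φ τ) →
    states ε m a b c φ ≈ states ε m a′ b′ c′ φ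
  states-cong ε m a b c a′ b′ c′ φ e w = begin
    states ε m a b c φ                                          ≈⟨ states-def ε m a b c φ ⟩
    ∑[ τ ∈ perms m ] ⟦ state? ε a b c τ ⟧ weight ε c φ τ        ≈⟨ ∑-cong (perms m) (λ τ →
      ⟦⟧-cong (state? ε a b c τ) (state? ε a′ b′ c′ τ) (to (e τ)) (from (e τ)) (w τ)) ⟩
    ∑[ τ ∈ perms m ] ⟦ state? ε a′ b′ c′ τ ⟧ weight ε c′ φ τ    ≈⟨ states-def ε m a′ b′ c′ φ ⟨
    states ε m a′ b′ c′ φ                                       ∎

  states-* : ∀ y ε m a b c φ → states ε m a b c (λ e → y * φ e) ≈ y * states ε m a b c φ
  states-* y ε m a b c φ = begin
    states ε m a b c (λ e → y * φ e)
      ≈⟨ states-def ε m a b c (λ e → y * φ e) ⟩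
    ∑[ τ ∈ perms m ] ⟦ state? ε a b c τ ⟧ weight ε c (λ e → y * φ e) τ
      ≈⟨ ∑-cong (perms m) (λ τ → ⟦⟧-congˡ (state? ε a b c τ) λ _ → weight-* y ε c φ τ) ⟩
    ∑[ τ ∈ perms m ] ⟦ state? ε a b c τ ⟧ (y * weight ε c φ τ)
      ≈⟨ *-∑-⟦⟧ y (state? ε a b c) (perms m) _ ⟨
    y * (∑[ τ ∈ perms m ] ⟦ state? ε a b c τ ⟧ weight ε c φ τ)
      ≈⟨ *-congˡ (states-def ε m a b c φ) ⟨
    y * states ε m a b c φ ∎

  -- Half step that reads the value `h`. By `raise` its position is either unread or equal to 0. In
  -- the second case the point is deleted and no longer counted in advance by `c`; `φ ∘ suc` makes
  -- up for it.
  states-close : ∀ ε {h} (a : Fin (suc m)) → toℕ a ≡ h → ∀ φ →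
    states ε (suc m) (suc h) h (suc h) φ ≈ states ε (suc m) (suc h) (suc h) (suc h) φ + q ^ h * states ε m h h h (φ ∘ suc)
  states-close {m} ε {h} a ≡.refl φ = begin
    states ε (suc m) (suc h) h (suc h) φ
      ≈⟨ states-def ε (suc m) (suc h) h (suc h) φ ⟩
    ∑[ τ ∈ perms (suc m) ] ⟦ open? τ ⟧ w τ
      ≈⟨ ∑-⟦⟧-⊎ open? (state? ε (suc h) (suc h) (suc h)) (λ τ → (τ ⟨$⟩ʳ zero) Fin.≟ a ×-dec open? τ) (perms (suc m))
           split lower (λ _ → proj₂) disjoint w ⟩
    ∑[ τ ∈ perms (suc m) ] ⟦ state? ε (suc h) (suc h) (suc h) τ ⟧ w τ + ∑[ τ ∈ perms (suc m) ] ⟦ (τ ⟨$⟩ʳ zero) Fin.≟ a ×-dec open? τ ⟧ w τ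
      ≈⟨ +-cong (sym (states-def ε (suc m) (suc h) (suc h) (suc h) φ)) (trans (∑-cong (perms (suc m)) λ τ → sym (⟦⟧-× ((τ ⟨$⟩ʳ zero) Fin.≟ a) (open? τ)))
           (∑-perms-insertˡ m a λ τ → ⟦ open? τ ⟧ w τ)) ⟩
    states ε (suc m) (suc h) (suc h) (suc h) φ + ∑[ ρ ∈ perms m ] ⟦ open? (insert zero a ρ) ⟧ w (insert zero a ρ)
      ≈⟨ +-congˡ (∑-cong (perms m) λ ρ → ⟦⟧-cong (open? (insert zero a ρ)) (state? ε h h h ρ)
           (to (insertˡ-state⇔ a ρ ε)) (from (insertˡ-state⇔ a ρ ε)) λ _ →
           weight-insert ε (suc h) h φ (φ ∘ suc) (insert zero a ρ) ρ h (≡.cong (λ e → φ (suc h ℕ.+ e)) (insertˡ-excedances a ρ ε)) (inv-insertˡ a ρ)) ⟩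
    states ε (suc m) (suc h) (suc h) (suc h) φ + ∑[ ρ ∈ perms m ] ⟦ state? ε h h h ρ ⟧ (q ^ h * weight ε h (φ ∘ suc) ρ)
      ≈⟨ +-congˡ (trans (*-congˡ (states-def ε m h h h (φ ∘ suc))) (*-∑-⟦⟧ (q ^ h) (state? ε h h h) (perms m) _)) ⟨
    states ε (suc m) (suc h) (suc h) (suc h) φ + q ^ h * states ε m h h h (φ ∘ suc) ∎
    where
    open? : ∀ τ → Dec (State ε (suc h) h (suc h) τ)
    open? = state? ε (suc h) h (suc h)
    w : Permutation′ (suc m) → Carrier
    w = weight ε (suc h) φ
    lower : ∀ τ → State ε (suc h) (suc h) (suc h) τ → State ε (suc h) h (suc h) τ
    lower τ (av , ab , nc) = av , (λ i lt → ℕ.<⇒≤ (ab i lt)) , nc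
    disjoint : ∀ τ → ¬ (State ε (suc h) (suc h) (suc h) τ × (τ ⟨$⟩ʳ zero ≡ a × State ε (suc h) h (suc h) τ))
    disjoint τ ((_ , ab , _) , eq , _) = ℕ.<⇒≱ (ab zero (s≤s z≤n)) (ℕ.≤-reflexive (≡.cong toℕ eq))
    split : ∀ τ → State ε (suc h) h (suc h) τ →
            State ε (suc h) (suc h) (suc h) τ ⊎ (τ ⟨$⟩ʳ zero ≡ a × State ε (suc h) h (suc h) τ)
    split τ st@(av , ab , nc) with (τ ⟨$⟩ʳ zero) Fin.≟ a
    ... | yes eq = inj₂ (eq , st)
    ... | no ne  = inj₁ (av , raise a τ av ab ne , nc)

  -- Half step that reads the position `suc h`. Its value is either unread or, by `smallValue`,
  -- equal to 0. In the second case the deleted point lies below the diagonal and is no excedance,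
  -- so `φ` stays.
  states-drop : ∀ ε {h} (a : Fin (suc m)) → toℕ a ≡ suc h → ∀ φ →
    states ε (suc m) (suc h) (suc h) (suc h) φ ≈
    states ε (suc m) (suc (suc h)) (suc h) (suc h) φ + q ^ suc h * states ε m (suc h) h (suc h) φ
  states-drop {m} ε {h} a a≡ φ = begin
    states ε (suc m) (suc h) (suc h) (suc h) φ
      ≈⟨ states-def ε (suc m) (suc h) (suc h) (suc h) φ ⟩
    ∑[ τ ∈ perms (suc m) ] ⟦ closed? τ ⟧ w τ
      ≈⟨ ∑-⟦⟧-⊎ closed? (state? ε (suc (suc h)) (suc h) (suc h)) (λ τ → (τ ⟨$⟩ˡ zero) Fin.≟ a ×-dec closed? τ) (perms (suc m))
           split lower (λ _ → proj₂) disjoint w ⟩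
    ∑[ τ ∈ perms (suc m) ] ⟦ state? ε (suc (suc h)) (suc h) (suc h) τ ⟧ w τ + ∑[ τ ∈ perms (suc m) ] ⟦ (τ ⟨$⟩ˡ zero) Fin.≟ a ×-dec closed? τ ⟧ w τ
      ≈⟨ +-cong (sym (states-def ε (suc m) (suc (suc h)) (suc h) (suc h) φ)) (trans (∑-cong (perms (suc m)) λ τ → sym (⟦⟧-× ((τ ⟨$⟩ˡ zero) Fin.≟ a) (closed? τ)))
           (∑-perms-insertʳ m a (λ τ → ⟦ closed? τ ⟧ w τ) λ σ τ eq → ⟦⟧-cong (closed? σ) (closed? τ)
             (state-cong ε (suc h) (suc h) (suc h) σ τ eq) (state-cong ε (suc h) (suc h) (suc h) τ σ (≡.sym ∘ eq))
             λ _ → weight-cong ε (suc h) φ σ τ eq)) ⟩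
    states ε (suc m) (suc (suc h)) (suc h) (suc h) φ + ∑[ ρ ∈ perms m ] ⟦ closed? (insert a zero ρ) ⟧ w (insert a zero ρ)
      ≈⟨ +-congˡ (∑-cong (perms m) λ ρ → ⟦⟧-cong (closed? (insert a zero ρ)) (state? ε (suc h) h (suc h) ρ)
           (to (insertʳ-state⇔ a a≡ ρ ε)) (from (insertʳ-state⇔ a a≡ ρ ε)) λ _ →
           weight-insert ε (suc h) (suc h) φ φ (insert a zero ρ) ρ (suc h) (≡.cong (λ e → φ (suc h ℕ.+ e)) (insertʳ-excedances a a≡ ρ ε))
             (≡.trans (inv-insertʳ a ρ) (≡.cong (ℕ._+ inv ρ) a≡))) ⟩
    states ε (suc m) (suc (suc h)) (suc h) (suc h) φ + ∑[ ρ ∈ perms m ] ⟦ state? ε (suc h) h (suc h) ρ ⟧ (q ^ suc h * weight ε (suc h) φ ρ)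
      ≈⟨ +-congˡ (trans (*-congˡ (states-def ε m (suc h) h (suc h) φ)) (*-∑-⟦⟧ (q ^ suc h) (state? ε (suc h) h (suc h)) (perms m) _)) ⟨
    states ε (suc m) (suc (suc h)) (suc h) (suc h) φ + q ^ suc h * states ε m (suc h) h (suc h) φ ∎
    where
    closed? : ∀ τ → Dec (State ε (suc h) (suc h) (suc h) τ)
    closed? = state? ε (suc h) (suc h) (suc h)
    w : Permutation′ (suc m) → Carrier
    w = weight ε (suc h) φ
    lower : ∀ τ → State ε (suc (suc h)) (suc h) (suc h) τ → State ε (suc h) (suc h) (suc h) τ
    lower τ (av , ab , nc) = av , (λ i lt → ab i (ℕ.m≤n⇒m≤1+n lt)) , nc
    split : ∀ τ → State ε (suc h) (suc h) (suc h) τ →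
            State ε (suc (suc h)) (suc h) (suc h) τ ⊎ (τ ⟨$⟩ˡ zero ≡ a × State ε (suc h) (suc h) (suc h) τ)
    split τ st@(av , ab , nc) with suc h ℕ.≤? toℕ (τ ⟨$⟩ʳ a)
    ... | no lt  = inj₂ (smallValue a a≡ τ av ab (ℕ.≰⇒> lt) , st)
    ... | yes le = inj₁ (av , above , nc)
      where
      above : Above (suc (suc h)) (suc h) τ
      above i lt with toℕ i ℕ.≟ suc h
      ... | yes eq = ≡.subst (λ i → suc h ℕ.≤ toℕ (τ ⟨$⟩ʳ i)) (Fin.toℕ-injective (≡.trans a≡ (≡.sym eq))) le
      ... | no ne  = ab i (ℕ.≤∧≢⇒< (ℕ.s≤s⁻¹ lt) ne)
    disjoint : ∀ τ → ¬ (State ε (suc (suc h)) (suc h) (suc h) τ × (τ ⟨$⟩ˡ zero ≡ a × State ε (suc h) (suc h) (suc h) τ))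
    disjoint τ ((_ , ab , _) , eq , _) = contradiction
      (≡.subst (λ v → suc h ℕ.≤ toℕ v) (≡.trans (≡.cong (τ ⟨$⟩ʳ_) (≡.sym eq)) (inverseʳ τ)) (ab a (s≤s (ℕ.≤-reflexive a≡)))) λ ()

  states-start : ∀ ε m φ → states ε (suc m) 0 0 0 φ ≈ states ε (suc m) 1 0 0 φ
  states-start ε m φ = states-cong ε (suc m) 0 0 0 1 0 0 φ
    (λ τ → mk⇔ (λ (av , _ , nc) → av , (λ _ _ → z≤n) , nc) (λ (av , _ , nc) → av , (λ _ _ → z≤n) , nc)) λ _ _ → refl

  -- The position `h` just read holds a value of at least `h`, which is all that a weak excedance
  -- needs.
  states-weak : ∀ {h} (a : Fin (suc m)) → toℕ a ≡ h → ∀ φ →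
    states 0 (suc m) (suc h) h h φ ≈ states 0 (suc m) (suc h) h (suc h) φ
  states-weak {m} a ≡.refl φ = states-cong 0 (suc m) (suc h) h h (suc h) h (suc h) φ
    (weak-state⇔ (suc h) h h (suc h)) λ τ (_ , ab , _) → weight-suc 0 φ a τ (ab a ℕ.≤-refl)
    where
    h : ℕ
    h = toℕ a

  -- If the position just read has an unread value, then the value of the same index cannot belong
  -- to a read position: it would be a cyclic double ascent. So reading that value deletes nothing.
  states-strict : ∀ {h} (a : Fin (suc m)) → toℕ a ≡ suc h → ∀ φ →
    states 1 (suc m) (suc (suc h)) (suc h) (suc h) φ ≈ states 1 (suc m) (suc (suc h)) (suc (suc h)) (suc (suc h)) φ
  states-strict {m} (suc a) ≡.refl φ = states-cong 1 (suc m) (suc h) h h (suc h) (suc h) (suc h) φ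
    equiv λ τ st → weight-suc 1 φ (suc a) τ (proj₁ (proj₂ (to (equiv τ) st)) (suc a) ℕ.≤-refl)
    where
    h : ℕ
    h = toℕ (suc a)
    equiv : ∀ τ → State 1 (suc h) h h τ ⇔ State 1 (suc h) (suc h) (suc h) τ
    equiv τ = strict-state⇔ (suc a) τ λ ()

  -- At height 0 the value read next may also belong to the position just read, as a fixed point;
  -- this gives the level step of weight `q ^ 0`.
  states-strict-0 : ∀ m φ → states 1 (suc m) 1 0 0 φ ≈ states 1 (suc m) 1 1 1 φ + states 1 m 0 0 0 φ
  states-strict-0 m φ = begin
    states 1 (suc m) 1 0 0 φ
      ≈⟨ states-def 1 (suc m) 1 0 0 φ ⟩
    ∑[ τ ∈ perms (suc m) ] ⟦ open? τ ⟧ w τ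
      ≈⟨ ∑-⟦⟧-⊎ open? (λ τ → ¬? (fixed? τ) ×-dec open? τ) (λ τ → fixed? τ ×-dec open? τ) (perms (suc m))
           split (λ _ → proj₂) (λ _ → proj₂) disjoint w ⟩
    ∑[ τ ∈ perms (suc m) ] ⟦ ¬? (fixed? τ) ×-dec open? τ ⟧ w τ + ∑[ τ ∈ perms (suc m) ] ⟦ fixed? τ ×-dec open? τ ⟧ w τ
      ≈⟨ +-cong
           (trans (∑-cong (perms (suc m)) λ τ → ⟦⟧-cong (¬? (fixed? τ) ×-dec open? τ) (state? 1 1 1 1 τ)
             (λ (ne , st) → to (equiv τ ne) st) (λ st → unfixed τ st , from (equiv τ (unfixed τ st)) st)
             λ (ne , st) → weight-suc 1 φ zero τ (proj₁ (proj₂ (to (equiv τ ne) st)) zero (s≤s z≤n)))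
             (sym (states-def 1 (suc m) 1 1 1 φ)))
           (trans (∑-cong (perms (suc m)) λ τ → sym (⟦⟧-× (fixed? τ) (open? τ)))
             (∑-perms-insertˡ m zero λ τ → ⟦ open? τ ⟧ w τ)) ⟩
    states 1 (suc m) 1 1 1 φ + ∑[ ρ ∈ perms m ] ⟦ open? (insert zero zero ρ) ⟧ w (insert zero zero ρ)
      ≈⟨ +-congˡ (trans (∑-cong (perms m) λ ρ → ⟦⟧-cong (open? (insert zero zero ρ)) (state? 1 0 0 0 ρ)
           (to (insertˡ-state⇔ zero ρ 1) ∘ to (insertˡ-fixed-state⇔ zero ρ ≡.refl 1))
           (from (insertˡ-fixed-state⇔ zero ρ ≡.refl 1) ∘ from (insertˡ-state⇔ zero ρ 1))
           λ _ → trans (weight-insert 1 0 0 φ φ (insert zero zero ρ) ρ 0 (≡.cong φ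
             (≡.trans (excedances-fixed (insert zero zero ρ) ≡.refl) (insertˡ-excedances zero ρ 1))) (inv-insertˡ zero ρ))
             (*-identityˡ _)) (sym (states-def 1 m 0 0 0 φ))) ⟩
    states 1 (suc m) 1 1 1 φ + states 1 m 0 0 0 φ ∎
    where
    open? : ∀ τ → Dec (State 1 1 0 0 τ)
    open? = state? 1 1 0 0
    w : Permutation′ (suc m) → Carrier
    w = weight 1 0 φ
    disjoint : ∀ τ → ¬ ((¬ τ ⟨$⟩ʳ zero ≡ zero × State 1 1 0 0 τ) × (τ ⟨$⟩ʳ zero ≡ zero × State 1 1 0 0 τ))
    disjoint τ ((ne , _) , eq , _) = ne eq
    fixed? : (τ : Permutation′ (suc m)) → Dec (τ ⟨$⟩ʳ zero ≡ zero)
    fixed? τ = (τ ⟨$⟩ʳ zero) Fin.≟ zero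
    split : ∀ τ → State 1 1 0 0 τ → (¬ τ ⟨$⟩ʳ zero ≡ zero × State 1 1 0 0 τ) ⊎ (τ ⟨$⟩ʳ zero ≡ zero × State 1 1 0 0 τ)
    split τ st with fixed? τ
    ... | yes eq = inj₂ (eq , st)
    ... | no ne  = inj₁ (ne , st)
    equiv : ∀ τ → ¬ τ ⟨$⟩ʳ zero ≡ zero → State 1 1 0 0 τ ⇔ State 1 1 1 1 τ
    equiv τ ne = strict-state⇔ zero τ (ne ∘ proj₂)
    unfixed : ∀ τ → State 1 1 1 1 τ → ¬ τ ⟨$⟩ʳ zero ≡ zero
    unfixed τ (_ , ab , _) eq = contradiction (≡.subst (λ v → 1 ℕ.≤ toℕ v) eq (ab zero (s≤s z≤n))) λ ()

  -- With all positions read, no position is left for the value 0.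
  states-empty : ∀ ε h φ → states ε (suc h) (suc h) (suc h) (suc h) φ ≈ 0#
  states-empty ε h φ = trans (states-def ε (suc h) (suc h) (suc h) (suc h) φ) (∑-zero (perms (suc h)) λ τ → ⟦⟧-false (state? ε (suc h) (suc h) (suc h) τ) λ (_ , ab , _) →
    contradiction (≡.subst (λ v → suc h ℕ.≤ toℕ v) (inverseʳ τ) (ab (τ ⟨$⟩ˡ zero) (Fin.toℕ<n _))) λ ())

  states-nil : ∀ ε φ → states ε 0 0 0 0 φ ≈ φ 0
  states-nil ε φ = trans (states-def ε 0 0 0 0 φ) (trans (+-identityʳ _) (trans (⟦⟧-true (state? ε 0 0 0 (Perm.id {0}))
    ((λ ()) , (λ ()) , (λ ()))) (weight-id ε φ)))

  -- Of the `m` remaining positions `h` have been read; each of the other `r` gives one step of the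
  -- path.
  strict≈motzkin : ∀ r h {m} → m ≡ r ℕ.+ h → ∀ φ → states 1 m h h h φ ≈ motzkin q h r φ
  strict≈motzkin zero    zero    ≡.refl φ = states-nil 1 φ
  strict≈motzkin zero    (suc h) ≡.refl φ = states-empty 1 h φ
  strict≈motzkin (suc r) zero    ≡.refl φ = begin
    states 1 (suc (r ℕ.+ 0)) 0 0 0 φ ≈⟨ states-start 1 (r ℕ.+ 0) φ ⟩
    states 1 (suc (r ℕ.+ 0)) 1 0 0 φ ≈⟨ states-strict-0 (r ℕ.+ 0) φ ⟩
    states 1 (suc (r ℕ.+ 0)) 1 1 1 φ + states 1 (r ℕ.+ 0) 0 0 0 φ
      ≈⟨ +-cong (strict≈motzkin r 1 (≡.sym (ℕ.+-suc r 0)) φ) (strict≈motzkin r 0 ≡.refl φ) ⟩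
    motzkin q 1 r φ + motzkin q 0 r φ ∎
  strict≈motzkin (suc r) (suc h) ≡.refl φ = begin
    states 1 (suc l) (suc h) (suc h) (suc h) φ
      ≈⟨ states-drop 1 a a≡ φ ⟩
    states 1 (suc l) (suc (suc h)) (suc h) (suc h) φ + q ^ suc h * states 1 l (suc h) h (suc h) φ
      -- Without a deletion at the position, the step goes up. After a deletion, the value decides
      -- between a level step and a down step.
      ≈⟨ +-cong (states-strict a a≡ φ) (*-congˡ (reflexive (≡.cong (λ l → states 1 l (suc h) h (suc h) φ) (ℕ.+-suc r h)))) ⟩
    states 1 (suc l) (suc (suc h)) (suc (suc h)) (suc (suc h)) φ + q ^ suc h * states 1 (suc (r ℕ.+ h)) (suc h) h (suc h) φ
      ≈⟨ +-cong (strict≈motzkin r (suc (suc h)) (≡.sym (ℕ.+-suc r (suc h))) φ)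
           (*-congˡ (trans (states-close 1 b b≡ φ) (+-cong (strict≈motzkin r (suc h) (≡.sym (ℕ.+-suc r h)) φ)
             (*-congˡ (strict≈motzkin r h ≡.refl (φ ∘ suc)))))) ⟩
    motzkin q (suc h) (suc r) φ ∎
    where
    l : ℕ
    l = r ℕ.+ suc h
    a : Fin (suc l)
    a = fromℕ< (s≤s (ℕ.m≤n+m (suc h) r))
    a≡ : toℕ a ≡ suc h
    a≡ = Fin.toℕ-fromℕ< (s≤s (ℕ.m≤n+m (suc h) r))
    b : Fin (suc (r ℕ.+ h))
    b = fromℕ< (s≤s (ℕ.m≤n+m h r))
    b≡ : toℕ b ≡ h
    b≡ = Fin.toℕ-fromℕ< _

  module _ (t : Carrier) where

    weak-close : ∀ r h → states 0 (suc (r ℕ.+ h)) (suc h) h (suc h) (t ^_) ≈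
      states 0 (suc (r ℕ.+ h)) (suc h) (suc h) (suc h) (t ^_) + q ^ h * (t * states 0 (r ℕ.+ h) h h h (t ^_))
    weak-close r h = trans (states-close 0 (fromℕ< {h} (s≤s (ℕ.m≤n+m h r))) (Fin.toℕ-fromℕ< _) (t ^_))
      (+-congˡ (*-congˡ (states-* t 0 (r ℕ.+ h) h h h (t ^_))))

    -- Height `h` now means `suc h` positions and `h` values read. The recursion pays `t` whenever
    -- reading a value deletes a point; the factor `t` in front is the last of these deletions,
    -- which ends the scan after the `r` steps.
    weak≈bicoloured : ∀ r h → states 0 (suc (r ℕ.+ h)) (suc h) h (suc h) (t ^_) ≈ t * bicoloured q t h r
    weak-start : ∀ r → states 0 (suc r ℕ.+ 0) 0 0 0 (t ^_) ≈ t * bicoloured q t 0 r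
    weak-drop : ∀ r h → states 0 (suc r ℕ.+ suc h) (suc h) (suc h) (suc h) (t ^_) ≈
                t * bicoloured q t (suc h) r + q ^ suc h * (t * bicoloured q t h r)

    weak-start r = begin
      states 0 (suc r ℕ.+ 0) 0 0 0 (t ^_) ≈⟨ states-start 0 (r ℕ.+ 0) (t ^_) ⟩
      states 0 (suc r ℕ.+ 0) 1 0 0 (t ^_) ≈⟨ states-weak zero ≡.refl (t ^_) ⟩
      states 0 (suc r ℕ.+ 0) 1 0 1 (t ^_) ≈⟨ weak≈bicoloured r 0 ⟩
      t * bicoloured q t 0 r ∎

    weak-drop r h = begin
      states 0 (suc l) (suc h) (suc h) (suc h) (t ^_)
        ≈⟨ states-drop 0 a a≡ (t ^_) ⟩
      states 0 (suc l) (suc (suc h)) (suc h) (suc h) (t ^_) + q ^ suc h * states 0 l (suc h) h (suc h) (t ^_)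
        ≈⟨ +-cong (states-weak a a≡ (t ^_)) (*-congˡ (reflexive (≡.cong (λ l → states 0 l (suc h) h (suc h) (t ^_)) (ℕ.+-suc r h)))) ⟩
      states 0 (suc l) (suc (suc h)) (suc h) (suc (suc h)) (t ^_) + q ^ suc h * states 0 (suc (r ℕ.+ h)) (suc h) h (suc h) (t ^_)
        ≈⟨ +-cong (weak≈bicoloured r (suc h)) (*-congˡ (weak≈bicoloured r h)) ⟩
      t * bicoloured q t (suc h) r + q ^ suc h * (t * bicoloured q t h r) ∎
      where
      l : ℕ
      l = r ℕ.+ suc h
      a : Fin (suc l)
      a = fromℕ< (s≤s (ℕ.m≤n+m (suc h) r))
      a≡ : toℕ a ≡ suc h
      a≡ = Fin.toℕ-fromℕ< (s≤s (ℕ.m≤n+m (suc h) r))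

    weak≈bicoloured zero zero = trans (weak-close 0 0)
      (trans (+-cong (states-empty 0 0 (t ^_)) (trans (*-identityˡ _) (*-congˡ (states-nil 0 (t ^_))))) (+-identityˡ _))
    weak≈bicoloured zero (suc h) = trans (weak-close 0 (suc h))
      (trans (+-cong (states-empty 0 (suc h) (t ^_)) (trans (*-congˡ (trans (*-congˡ (states-empty 0 h (t ^_))) (zeroʳ t))) (zeroʳ _)))
        (trans (+-identityˡ 0#) (sym (zeroʳ t))))
    weak≈bicoloured (suc r) zero = begin
      states 0 (suc (suc r ℕ.+ 0)) 1 0 1 (t ^_)
        ≈⟨ weak-close (suc r) 0 ⟩
      states 0 (suc (suc r ℕ.+ 0)) 1 1 1 (t ^_) + 1# * (t * states 0 (suc r ℕ.+ 0) 0 0 0 (t ^_))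
        ≈⟨ +-cong (trans (reflexive (≡.cong (λ m → states 0 (suc m) 1 1 1 (t ^_)) (≡.sym (ℕ.+-suc r 0)))) (weak-drop r 0))
             (trans (*-identityˡ _) (*-congˡ (weak-start r))) ⟩
      t * H 1 + q ^ 1 * (t * H 0) + t * (t * H 0)
        ≈⟨ trans (+-assoc _ _ _) (+-congˡ (trans (+-comm _ _) (+-congˡ (trans (*-congʳ (*-identityʳ q)) (x∙yz≈y∙xz _ _ _))))) ⟩
      t * H 1 + (t * (t * H 0) + t * (q * H 0))
        ≈⟨ trans (distribˡ t _ _) (+-congˡ (trans (*-congˡ (distribʳ _ _ _)) (distribˡ t _ _))) ⟨
      t * bicoloured q t 0 (suc r) ∎
      where
      H : ℕ → Carrier
      H h = bicoloured q t h r
    weak≈bicoloured (suc r) (suc h) = begin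
      states 0 (suc (suc r ℕ.+ suc h)) (suc (suc h)) (suc h) (suc (suc h)) (t ^_)
        ≈⟨ weak-close (suc r) (suc h) ⟩
      states 0 (suc (suc r ℕ.+ suc h)) (suc (suc h)) (suc (suc h)) (suc (suc h)) (t ^_) +
        x * (t * states 0 (suc r ℕ.+ suc h) (suc h) (suc h) (suc h) (t ^_))
        ≈⟨ +-cong (trans (reflexive (≡.cong (λ m → states 0 (suc m) (suc (suc h)) (suc (suc h)) (suc (suc h)) (t ^_)) (≡.sym (ℕ.+-suc r (suc h)))))
             (weak-drop r (suc h))) (*-congˡ (*-congˡ (weak-drop r h))) ⟩
      t * U + q * x * (t * L) + x * (t * (t * L + x * (t * D)))
        -- The two terms in `L` are the two kinds of level steps: `q * x` when only the position
        -- deletes a point, `t` when only the value does.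
        ≈⟨ +-cong (+-congˡ (solve 4 (λ q x t L → (q ⊕ x) ⊕ (t ⊕ L) ⊜ t ⊕ (x ⊕ (q ⊕ L))) refl q x t L))
             (trans (x∙yz≈y∙xz _ _ _) (*-congˡ (*-congˡ (+-congˡ (solve 3 (λ x t D → x ⊕ (t ⊕ D) ⊜ (t ⊕ x) ⊕ D) refl x t D))))) ⟩
      t * U + t * (x * (q * L)) + t * (x * (t * L + t * x * D))
        ≈⟨ trans (+-assoc _ _ _) (+-congˡ (trans (sym (distribˡ t _ _)) (*-congˡ (sym (distribˡ x _ _))))) ⟩
      t * U + t * (x * (q * L + (t * L + t * x * D)))
        ≈⟨ +-congˡ (*-congˡ (*-congˡ (trans (sym (+-assoc _ _ _)) (+-congʳ (trans (+-comm _ _) (sym (distribʳ _ _ _))))))) ⟩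
      t * U + t * (x * ((t + q) * L + t * x * D))
        ≈⟨ distribˡ t _ _ ⟨
      t * bicoloured q t (suc h) (suc r) ∎
      where
      x U L D : Carrier
      x = q ^ suc h
      U = bicoloured q t (suc (suc h)) r
      L = bicoloured q t (suc h) r
      D = bicoloured q t h r

-- Sums over words avoiding 231 and their recursion.

avoids231? : (σ : Permutation′ m) → Dec (Avoids231 σ)
avoids231? σ = Dec.map (avoids231⇔ σ) (avoids? p231 σ)

noDoubleDescent? : (σ : Permutation′ m) → Dec (NoDoubleDescent σ)
noDoubleDescent? σ = Dec.map (ldd≡0⇔ σ) (ldd σ ℕ.≟ 0)

cut? : ∀ c (σ : Permutation′ m) → Dec (Cut c σ)
cut? c σ = Fin.all? λ x → Fin.all? λ y → x Fin.<? y →-dec (toℕ (σ ⟨$⟩ʳ y) ℕ.<? c →-dec toℕ (σ ⟨$⟩ʳ x) ℕ.<? c)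

cuts? : ∀ o ss (σ : Permutation′ m) → Dec (Cuts o ss σ)
cuts? o []       σ = yes tt
cuts? o (s ∷ ss) σ = cut? (o ℕ.+ s) σ ×-dec cuts? (o ℕ.+ s) ss σ

opaque
  good? : ∀ ss (σ : Permutation′ m) → Dec (Good ss σ)
  good? ss σ = (avoids231? σ ×-dec noDoubleDescent? σ) ×-dec cuts? 0 ss σ

module Avoiding231 {c ℓ} (R : CommutativeRing c ℓ) (q : CommutativeRing.Carrier R) where
  open CommutativeRing R hiding (zero)
  open Polynomials R
  open Sums R
  open Paths R
  open import Algebra.Properties.Semiring.Exp semiring using (^-cong; ^-homo-*)
  open import Algebra.Properties.CommutativeSemigroup *-commutativeSemigroup using (x∙yz≈y∙xz)
  open import Relation.Binary.Reasoning.Setoid setoid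

  opaque
    -- The exponent of `q` is the counterpart of `inv`: the descents are added because deleting a
    -- first letter `suc i` together with the following 0 lowers it by `suc i`, as `motzkin≈`
    -- requires.
    weight231 : Weight → Permutation′ m → Carrier
    weight231 φ τ = φ (des τ) * q ^ (⟨31-2⟩ τ ℕ.+ des τ)

    weight231-def : ∀ φ (τ : Permutation′ m) → weight231 φ τ ≈ φ (des τ) * q ^ (⟨31-2⟩ τ ℕ.+ des τ)
    weight231-def φ τ = refl

    weight231-insert₀ : ∀ φ (ρ : Permutation′ m) → weight231 φ (insert zero zero ρ) ≈ weight231 φ ρ
    weight231-insert₀ φ ρ = reflexive (≡.cong₂ (λ d e → φ d * q ^ (e ℕ.+ d)) (des-insert₀ ρ) (31-2-insert₀ ρ))

    weight231-insert₂ : ∀ φ i (ρ : Permutation′ m) →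
      weight231 φ (insert zero (suc i) (insert zero zero ρ)) ≈ q ^ suc (toℕ i) * weight231 (φ ∘ suc) ρ
    weight231-insert₂ {m} φ i ρ = begin
      φ (des τ) * q ^ (⟨31-2⟩ τ ℕ.+ des τ)
        ≈⟨ reflexive (≡.cong₂ (λ d e → φ d * q ^ (e ℕ.+ d)) (des-insert₂ i ρ) (31-2-insert₂ i ρ)) ⟩
      φ (suc d) * q ^ ((toℕ i ℕ.+ ⟨31-2⟩ ρ) ℕ.+ suc d)
        ≈⟨ *-congˡ (^-cong refl (≡.trans (ℕ.+-suc (toℕ i ℕ.+ ⟨31-2⟩ ρ) d) (≡.cong suc (ℕ.+-assoc (toℕ i) (⟨31-2⟩ ρ) d)))) ⟩
      φ (suc d) * q ^ (suc (toℕ i) ℕ.+ (⟨31-2⟩ ρ ℕ.+ d))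
        ≈⟨ trans (*-congˡ (^-homo-* q (suc (toℕ i)) (⟨31-2⟩ ρ ℕ.+ d))) (x∙yz≈y∙xz _ _ _) ⟩
      q ^ suc (toℕ i) * (φ (suc d) * q ^ (⟨31-2⟩ ρ ℕ.+ d)) ∎
      where
      τ : Permutation′ (suc (suc m))
      τ = insert zero (suc i) (insert zero zero ρ)
      d : ℕ
      d = des ρ

    words : ℕ → List ℕ → Weight → Carrier
    words n ss φ = ∑[ τ ∈ perms n ] ⟦ good? ss τ ⟧ weight231 φ τ

    words-def : ∀ n ss φ → words n ss φ ≈ ∑[ τ ∈ perms n ] ⟦ good? ss τ ⟧ weight231 φ τ
    words-def n ss φ = refl

  words-[] : ∀ φ → words 0 [] φ ≈ φ 0
  words-[] φ = trans (words-def 0 [] φ) (trans (+-identityʳ _) (trans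
    (⟦⟧-true (good? [] (Perm.id {0})) (((λ ()) , (λ ())) , tt)) (trans (weight231-def φ (Perm.id {0})) (*-identityʳ _))))

  words-zero : ∀ n ss φ → words n (0 ∷ ss) φ ≈ words n ss φ
  words-zero n ss φ = begin
    words n (0 ∷ ss) φ                                         ≈⟨ words-def n (0 ∷ ss) φ ⟩
    ∑[ τ ∈ perms n ] ⟦ good? (0 ∷ ss) τ ⟧ weight231 φ τ        ≈⟨ ∑-cong (perms n) (λ τ → ⟦⟧-cong (good? (0 ∷ ss) τ) (good? ss τ)
      (λ (p , _ , cs) → p , cs) (λ (p , cs) → p , (λ _ _ _ ()) , cs) λ _ → refl) ⟩
    ∑[ τ ∈ perms n ] ⟦ good? ss τ ⟧ weight231 φ τ              ≈⟨ words-def n ss φ ⟨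
    words n ss φ                                               ∎

  ∑-allFin-conv : ∀ n s (F : ℕ → ℕ → Carrier) → s ℕ.≤ n →
    ∑[ i ∈ allFin n ] ⟦ toℕ i ℕ.<? s ⟧ F (toℕ i) (s ℕ.∸ suc (toℕ i)) ≈ conv s F
  ∑-allFin-conv n       zero    F le = ∑-zero (allFin n) λ i → ⟦⟧-false (toℕ i ℕ.<? 0) (λ ()) {F (toℕ i) 0}
  ∑-allFin-conv (suc n) (suc s) F le = begin
    ∑[ i ∈ allFin (suc n) ] ⟦ toℕ i ℕ.<? suc s ⟧ F (toℕ i) (s ℕ.∸ toℕ i)
      ≈⟨ ∑-allFin-suc n _ ⟩
    F 0 s + ∑[ i ∈ allFin n ] ⟦ suc (toℕ i) ℕ.<? suc s ⟧ F (suc (toℕ i)) (s ℕ.∸ suc (toℕ i))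
      ≈⟨ +-congˡ (trans (∑-cong (allFin n) λ i → ⟦⟧-cong (suc (toℕ i) ℕ.<? suc s) (toℕ i ℕ.<? s) ℕ.s<s⁻¹ s≤s λ _ → refl)
           (∑-allFin-conv n s (F ∘ suc) (ℕ.s≤s⁻¹ le))) ⟩
    F 0 s + conv s (F ∘ suc) ∎

  -- The cut at `suc s` bounds the first letter by `first-≤`, and `second-zero` determines the
  -- second letter; so two letters can be removed at once.
  words-first : ∀ m (i : Fin (suc m)) s ss φ →
    ∑[ ρ ∈ perms (suc m) ] ⟦ good? (suc s ∷ ss) (insert zero (suc i) ρ) ⟧ weight231 φ (insert zero (suc i) ρ) ≈
    ⟦ toℕ i ℕ.<? s ⟧ (q ^ suc (toℕ i) * words m (toℕ i ∷ s ℕ.∸ suc (toℕ i) ∷ ss) (φ ∘ suc))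
  words-first m i s ss φ with toℕ i ℕ.<? s
  ... | no i≮s = trans
    (∑-zero (perms (suc m)) λ ρ → ⟦⟧-false (good? (suc s ∷ ss) (insert zero (suc i) ρ))
      λ (_ , cut , _) → i≮s (first-≤ (suc i) ρ cut))
    (sym (⟦⟧-false (toℕ i ℕ.<? s) i≮s))
  ... | yes i<s = begin
    ∑[ ρ ∈ perms (suc m) ] ⟦ τ? ρ ⟧ w ρ
      ≈⟨ ∑-cong (perms (suc m)) (λ ρ → trans
           (⟦⟧-cong (τ? ρ) ((ρ ⟨$⟩ʳ zero) Fin.≟ zero ×-dec τ? ρ)
             (λ st@((av , nd) , _) → second-zero i ρ av nd , st) proj₂ λ _ → refl)
           (sym (⟦⟧-× ((ρ ⟨$⟩ʳ zero) Fin.≟ zero) (τ? ρ)))) ⟩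
    ∑[ ρ ∈ perms (suc m) ] ⟦ (ρ ⟨$⟩ʳ zero) Fin.≟ zero ⟧ ⟦ τ? ρ ⟧ w ρ
      ≈⟨ ∑-perms-insertˡ m zero (λ ρ → ⟦ τ? ρ ⟧ w ρ) ⟩
    ∑[ ρ ∈ perms m ] ⟦ τ? (insert zero zero ρ) ⟧ w (insert zero zero ρ)
      ≈⟨ ∑-cong (perms m) (λ ρ → ⟦⟧-cong (τ? (insert zero zero ρ)) (good? (toℕ i ∷ j ∷ ss) ρ)
           (to (good⇔ ρ)) (from (good⇔ ρ)) λ _ → weight231-insert₂ φ i ρ) ⟩
    ∑[ ρ ∈ perms m ] ⟦ good? (toℕ i ∷ j ∷ ss) ρ ⟧ (q ^ suc (toℕ i) * weight231 (φ ∘ suc) ρ)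
      ≈⟨ *-∑-⟦⟧ (q ^ suc (toℕ i)) (good? (toℕ i ∷ j ∷ ss)) (perms m) _ ⟨
    q ^ suc (toℕ i) * (∑[ ρ ∈ perms m ] ⟦ good? (toℕ i ∷ j ∷ ss) ρ ⟧ weight231 (φ ∘ suc) ρ)
      ≈⟨ *-congˡ (words-def m (toℕ i ∷ j ∷ ss) (φ ∘ suc)) ⟨
    q ^ suc (toℕ i) * words m (toℕ i ∷ j ∷ ss) (φ ∘ suc)
      ≈⟨ ⟦⟧-true (toℕ i ℕ.<? s) i<s ⟨
    ⟦ toℕ i ℕ.<? s ⟧ (q ^ suc (toℕ i) * words m (toℕ i ∷ j ∷ ss) (φ ∘ suc)) ∎
    where
    j : ℕ
    j = s ℕ.∸ suc (toℕ i)
    τ? : ∀ ρ → Dec (Good (suc s ∷ ss) (insert zero (suc i) ρ))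
    τ? ρ = good? (suc s ∷ ss) (insert zero (suc i) ρ)
    w : Permutation′ (suc m) → Carrier
    w ρ = weight231 φ (insert zero (suc i) ρ)
    good⇔ : ∀ ρ → Good (suc s ∷ ss) (insert zero (suc i) (insert zero zero ρ)) ⇔ Good (toℕ i ∷ j ∷ ss) ρ
    good⇔ ρ = ≡.subst (λ s → Good (suc s ∷ ss) (insert zero (suc i) (insert zero zero ρ)) ⇔ Good (toℕ i ∷ j ∷ ss) ρ)
      (ℕ.m+[n∸m]≡n i<s) (insert₂-good⇔ i ρ j ss)

  words-larger : ∀ n s ss φ → n ≡ s ℕ.+ sum ss →
    ∑[ i ∈ allFin n ] ∑[ ρ ∈ perms n ] ⟦ good? (suc s ∷ ss) (insert zero (suc i) ρ) ⟧ weight231 φ (insert zero (suc i) ρ) ≈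
    conv s (λ i j → q ^ suc i * words (sum (i ∷ j ∷ ss)) (i ∷ j ∷ ss) (φ ∘ suc))
  words-larger zero    zero    ss φ eq = refl
  words-larger (suc m) s       ss φ eq = begin
    ∑[ i ∈ allFin (suc m) ] ∑[ ρ ∈ perms (suc m) ] ⟦ good? (suc s ∷ ss) (insert zero (suc i) ρ) ⟧ weight231 φ (insert zero (suc i) ρ)
      ≈⟨ ∑-cong (allFin (suc m)) (λ i → trans (words-first m i s ss φ) (⟦⟧-congˡ (toℕ i ℕ.<? s) λ i<s → *-congˡ
           (reflexive (≡.cong (λ m → words m (toℕ i ∷ s ℕ.∸ suc (toℕ i) ∷ ss) (φ ∘ suc)) (size (toℕ i) i<s))))) ⟩
    ∑[ i ∈ allFin (suc m) ] ⟦ toℕ i ℕ.<? s ⟧ F (toℕ i) (s ℕ.∸ suc (toℕ i))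
      ≈⟨ ∑-allFin-conv (suc m) s F (ℕ.≤-trans (ℕ.m≤m+n s (sum ss)) (ℕ.≤-reflexive (≡.sym eq))) ⟩
    conv s F ∎
    where
    F : ℕ → ℕ → Carrier
    F i j = q ^ suc i * words (sum (i ∷ j ∷ ss)) (i ∷ j ∷ ss) (φ ∘ suc)
    size : ∀ i → i ℕ.< s → m ≡ i ℕ.+ (s ℕ.∸ suc i ℕ.+ sum ss)
    size i i<s = ℕ.suc-injective (≡.trans eq (≡.trans
      (≡.cong (ℕ._+ sum ss) (≡.sym (ℕ.m+[n∸m]≡n i<s))) (ℕ.+-assoc (suc i) (s ℕ.∸ suc i) (sum ss))))

  -- The first letter is 0, which plays the part of a level step, or larger, which plays the part of
  -- an up step with its matching down step.
  words-suc : ∀ s ss φ → words (sum (suc s ∷ ss)) (suc s ∷ ss) φ ≈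
    words (sum (s ∷ ss)) (s ∷ ss) φ + conv s (λ i j → q ^ suc i * words (sum (i ∷ j ∷ ss)) (i ∷ j ∷ ss) (φ ∘ suc))
  words-suc s ss φ = begin
    words (suc l) (suc s ∷ ss) φ
      ≈⟨ words-def (suc l) (suc s ∷ ss) φ ⟩
    ∑[ τ ∈ perms (suc l) ] ⟦ good? (suc s ∷ ss) τ ⟧ weight231 φ τ
      ≈⟨ ∑-perms-suc l (λ τ → ⟦ good? (suc s ∷ ss) τ ⟧ weight231 φ τ) ⟩
    ∑[ a ∈ allFin (suc l) ] ∑[ ρ ∈ perms l ] ⟦ good? (suc s ∷ ss) (insert zero a ρ) ⟧ weight231 φ (insert zero a ρ)
      ≈⟨ ∑-allFin-suc l (λ a → ∑[ ρ ∈ perms l ] ⟦ good? (suc s ∷ ss) (insert zero a ρ) ⟧ weight231 φ (insert zero a ρ)) ⟩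
    ∑[ ρ ∈ perms l ] ⟦ good? (suc s ∷ ss) (insert zero zero ρ) ⟧ weight231 φ (insert zero zero ρ) +
    ∑[ i ∈ allFin l ] ∑[ ρ ∈ perms l ] ⟦ good? (suc s ∷ ss) (insert zero (suc i) ρ) ⟧ weight231 φ (insert zero (suc i) ρ)
      ≈⟨ +-cong
           (trans (∑-cong (perms l) λ ρ → ⟦⟧-cong (good? (suc s ∷ ss) (insert zero zero ρ)) (good? (s ∷ ss) ρ)
             (to (insert₀-good⇔ ρ s ss)) (from (insert₀-good⇔ ρ s ss)) λ _ → weight231-insert₀ φ ρ)
             (sym (words-def l (s ∷ ss) φ)))
           (words-larger l s ss φ ≡.refl) ⟩
    words l (s ∷ ss) φ + conv s (λ i j → q ^ suc i * words (sum (i ∷ j ∷ ss)) (i ∷ j ∷ ss) (φ ∘ suc)) ∎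
    where
    l : ℕ
    l = s ℕ.+ sum ss

  motzkin≈words : ∀ m φ → motzkin q 0 m φ ≈ words m (m ∷ []) φ
  motzkin≈words m φ = trans
    (motzkin≈ q (λ ss → words (sum ss) ss) words-[] (λ ss → words-zero (sum ss) ss) words-suc m φ)
    (reflexive (≡.cong (λ n → words n (m ∷ []) φ) (ℕ.+-identityʳ m)))

-- From the given statistics to those of the scan.

cda≡0⇔ : (σ : Permutation′ m) → cda σ ≡ 0 ⇔ NoCda 1 0 σ
cda≡0⇔ {m} σ = mk⇔
  (λ eq x _ p r → contradiction (p , r) (#₁≡0⇒none cda? eq x))
  (λ nc → #₁-none cda? λ x (p , r) → contradiction (nc x z≤n p r) λ ())
  where
  cda? : ∀ x → Dec ((σ ⟨$⟩ˡ x) Fin.< x × x Fin.< (σ ⟨$⟩ʳ x))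
  cda? x = (σ ⟨$⟩ˡ x) Fin.<? x ×-dec x Fin.<? (σ ⟨$⟩ʳ x)

opaque
  unfolding excedances

  excedances≡exc : (σ : Permutation′ m) → excedances 1 0 σ ≡ exc σ
  excedances≡exc σ = #₁-cong (excedance? 1 0 σ) (λ i → i Fin.<? (σ ⟨$⟩ʳ i)) λ i → mk⇔ proj₂ (z≤n ,_)

  -- This is the effect of setting `r = t` in `N`: excedances and fixed points get the same weight
  -- and together are the weak excedances.
  excedances≡exc+fix : (σ : Permutation′ m) → excedances 0 0 σ ≡ exc σ ℕ.+ fix σ
  excedances≡exc+fix σ = #₁-+ (excedance? 0 0 σ) exc? fix? split
    where
    exc? : ∀ i → Dec (i Fin.< (σ ⟨$⟩ʳ i))
    exc? i = i Fin.<? (σ ⟨$⟩ʳ i)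
    fix? : ∀ i → Dec ((σ ⟨$⟩ʳ i) ≡ i)
    fix? i = (σ ⟨$⟩ʳ i) Fin.≟ i
    split : ∀ i → ind (excedance? 0 0 σ i) ≡ ind (exc? i) ℕ.+ ind (fix? i)
    split i with Fin.<-cmp i (σ ⟨$⟩ʳ i)
    ... | tri< lt ne _ = ≡.trans (ind-true (excedance? 0 0 σ i) (z≤n , ℕ.<⇒≤ lt))
            (≡.sym (≡.cong₂ ℕ._+_ (ind-true (exc? i) lt) (ind-false (fix? i) (ne ∘ ≡.sym))))
    ... | tri≈ nlt eq _ = ≡.trans (ind-true (excedance? 0 0 σ i) (z≤n , ℕ.≤-reflexive (≡.cong toℕ eq)))
            (≡.sym (≡.cong₂ ℕ._+_ (ind-false (exc? i) nlt) (ind-true (fix? i) (≡.sym eq))))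
    ... | tri> nlt ne gt = ≡.trans (ind-false (excedance? 0 0 σ i) λ (_ , le) → ℕ.<⇒≱ gt le)
            (≡.sym (≡.cong₂ ℕ._+_ (ind-false (exc? i) nlt) (ind-false (fix? i) (ne ∘ ≡.sym))))

avoids-cong : (σ τ : Permutation′ m) → σ ≈ₚ τ → Avoids p231 σ → Avoids p231 τ
avoids-cong σ τ eq av = from (avoids231⇔ τ) (avoidsSorted-cong 2F 0F 1F σ τ eq (to (avoids231⇔ σ) av))

ldd-cong : (σ τ : Permutation′ m) → σ ≈ₚ τ → ldd σ ≡ 0 → ldd τ ≡ 0
ldd-cong σ τ eq = from (ldd≡0⇔ τ) ∘ noDoubleDescent-cong σ τ eq ∘ to (ldd≡0⇔ σ)

m<2*suc⌊m/2⌋ : ∀ m → m ℕ.< 2 ℕ.* suc ⌊ m /2⌋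
m<2*suc⌊m/2⌋ zero          = s≤s z≤n
m<2*suc⌊m/2⌋ (suc zero)    = s≤s (s≤s z≤n)
m<2*suc⌊m/2⌋ (suc (suc m)) = ≡.subst (suc (suc m) ℕ.<_) (≡.sym (ℕ.*-suc 2 (suc ⌊ m /2⌋))) (s≤s (s≤s (m<2*suc⌊m/2⌋ m)))

⇔-trans : {A B C : Set} → A ⇔ B → B ⇔ C → A ⇔ C
⇔-trans e f = f ⇔-∘ e

-- Transfer from 231 to the patterns 132, 213 and 312.

module Classes {c ℓ} (R : CommutativeRing c ℓ) (q : CommutativeRing.Carrier R) where
  open CommutativeRing R hiding (zero)
  open Polynomials R
  open Sums R
  open import Algebra.Properties.Semiring.Exp semiring using (^-cong)
  open import Relation.Binary.Reasoning.Setoid setoid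

  stat? : (des′ ldd′ : Permutation′ m → ℕ) → ∀ k σ → Dec (des′ σ ≡ k × ldd′ σ ≡ 0)
  stat? des′ ldd′ k σ = des′ σ ℕ.≟ k ×-dec ldd′ σ ℕ.≟ 0

  ∑-class : (τ : Vec ℕ 3) (des′ ldd′ 31-2′ : Permutation′ m → ℕ) (ψ : Permutation′ m → Permutation′ m) →
    (∀ σ τ → σ ≈ₚ τ → ψ σ ≈ₚ ψ τ) → (∀ σ → ψ (ψ σ) ≈ₚ σ) →
    (∀ σ → Avoids τ σ ⇔ Avoids p231 (ψ σ)) → (∀ σ → des′ σ ≡ des (ψ σ)) → (∀ σ → ldd′ σ ≡ 0 ⇔ ldd (ψ σ) ≡ 0) →
    (∀ σ → 31-2′ σ ≡ ⟨31-2⟩ (ψ σ)) → ∀ k →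
    ∑[ π ∈ filter (stat? des′ ldd′ k) (𝔖 m τ) ] (q ^ (m ℕ.+ 31-2′ π)) ≈ ∑[ π ∈ 𝔖~231 m k ] (q ^ (m ℕ.+ ⟨31-2⟩ π))
  ∑-class {m} τ des′ ldd′ 31-2′ ψ ψ-cong ψψ av⇔ des≡ ldd⇔ 31-2≡ k = begin
    ∑[ π ∈ filter (stat? des′ ldd′ k) (𝔖 m τ) ] (q ^ (m ℕ.+ 31-2′ π))
      ≈⟨ ∑-filter² (stat? des′ ldd′ k) (avoids? τ) (perms m) _ ⟩
    ∑[ σ ∈ perms m ] ⟦ avoids? τ σ ×-dec stat? des′ ldd′ k σ ⟧ (q ^ (m ℕ.+ 31-2′ σ))
      ≈⟨ ∑-cong (perms m) (λ σ → ⟦⟧-cong (avoids? τ σ ×-dec stat? des′ ldd′ k σ) (class? (ψ σ))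
           (λ (av , d , l) → to (av⇔ σ) av , ≡.trans (≡.sym (des≡ σ)) d , to (ldd⇔ σ) l)
           (λ (av , d , l) → from (av⇔ σ) av , ≡.trans (des≡ σ) d , from (ldd⇔ σ) l)
           λ _ → ^-cong refl (≡.cong (m ℕ.+_) (31-2≡ σ))) ⟩
    ∑[ σ ∈ perms m ] F (ψ σ)
      ≈⟨ ∑-perms-involution ψ ψ-cong ψψ F (λ σ τ eq → ⟦⟧-cong (class? σ) (class? τ) (class-cong σ τ eq) (class-cong τ σ (≡.sym ∘ eq))
           λ _ → ^-cong refl (≡.cong (m ℕ.+_) (31-2-cong σ τ eq))) ⟩
    ∑ (perms m) F
      ≈⟨ ∑-filter² (stat? des ldd k) (avoids? p231) (perms m) _ ⟨
    ∑[ π ∈ 𝔖~231 m k ] (q ^ (m ℕ.+ ⟨31-2⟩ π)) ∎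
    where
    class? : ∀ σ → Dec (Avoids p231 σ × des σ ≡ k × ldd σ ≡ 0)
    class? σ = avoids? p231 σ ×-dec stat? des ldd k σ
    F : Permutation′ m → Carrier
    F σ = ⟦ class? σ ⟧ (q ^ (m ℕ.+ ⟨31-2⟩ σ))
    class-cong : ∀ σ τ → σ ≈ₚ τ → Avoids p231 σ × des σ ≡ k × ldd σ ≡ 0 → Avoids p231 τ × des τ ≡ k × ldd τ ≡ 0
    class-cong σ τ eq (av , d , l) = avoids-cong σ τ eq av , ≡.trans (≡.sym (descents-cong σ τ eq)) d , ldd-cong σ τ eq l

  ∑-132 : ∀ m k → ∑[ π ∈ 𝔖~132 m k ] (q ^ (m ℕ.+ ⟨2-13⟩ π)) ≈ ∑[ π ∈ 𝔖~231 m k ] (q ^ (m ℕ.+ ⟨31-2⟩ π))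
  ∑-132 m = ∑-class {m} p132 asc rda ⟨2-13⟩ rev (λ _ _ eq i → eq (Fin.opposite i)) rev-involutive
    (λ σ → ⇔-trans (avoids⇔ p132 0F 2F 1F σ) (⇔-trans (avoids132⇔ σ) (⇔-sym (avoids231⇔ (rev σ)))))
    asc≡des-rev
    (λ σ → ⇔-trans (rda≡0⇔ σ) (⇔-trans (noDoubleAscent-rev⇔ σ) (⇔-sym (ldd≡0⇔ (rev σ)))))
    2-13≡31-2-rev

  ∑-213 : ∀ m k → ∑[ π ∈ 𝔖~213 m k ] (q ^ (m ℕ.+ ⟨13-2⟩ π)) ≈ ∑[ π ∈ 𝔖~231 m k ] (q ^ (m ℕ.+ ⟨31-2⟩ π))
  ∑-213 m = ∑-class {m} p213 asc rda ⟨13-2⟩ comp (λ _ _ eq i → ≡.cong Fin.opposite (eq i)) comp-involutive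
    (λ σ → ⇔-trans (avoids⇔ p213 1F 0F 2F σ) (⇔-trans (avoids213⇔ σ) (⇔-sym (avoids231⇔ (comp σ)))))
    asc≡des-comp
    (λ σ → ⇔-trans (rda≡0⇔ σ) (⇔-trans (noDoubleAscent-comp⇔ σ) (⇔-sym (ldd≡0⇔ (comp σ)))))
    13-2≡31-2-comp

  -- The complement of 312 is 132, so the statistics pass through `asc` and `⟨2-13⟩` before the
  -- reversal.
  ∑-312 : ∀ m k → ∑[ π ∈ 𝔖~312 m k ] (q ^ (m ℕ.+ ⟨2-31⟩ π)) ≈ ∑[ π ∈ 𝔖~231 m k ] (q ^ (m ℕ.+ ⟨31-2⟩ π))
  ∑-312 m = ∑-class {m} p312 des ldd ⟨2-31⟩ rc (λ _ _ eq i → ≡.cong Fin.opposite (eq (Fin.opposite i))) rc-involutive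
    (λ σ → ⇔-trans (avoids⇔ p312 1F 2F 0F σ) (⇔-trans (avoids312⇔ σ) (⇔-sym (avoids231⇔ (rc σ)))))
    (λ σ → ≡.trans (des≡asc-comp σ) (asc≡des-rev (comp σ)))
    (λ σ → ⇔-trans (ldd≡0⇔ σ) (⇔-trans (noDoubleDescent-comp⇔ σ) (⇔-trans (noDoubleAscent-rev⇔ (comp σ)) (⇔-sym (ldd≡0⇔ (rc σ))))))
    (λ σ → ≡.trans (2-31≡2-13-comp σ) (2-13≡31-2-rev (comp σ)))

-- The γ-coefficients and the expansion of `N`.

module Coefficients {c ℓ} (R : CommutativeRing c ℓ) (q q⁻¹ : CommutativeRing.Carrier R)
  (q*q⁻¹≈1 : CommutativeRing._≈_ R (CommutativeRing._*_ R q q⁻¹) (CommutativeRing.1# R)) where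
  open CommutativeRing R hiding (zero)
  open Polynomials R
  open Sums R
  open Paths R
  open Expansion R
  open Avoiding321 R q
  open Avoiding231 R q
  open import Algebra.Properties.Semiring.Exp semiring using (^-cong; ^-congˡ; ^-homo-*)
  open import Algebra.Properties.CommutativeSemiring.Exp commutativeSemiring using (^-distrib-*)
  open import Algebra.Properties.CommutativeSemigroup *-commutativeSemigroup using (x∙yz≈y∙xz)
  open import Algebra.Solver.CommutativeMonoid *-commutativeMonoid using (solve; _⊕_; _⊜_)
  open import Relation.Binary.Reasoning.Setoid setoid

  1^≈1 : ∀ n → 1# ^ n ≈ 1#
  1^≈1 zero    = refl
  1^≈1 (suc n) = trans (*-identityˡ _) (1^≈1 n)

  q⁻¹^*q^ : ∀ k → q⁻¹ ^ k * q ^ k ≈ 1#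
  q⁻¹^*q^ k = trans (*-comm _ _) (trans (sym (^-distrib-* q q⁻¹ k)) (trans (^-congˡ k q*q⁻¹≈1) (1^≈1 k)))

  q⁻¹^-cancel : ∀ k n → q⁻¹ ^ k * q ^ (k ℕ.+ n) ≈ q ^ n
  q⁻¹^-cancel k n = trans (*-congˡ (^-homo-* q k n)) (trans (sym (*-assoc _ _ _))
    (trans (*-congʳ (q⁻¹^*q^ k)) (*-identityˡ _)))

  -- For `exc σ = k` the prefactor turns `q ^ inv σ` into `q ^ (m + inv σ - exc σ)`; for `des σ = k`
  -- it turns the weight of `weight231` into `q ^ (m + ⟨31-2⟩ σ)`.
  coefficient : ℕ → ℕ → Carrier
  coefficient m k = q ^ m * q⁻¹ ^ k * motzkin q 0 m (δ k)

  shift-weight : ∀ m k s r → m ℕ.+ s ≡ k ℕ.+ r → q ^ m * q⁻¹ ^ k * q ^ s ≈ q ^ r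
  shift-weight m k s r eq = begin
    q ^ m * q⁻¹ ^ k * q ^ s     ≈⟨ trans (*-congʳ (*-comm _ _)) (*-assoc _ _ _) ⟩
    q⁻¹ ^ k * (q ^ m * q ^ s)   ≈⟨ *-congˡ (^-homo-* q m s) ⟨
    q⁻¹ ^ k * q ^ (m ℕ.+ s)     ≈⟨ *-congˡ (^-cong refl eq) ⟩
    q⁻¹ ^ k * q ^ (k ℕ.+ r)     ≈⟨ q⁻¹^-cancel k r ⟩
    q ^ r                       ∎

  -- Bridges two ways of fixing a statistic: the classes put `e ≡ k` into the index set, the path
  -- sums put it into the weight through `δ k`.
  ⟦⟧-select : {P Q : Set} (Q? : Dec Q) (P? : Dec P) (e k : ℕ) → Q ⇔ (P × e ≡ k) → ∀ {x y} →
    (Q → x ≈ y) → (e ≢ k → y ≈ 0#) → ⟦ Q? ⟧ x ≈ ⟦ P? ⟧ y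
  ⟦⟧-select Q? P? e k equiv x≈y y≈0 with e ℕ.≟ k
  ... | yes eq = ⟦⟧-cong Q? P? (proj₁ ∘ to equiv) (λ p → from equiv (p , eq)) x≈y
  ... | no ne  = trans (⟦⟧-false Q? (ne ∘ proj₂ ∘ to equiv)) (sym (zero′ P?))
    where
    zero′ : {P : Set} (P? : Dec P) → ⟦ P? ⟧ _ ≈ 0#
    zero′ (yes _) = y≈0 ne
    zero′ (no _)  = refl

  γ~≈coefficient : ∀ m k → γ~ m k q ≈ coefficient m k
  γ~≈coefficient m k = begin
    γ~ m k q
      ≈⟨ ∑-filter² (λ σ → exc σ ℕ.≟ k ×-dec cda σ ℕ.≟ 0) (avoids? p321) (perms m) _ ⟩
    ∑[ σ ∈ perms m ] ⟦ class? σ ⟧ (q ^ (m ℕ.+ inv σ ℕ.∸ exc σ))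
      ≈⟨ ∑-cong (perms m) (λ σ → ⟦⟧-select (class? σ) (state? 1 0 0 0 σ) (exc σ) k (equiv σ) (value σ) (λ ne →
           trans (*-congˡ (weight≈ σ)) (trans (*-congˡ (trans (*-congʳ (δ-≢ k (exc σ) (ne ∘ ≡.sym))) (zeroˡ _))) (zeroʳ _)))) ⟩
    ∑[ σ ∈ perms m ] ⟦ state? 1 0 0 0 σ ⟧ (x * weight 1 0 (δ k) σ)
      ≈⟨ *-∑-⟦⟧ x (state? 1 0 0 0) (perms m) _ ⟨
    x * (∑[ σ ∈ perms m ] ⟦ state? 1 0 0 0 σ ⟧ weight 1 0 (δ k) σ)
      ≈⟨ *-congˡ (states-def 1 m 0 0 0 (δ k)) ⟨
    x * states 1 m 0 0 0 (δ k)
      ≈⟨ *-congˡ (strict≈motzkin m 0 (≡.sym (ℕ.+-identityʳ m)) (δ k)) ⟩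
    coefficient m k ∎
    where
    x : Carrier
    x = q ^ m * q⁻¹ ^ k
    class? : ∀ σ → Dec (Avoids p321 σ × exc σ ≡ k × cda σ ≡ 0)
    class? σ = avoids? p321 σ ×-dec exc σ ℕ.≟ k ×-dec cda σ ℕ.≟ 0
    weight≈ : ∀ (σ : Permutation′ m) → weight 1 0 (δ k) σ ≈ δ k (exc σ) * q ^ inv σ
    weight≈ σ = trans (weight-def 1 0 (δ k) σ) (*-congʳ (reflexive (≡.cong (δ k) (excedances≡exc σ))))
    equiv : ∀ σ → (Avoids p321 σ × exc σ ≡ k × cda σ ≡ 0) ⇔ (State 1 0 0 0 σ × exc σ ≡ k)
    equiv σ = mk⇔
      (λ (av , e , c) → (to (avoids321⇔ σ) av , (λ _ ()) , to (cda≡0⇔ σ) c) , e)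
      (λ ((av , _ , nc) , e) → from (avoids321⇔ σ) av , e , from (cda≡0⇔ σ) nc)
    value : ∀ σ → Avoids p321 σ × exc σ ≡ k × cda σ ≡ 0 → q ^ (m ℕ.+ inv σ ℕ.∸ exc σ) ≈ x * weight 1 0 (δ k) σ
    value σ (_ , ≡.refl , _) = begin
      q ^ (m ℕ.+ inv σ ℕ.∸ exc σ)          ≈⟨ shift-weight m (exc σ) (inv σ) _ (≡.sym (ℕ.m+[n∸m]≡n
        (ℕ.≤-trans (#₁-≤ (λ i → i Fin.<? (σ ⟨$⟩ʳ i))) (ℕ.m≤m+n m (inv σ))))) ⟨
      x * q ^ inv σ                        ≈⟨ *-congˡ (trans (*-congʳ (δ-≡ (exc σ))) (*-identityˡ _)) ⟨
      x * (δ (exc σ) (exc σ) * q ^ inv σ)  ≈⟨ *-congˡ (weight≈ σ) ⟨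
      x * weight 1 0 (δ k) σ               ∎

  ∑-231≈coefficient : ∀ m k → ∑[ π ∈ 𝔖~231 m k ] (q ^ (m ℕ.+ ⟨31-2⟩ π)) ≈ coefficient m k
  ∑-231≈coefficient m k = begin
    ∑[ π ∈ 𝔖~231 m k ] (q ^ (m ℕ.+ ⟨31-2⟩ π))
      ≈⟨ ∑-filter² (λ σ → des σ ℕ.≟ k ×-dec ldd σ ℕ.≟ 0) (avoids? p231) (perms m) _ ⟩
    ∑[ σ ∈ perms m ] ⟦ class? σ ⟧ (q ^ (m ℕ.+ ⟨31-2⟩ σ))
      ≈⟨ ∑-cong (perms m) (λ σ → ⟦⟧-select (class? σ) (good? (m ∷ []) σ) (des σ) k (equiv σ) (value σ) (λ ne →
           trans (*-congˡ (weight231-def (δ k) σ)) (trans (*-congˡ (trans (*-congʳ (δ-≢ k (des σ) (ne ∘ ≡.sym))) (zeroˡ _))) (zeroʳ _)))) ⟩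
    ∑[ σ ∈ perms m ] ⟦ good? (m ∷ []) σ ⟧ (x * weight231 (δ k) σ)
      ≈⟨ *-∑-⟦⟧ x (good? (m ∷ [])) (perms m) _ ⟨
    x * (∑[ σ ∈ perms m ] ⟦ good? (m ∷ []) σ ⟧ weight231 (δ k) σ)
      ≈⟨ *-congˡ (words-def m (m ∷ []) (δ k)) ⟨
    x * words m (m ∷ []) (δ k)
      ≈⟨ *-congˡ (motzkin≈words m (δ k)) ⟨
    coefficient m k ∎
    where
    x : Carrier
    x = q ^ m * q⁻¹ ^ k
    class? : ∀ σ → Dec (Avoids p231 σ × des σ ≡ k × ldd σ ≡ 0)
    class? σ = avoids? p231 σ ×-dec des σ ℕ.≟ k ×-dec ldd σ ℕ.≟ 0
    equiv : ∀ σ → (Avoids p231 σ × des σ ≡ k × ldd σ ≡ 0) ⇔ (Good (m ∷ []) σ × des σ ≡ k)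
    equiv σ = mk⇔
      (λ (av , d , l) → ((to (avoids231⇔ σ) av , to (ldd≡0⇔ σ) l) , (λ x _ _ _ → Fin.toℕ<n (σ ⟨$⟩ʳ x)) , tt) , d)
      (λ (((av , nd) , _) , d) → from (avoids231⇔ σ) av , d , from (ldd≡0⇔ σ) nd)
    value : ∀ σ → Avoids p231 σ × des σ ≡ k × ldd σ ≡ 0 → q ^ (m ℕ.+ ⟨31-2⟩ σ) ≈ x * weight231 (δ k) σ
    value σ (_ , ≡.refl , _) = begin
      q ^ (m ℕ.+ ⟨31-2⟩ σ)                                ≈⟨ shift-weight m (des σ) (⟨31-2⟩ σ ℕ.+ des σ) _
        (≡.trans (≡.sym (ℕ.+-assoc m (⟨31-2⟩ σ) (des σ))) (ℕ.+-comm _ (des σ))) ⟨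
      x * q ^ (⟨31-2⟩ σ ℕ.+ des σ)                        ≈⟨ *-congˡ (trans (*-congʳ (δ-≡ (des σ))) (*-identityˡ _)) ⟨
      x * (δ (des σ) (des σ) * q ^ (⟨31-2⟩ σ ℕ.+ des σ))  ≈⟨ *-congˡ (weight231-def (δ (des σ)) σ) ⟨
      x * weight231 (δ (des σ)) σ                         ∎

  module _ (t : Carrier) where

    N≈states : ∀ n → N n t q t ≈ states 0 n 0 0 0 (t ^_)
    N≈states n = begin
      N n t q t
        ≈⟨ ∑-filter (avoids? p321) (perms n) _ ⟩
      ∑[ σ ∈ perms n ] ⟦ avoids? p321 σ ⟧ (t ^ exc σ * q ^ inv σ * t ^ fix σ)
        ≈⟨ ∑-cong (perms n) (λ σ → ⟦⟧-cong (avoids? p321 σ) (state? 0 0 0 0 σ)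
             (λ av → to (avoids321⇔ σ) av , (λ _ ()) , λ _ _ _ _ → ≡.refl) (λ (av , _) → from (avoids321⇔ σ) av) λ _ → value σ) ⟩
      ∑[ σ ∈ perms n ] ⟦ state? 0 0 0 0 σ ⟧ weight 0 0 (t ^_) σ
        ≈⟨ states-def 0 n 0 0 0 (t ^_) ⟨
      states 0 n 0 0 0 (t ^_) ∎
      where
      value : ∀ (σ : Permutation′ n) → t ^ exc σ * q ^ inv σ * t ^ fix σ ≈ weight 0 0 (t ^_) σ
      value σ = begin
        t ^ exc σ * q ^ inv σ * t ^ fix σ    ≈⟨ trans (*-assoc _ _ _) (trans (*-congˡ (*-comm _ _)) (sym (*-assoc _ _ _))) ⟩
        t ^ exc σ * t ^ fix σ * q ^ inv σ    ≈⟨ *-congʳ (trans (^-cong refl (excedances≡exc+fix σ)) (^-homo-* t (exc σ) (fix σ))) ⟨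
        t ^ excedances 0 0 σ * q ^ inv σ     ≈⟨ weight-def 0 0 (t ^_) σ ⟨
        weight 0 0 (t ^_) σ                  ∎

    -- The index `k` is one less than in the theorem. Since `t + q = q * (1 + t * q⁻¹)`, the factors
    -- `(t * q) ^ k` and `(t + q) ^ (m - 2k)` release `q ^ k` and `q ^ (m - 2k)`, together the
    -- prefactor `q ^ (m - k)` of `coefficient`.
    summand : ∀ m k → t * (motzkin q 0 m (δ k) * term q t (m ℕ.+ 0) k) ≈
              γ~ m k q * t ^ suc k * (1# + t * q⁻¹) ^ (suc m ℕ.+ 1 ℕ.∸ 2 ℕ.* suc k)
    summand m k = trans (by-cases (2 ℕ.* k ℕ.≤? m)) (sym (*-cong (*-congʳ (γ~≈coefficient m k)) (^-cong refl exponent)))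
      where
      M : Carrier
      M = motzkin q 0 m (δ k)
      exponent : suc m ℕ.+ 1 ℕ.∸ 2 ℕ.* suc k ≡ m ℕ.∸ 2 ℕ.* k
      exponent = ≡.cong₂ ℕ._∸_ (≡.cong suc (ℕ.+-comm m 1)) (ℕ.*-suc 2 k)
      d : ℕ
      d = m ℕ.∸ 2 ℕ.* k
      y : Carrier
      y = 1# + t * q⁻¹
      qy : q * y ≈ t + q
      qy = begin
        q * (1# + t * q⁻¹)      ≈⟨ distribˡ q _ _ ⟩
        q * 1# + q * (t * q⁻¹)  ≈⟨ +-cong (*-identityʳ q) (trans (x∙yz≈y∙xz q t q⁻¹) (trans (*-congˡ q*q⁻¹≈1) (*-identityʳ t))) ⟩
        q + t                   ≈⟨ +-comm q t ⟩
        t + q                   ∎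
      by-cases : Dec (2 ℕ.* k ℕ.≤ m) → t * (M * term q t (m ℕ.+ 0) k) ≈ coefficient m k * t ^ suc k * y ^ d
      -- The powers of `q` need not balance when `2k > m`, but then `M` is 0 and both sides vanish.
      by-cases (no gt) = trans (vanish λ z → trans (*-congˡ (trans (*-congʳ z) (zeroˡ _))) (zeroʳ t))
        (sym (vanish λ z → trans (*-congʳ (trans (*-congʳ (trans (*-congˡ z) (zeroʳ _))) (zeroˡ _))) (zeroˡ _)))
        where
        vanish : ∀ {x} → (M ≈ 0# → x ≈ 0#) → x ≈ 0#
        vanish f = f (motzkin-δ-vanishes q t 0 m k (≡.subst (ℕ._< 2 ℕ.* k) (≡.sym (ℕ.+-identityʳ m)) (ℕ.≰⇒> gt)))
      by-cases (yes le) = begin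
        t * (M * ((t * q) ^ k * (t + q) ^ (m ℕ.+ 0 ℕ.∸ 2 ℕ.* k)))
          ≈⟨ *-congˡ (*-congˡ (*-cong (^-distrib-* t q k) (trans (^-cong refl (≡.cong (ℕ._∸ 2 ℕ.* k) (ℕ.+-identityʳ m)))
               (trans (^-congˡ d (sym qy)) (^-distrib-* q y d))))) ⟩
        t * (M * ((t ^ k * q ^ k) * (q ^ d * y ^ d)))
          ≈⟨ solve 6 (λ t M tk qk qd yd → t ⊕ (M ⊕ ((tk ⊕ qk) ⊕ (qd ⊕ yd))) ⊜ (((qk ⊕ qd) ⊕ M) ⊕ (t ⊕ tk)) ⊕ yd)
               refl t M (t ^ k) (q ^ k) (q ^ d) (y ^ d) ⟩
        q ^ k * q ^ d * M * t ^ suc k * y ^ d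
          ≈⟨ *-congʳ (*-congʳ (*-congʳ powers)) ⟨
        coefficient m k * t ^ suc k * y ^ d ∎
        where
        powers : q ^ m * q⁻¹ ^ k ≈ q ^ k * q ^ d
        powers = begin
          q ^ m * q⁻¹ ^ k              ≈⟨ *-comm _ _ ⟩
          q⁻¹ ^ k * q ^ m              ≈⟨ *-congˡ (^-cong refl (≡.trans (≡.sym (ℕ.m+[n∸m]≡n le))
            (≡.trans (≡.cong (ℕ._+ d) (≡.cong (k ℕ.+_) (ℕ.+-identityʳ k))) (ℕ.+-assoc k k d)))) ⟩
          q⁻¹ ^ k * q ^ (k ℕ.+ (k ℕ.+ d)) ≈⟨ q⁻¹^-cancel k (k ℕ.+ d) ⟩
          q ^ (k ℕ.+ d)                ≈⟨ ^-homo-* q k d ⟩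
          q ^ k * q ^ d                ∎

    N-expansion : ∀ m → N (suc m) t q t ≈
      ∑[ k ∈ [1‥ ⌊ suc m ℕ.+ 1 /2⌋ ] ] (γ~ m (k ℕ.∸ 1) q * t ^ k * (1# + t * q⁻¹) ^ (suc m ℕ.+ 1 ℕ.∸ 2 ℕ.* k))
    N-expansion m = begin
      N (suc m) t q t
        ≈⟨ N≈states (suc m) ⟩
      states 0 (suc m) 0 0 0 (t ^_)
        ≈⟨ reflexive (≡.cong (λ n → states 0 (suc n) 0 0 0 (t ^_)) (ℕ.+-identityʳ m)) ⟨
      states 0 (suc m ℕ.+ 0) 0 0 0 (t ^_)
        ≈⟨ weak-start t m ⟩
      t * bicoloured q t 0 m
        ≈⟨ *-congˡ (expansion≈bicoloured q t K 0 m bound) ⟨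
      t * expansion q t K 0 m
        ≈⟨ trans (*-∑ t (upTo K) _) (∑-cong (upTo K) (summand m)) ⟩
      ∑[ k ∈ upTo K ] (γ~ m k q * t ^ suc k * (1# + t * q⁻¹) ^ (suc m ℕ.+ 1 ℕ.∸ 2 ℕ.* suc k))
        ≈⟨ ∑-applyUpTo suc K (λ k → γ~ m (k ℕ.∸ 1) q * t ^ k * (1# + t * q⁻¹) ^ (suc m ℕ.+ 1 ℕ.∸ 2 ℕ.* k)) ⟨
      ∑[ k ∈ [1‥ K ] ] (γ~ m (k ℕ.∸ 1) q * t ^ k * (1# + t * q⁻¹) ^ (suc m ℕ.+ 1 ℕ.∸ 2 ℕ.* k)) ∎
      where
      K : ℕ
      K = ⌊ suc m ℕ.+ 1 /2⌋
      -- `K` is `1 + ⌊ m /2⌋`, the least number with `m < 2K`, so the range of the theorem is just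
      -- long enough.
      bound : m ℕ.+ 0 ℕ.< 2 ℕ.* K
      bound = ≡.subst₂ ℕ._<_ (≡.sym (ℕ.+-identityʳ m)) (≡.cong (λ n → 2 ℕ.* ⌊ suc n /2⌋) (ℕ.+-comm 1 m)) (m<2*suc⌊m/2⌋ m)

theorem3p14 : ∀ {c ℓ} (R : CommutativeRing c ℓ) →
    let open CommutativeRing R
        open Polynomials R
    in
    ∀ (t q q⁻¹ : Carrier) → q * q⁻¹ ≈ 1# →
    ∀ (n : ℕ) → 1 ≤ n →
      (N n t q t ≈
        ∑[ k ∈ [1‥ ⌊ n +ℕ 1 /2⌋ ] ] (γ~ (n ∸ 1) (k ∸ 1) q * t ^ k * (1# + t * q⁻¹) ^ (n +ℕ 1 ∸ 2 *ℕ k)))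
      ×
      (∀ (k : ℕ) → 1 ≤ k → k ≤ ⌊ n +ℕ 1 /2⌋ →
        (γ~ (n ∸ 1) (k ∸ 1) q ≈ ∑[ π ∈ 𝔖~231 (n ∸ 1) (k ∸ 1) ] (q ^ (n ∸ 1 +ℕ ⟨31-2⟩ π))) ×
        (γ~ (n ∸ 1) (k ∸ 1) q ≈ ∑[ π ∈ 𝔖~312 (n ∸ 1) (k ∸ 1) ] (q ^ (n ∸ 1 +ℕ ⟨2-31⟩ π))) ×
        (γ~ (n ∸ 1) (k ∸ 1) q ≈ ∑[ π ∈ 𝔖~132 (n ∸ 1) (k ∸ 1) ] (q ^ (n ∸ 1 +ℕ ⟨2-13⟩ π))) ×
        (γ~ (n ∸ 1) (k ∸ 1) q ≈ ∑[ π ∈ 𝔖~213 (n ∸ 1) (k ∸ 1) ] (q ^ (n ∸ 1 +ℕ ⟨13-2⟩ π))))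
theorem3p14 R t q q⁻¹ qq⁻¹ (suc m) _ = N-expansion t m , λ k _ _ →
  γ~≈231 (k ∸ 1) ,
  trans (γ~≈231 (k ∸ 1)) (sym (∑-312 m (k ∸ 1))) ,
  trans (γ~≈231 (k ∸ 1)) (sym (∑-132 m (k ∸ 1))) ,
  trans (γ~≈231 (k ∸ 1)) (sym (∑-213 m (k ∸ 1)))
  where
  open CommutativeRing R
  open Polynomials R
  open Coefficients R q q⁻¹ qq⁻¹
  open Classes R q
  γ~≈231 : ∀ k → γ~ m k q ≈ ∑[ π ∈ 𝔖~231 m k ] (q ^ (m +ℕ ⟨31-2⟩ π))
  γ~≈231 k = trans (γ~≈coefficient m k) (sym (∑-231≈coefficient m k))
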